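{- Let $\mathcal H=(V,E)$ be a connected hypergraph, and fix any ribbon structure on $\mathrm{Bip}\,\mathcal H$, base node $b_0$ and base edge $b_0b_1$. Then $\tilde I_{\mathcal H}=I_{\mathcal H}$. In particular $\tilde I_{\mathcal H}$ does not depend on the ribbon structure (nor on the base node and base edge).
   Context: A hypergraph is a pair $\mathcal H=(V,E)$ with $V$ a finite set and $E$ a finite multiset of nonempty subsets of $V$; $\mathrm{Bip}\,\mathcal H$ is the bipartite graph with color classes $V$ (violet) and $E$ (emerald), $v$ joined to $e$ iff $v\in e$; connected means $\mathrm{Bip}\,\mathcal H$ is connected. A hypertree on $E$ is $\mathbf f:E\to\mathbb Z_{\ge0}$ such that some spanning tree $T$ of $\mathrm{Bip}\,\mathcal H$ has $d_T(e)=\mathbf f(e)+1$ for all $e\in E$; $B_E$ is the set of hypertrees on $E$. Given a linear order on $E$, a hyperedge $e$ is internally active for $\mathbf f\in B_E$ if there is no $e'<e$ such that the vector obtained from $\mathbf f$ by decreasing its value at $e$ by $1$ and increasing its value at $e'$ by $1$ is a hypertree; otherwise $e$ is internally inactive, and $\bar\iota(\mathbf f)$ denotes the number of internally inactive hyperedges. The interior polynomial is $I_{\mathcal H}(\xi)=\sum_{\mathbf f\in B_E}\xi^{\bar\iota(\mathbf f)}$ for any fixed linear order on $E$ (it is known not to depend on the order). A ribbon structure on a loopless graph assigns to every node $x$ a cyclic permutation of its incident edges; $xy^+$ is the edge following $xy$ in the cyclic order at $x$; subgraphs inherit the restricted cyclic orders, $xy^+_G$ denoting the successor in subgraph $G$.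 The (ht:$E$, cut:$E$) Bernardi process on $\mathbf f\in B_E$: keep a current graph $G$ (initially $\mathrm{Bip}\,\mathcal H$) and current edge. If $b_0\in E$ the first current edge is $b_0b_1$; if $b_0\in V$ it is $b_1b_0^+$ and $b_0b_1$ counts as traversed from its violet endpoint. With current edge $ev$ ($e\in E$, $v\in V$): if $\mathbf f$ is still a hypertree on $E$ in $G-ev$, then $ev$ is removed, the current graph becomes $G-ev$ and the next current edge is $ev^+_G$; otherwise $ev$ is traversed from $e$, $vd:=ve^+_G$ is traversed from $v$, and the next current edge is $dv^+_G$. The process stops right before an edge would be traversed a second time from the same endpoint; every edge of $\mathrm{Bip}\,\mathcal H$ is current exactly once. For $\mathbf f\in B_E$, define the order $<_{\mathbf f}$ on $E$ by $e_1<_{\mathbf f}e_2$ iff some edge incident to $e_1$ becomes current earlier than every edge incident to $e_2$ in this process run on $\mathbf f$. Let $\overline{ie}(\mathbf f)$ be the number of internally inactive hyperedges for $\mathbf f$ with respect to $<_{\mathbf f}$, and $\tilde I_{\mathcal H}(\xi)=\sum_{\mathbf f\in B_E}\xi^{\overline{ie}(\mathbf f)}$. -}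

module Defs where

open import Data.Nat using (ℕ; zero; suc; _≤_; pred)
open import Data.Fin as Fin using (Fin)
open import Data.Bool using (Bool; true; false; if_then_else_; _∧_)
open import Data.List as List using (List; []; _∷_; _++_; length; map; allFin; [_])
open import Data.Nat.ListAction using (sum)
open import Data.Vec as Vec using (Vec; _[_]%=_)
open import Data.Product using (Σ; ∃; _×_; _,_; proj₁; proj₂)
open import Data.Sum using (_⊎_; inj₁; inj₂)
open import Relation.Nullary using (¬_; yes; no)
open import Relation.Nullary.Decidable using (⌊_⌋)
open import Relation.Binary.PropositionalEquality using (_≡_)
open import Relation.Binary.Definitions using (DecidableEquality)
open import Relation.Binary.Construct.Closure.ReflexiveTransitive using (Star)
open import Data.List.Relation.Unary.Unique.Propositional using (Unique)
open import Data.List.Relation.Unary.Linked using (Linked)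
open import Data.List.Membership.Propositional using (_∈_)
open import Function.Bundles using (_⇔_)

HasCard : {A : Set} → (A → Set) → ℕ → Set
HasCard {A} P k =
  Σ (List A) λ xs → Unique xs × (∀ x → (x ∈ xs) ⇔ P x) × length xs ≡ k

-- Successor in a cyclic order given by a duplicate-free list, restricted
-- to the elements satisfying `keep` (i.e. successor in a subgraph).
-- cycSucc keep xs y: the first element after y (cyclically) that is kept;
-- if there is none, y itself.

module _ {A : Set} (_≟A_ : DecidableEquality A) where
  breakAt : A → List A → List A × List A
  breakAt y [] = [] , []
  breakAt y (x ∷ xs) with x ≟A y
  ... | yes _ = [] , xs
  ... | no _ = (x ∷ proj₁ (breakAt y xs)) , proj₂ (breakAt y xs)

  firstKept : (A → Bool) → A → List A → A
  firstKept keep d [] = d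
  firstKept keep d (x ∷ xs) = if keep x then x else firstKept keep d xs

  cycSucc : (A → Bool) → List A → A → A
  cycSucc keep xs y = firstKept keep y (proj₂ (breakAt y xs) ++ proj₁ (breakAt y xs))

-- Hypergraphs with hyperedges E = Fin m and vertices V = Fin n.
-- A subgraph of Bip H (or any bipartite graph between E and V) is an
-- edge set  G : Fin m → Fin n → Bool  (G e v = true iff edge ev present).

EdgeSet : ℕ → ℕ → Set
EdgeSet m n = Fin m → Fin n → Bool

-- nodes of the bipartite graph: inj₁ = emerald (hyperedge), inj₂ = violet
Node : ℕ → ℕ → Set
Node m n = Fin m ⊎ Fin n

record Hypergraph (m n : ℕ) : Set where
  field
    inc      : EdgeSet m n
    nonempty : ∀ e → ∃ λ v → inc e v ≡ true
open Hypergraph public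

module _ {m n : ℕ} where

  data Adj (G : EdgeSet m n) : Node m n → Node m n → Set where
    ev : ∀ {e v} → G e v ≡ true → Adj G (inj₁ e) (inj₂ v)
    ve : ∀ {e v} → G e v ≡ true → Adj G (inj₂ v) (inj₁ e)

  Connected : EdgeSet m n → Set
  Connected G = ∀ x y → Star (Adj G) x y

  HasCycle : EdgeSet m n → Set
  HasCycle G = Σ (Node m n) λ x → Σ (List (Node m n)) λ xs →
    Unique (x ∷ xs) × 2 ≤ length xs × Linked (Adj G) (x ∷ xs ++ [ x ])

  IsTree : EdgeSet m n → Set
  IsTree T = Connected T × ¬ HasCycle T

  _⊆E_ : EdgeSet m n → EdgeSet m n → Set
  T ⊆E G = ∀ e v → T e v ≡ true → G e v ≡ true

  IsSpanningTreeOf : EdgeSet m n → EdgeSet m n → Set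
  IsSpanningTreeOf G T = T ⊆E G × IsTree T

  deg : EdgeSet m n → Fin m → ℕ
  deg T e = sum (map (λ v → if T e v then 1 else 0) (allFin n))

  removeEdge : EdgeSet m n → Fin m → Fin n → EdgeSet m n
  removeEdge G e v e' v' =
    if ⌊ e' Fin.≟ e ⌋ ∧ ⌊ v' Fin.≟ v ⌋ then false else G e' v'

  IsHypertreeIn : EdgeSet m n → Vec ℕ m → Set
  IsHypertreeIn G f = ∃ λ T → IsSpanningTreeOf G T × (∀ e → deg T e ≡ suc (Vec.lookup f e))

  -- decrease at e by one, increase at e' by one (only used when f e ≥ 1)
  move : Vec ℕ m → Fin m → Fin m → Vec ℕ m
  move f e e' = (f [ e ]%= pred) [ e' ]%= suc

  InternallyInactive : EdgeSet m n → (Fin m → Fin m → Set) → Vec ℕ m → Fin m → Set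
  InternallyInactive G _≺_ f e =
    ∃ λ e' → e' ≺ e × 1 ≤ Vec.lookup f e × IsHypertreeIn G (move f e e')

  InactiveCount : EdgeSet m n → (Fin m → Fin m → Set) → Vec ℕ m → ℕ → Set
  InactiveCount G _≺_ f k = HasCard (InternallyInactive G _≺_ f) k

-- coefficient of ξ^k in the interior polynomial is c
-- (the fixed linear order on E = Fin m is the natural one)
InteriorCoeff : {m n : ℕ} → Hypergraph m n → ℕ → ℕ → Set
InteriorCoeff H k c =
  HasCard (λ f → IsHypertreeIn (inc H) f × InactiveCount (inc H) Fin._<_ f k) c

-- Ribbon structure on Bip H: at each node a cyclic order of its incident
-- edges, given by a duplicate-free list of the neighbours (read cyclically).

record Ribbon {m n : ℕ} (H : Hypergraph m n) : Set where
  field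
    rotE     : Fin m → List (Fin n)
    rotE-uniq : ∀ e → Unique (rotE e)
    rotE-mem : ∀ e v → (v ∈ rotE e) ⇔ (inc H e v ≡ true)
    rotV     : Fin n → List (Fin m)
    rotV-uniq : ∀ v → Unique (rotV v)
    rotV-mem : ∀ v e → (e ∈ rotV v) ⇔ (inc H e v ≡ true)
open Ribbon public

data Base {m n : ℕ} (H : Hypergraph m n) : Set where
  baseE : (b₀ : Fin m) (b₁ : Fin n) → inc H b₀ b₁ ≡ true → Base H
  baseV : (b₀ : Fin n) (b₁ : Fin m) → inc H b₁ b₀ ≡ true → Base H

data Side : Set where
  fromEmerald fromViolet : Side

-- The (ht:E, cut:E) Bernardi process.
-- Current edges are written (e , v) with e emerald, v violet.
-- A traversal record (e , v , s): edge ev traversed from its endpoint of side s.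
-- Run G c tr L : starting with current graph G, current edge c and the
-- traversals tr already made, the process stops, and L is the list of
-- edges that become current (in order).

module Process {m n : ℕ} (H : Hypergraph m n) (ρ : Ribbon H) (f : Vec ℕ m) where

  Trav : Set
  Trav = Fin m × Fin n × Side

  succAtE : EdgeSet m n → Fin m → Fin n → Fin n
  succAtE G e v = cycSucc Fin._≟_ (λ w → G e w) (rotE ρ e) v

  succAtV : EdgeSet m n → Fin n → Fin m → Fin m
  succAtV G v e = cycSucc Fin._≟_ (λ d → G d v) (rotV ρ v) e

  data Run : EdgeSet m n → Fin m × Fin n → List Trav → List (Fin m × Fin n) → Set where
    remove : ∀ {G e v tr L} →
      IsHypertreeIn (removeEdge G e v) f →
      Run (removeEdge G e v) (e , succAtE (removeEdge G e v) e v) tr L →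
      Run G (e , v) tr ((e , v) ∷ L)
    stopE : ∀ {G e v tr} →
      ¬ IsHypertreeIn (removeEdge G e v) f →
      (e , v , fromEmerald) ∈ tr →
      Run G (e , v) tr [ (e , v) ]
    stopV : ∀ {G e v tr} →
      ¬ IsHypertreeIn (removeEdge G e v) f →
      ¬ ((e , v , fromEmerald) ∈ tr) →
      (succAtV G v e , v , fromViolet) ∈ tr →
      Run G (e , v) tr [ (e , v) ]
    traverse : ∀ {G e v tr L} →
      ¬ IsHypertreeIn (removeEdge G e v) f →
      ¬ ((e , v , fromEmerald) ∈ tr) →
      ¬ ((succAtV G v e , v , fromViolet) ∈ tr) →
      Run G (succAtV G v e , succAtE G (succAtV G v e) v)
          ((succAtV G v e , v , fromViolet) ∷ (e , v , fromEmerald) ∷ tr) L →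
      Run G (e , v) tr ((e , v) ∷ L)

  RunFrom : Base H → List (Fin m × Fin n) → Set
  RunFrom (baseE b₀ b₁ _) L = Run (inc H) (b₀ , b₁) [] L
  RunFrom (baseV b₀ b₁ _) L =
    Run (inc H) (b₁ , succAtE (inc H) b₁ b₀) [ (b₁ , b₀ , fromViolet) ] L

CurrentOrder : {m n : ℕ} → List (Fin m × Fin n) → Fin m → Fin m → Set
CurrentOrder L e₁ e₂ =
  ∃ λ (i : Fin (length L)) → proj₁ (List.lookup L i) ≡ e₁ ×
    (∀ (j : Fin (length L)) → proj₁ (List.lookup L j) ≡ e₂ → i Fin.< j)

IeBar : {m n : ℕ} (H : Hypergraph m n) → Ribbon H → Base H → Vec ℕ m → ℕ → Set
IeBar H ρ b f k = ∃ λ L → Process.RunFrom H ρ f b L × InactiveCount (inc H) (CurrentOrder L) f k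

TildeCoeff : {m n : ℕ} (H : Hypergraph m n) → Ribbon H → Base H → ℕ → ℕ → Set
TildeCoeff H ρ b k c = HasCard (λ f → IsHypertreeIn (inc H) f × IeBar H ρ b f k) c

{-# OPTIONS --safe #-}
module Submission where

-- By Hall's condition (Lovász), f is a hypertree in G iff 1 + Σ f = |V| and 1 + f(U) ≤ |N_G(U)| for every nonempty
-- U ⊆ E; so a transfer f − 1ₐ + 1_b of a hypertree f fails to be a hypertree iff a tight set (one with equality)
-- contains b but not a.
--
-- Exchanging two consecutive hyperedges a, b of an order, after a common initial segment h, changes the number of
-- inactive hyperedges only for those f from which neither a nor b can transfer to h. These f form lines in direction
-- 1ₐ − 1_b along which the activity of all other hyperedges is constant, so the distribution of the number of
-- inactive hyperedges does not change, for any family of hypertrees that is a union of such lines.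
--
-- The Bernardi process is a decision tree on hypertrees. If it has met only the hyperedges of h, then it cannot
-- separate two consecutive points of such a line (submodularity of |N_G|). Hence at each node of the decision
-- tree the newly met hyperedge may be moved to the front of the hyperedges not yet met, and by induction <_f can be
-- replaced by the fixed order. The process meets every hyperedge because it is a tour of a spanning tree.

open import Defs
open import Data.Nat as ℕ using (ℕ; zero; suc; _+_; _≤_; _<_; z≤n; s≤s; pred; _≤?_)
open import Data.Nat.Properties as ℕₚ using (+-0-commutativeMonoid; ≤-refl; ≤-trans; ≤-reflexive; +-mono-≤; +-monoʳ-≤; +-monoˡ-≤; +-mono-<-≤; +-mono-≤-<; m≤m+n; m≤n+m; <-irrefl; ≮⇒≥; ≰⇒>)
open import Data.Nat.ListAction using (sum)
open import Data.Nat.Tactic.RingSolver using (solve-∀)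
import Algebra.Properties.CommutativeMonoid.Sum as CommutativeMonoidSum
open import Data.Bool as Bool using (Bool; true; false; if_then_else_; _∧_; _∨_; not; _xor_)
open import Data.Bool.Properties using (∧-zeroʳ)
open import Data.Empty using (⊥; ⊥-elim)
open import Data.Fin as Fin using (Fin; zero; suc)
open import Data.Fin.Properties as Finₚ using (any?; suc-injective)
open import Data.Fin.Subset.Properties using (anySubset?)
open import Data.List as List using (List; []; _∷_; _++_; length; map; allFin; [_]; filter; upTo; cartesianProductWith)
open import Data.List.Properties using (map-tabulate; length-map; length-++; ++-assoc; ++-identityʳ; ∷-injective)
open import Data.List.Membership.Propositional using (_∈_; _∉_)
open import Data.List.Membership.Propositional.Properties using (∈-++⁺ˡ; ∈-++⁺ʳ; ∈-++⁻; ∈-∃++; ∈-filter⁺; ∈-filter⁻; ∈-map⁻; ∈-allFin; ∈-upTo⁺; ∈-cartesianProductWith⁺)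
import Data.List.Membership.DecPropositional as DecMembership
open import Data.List.Relation.Unary.All as All using (All; []; _∷_)
import Data.List.Relation.Unary.All.Properties as Allₚ
open import Data.List.Relation.Unary.AllPairs using ([]; _∷_)
open import Data.List.Relation.Unary.Any using (here; there)
open import Data.List.Relation.Unary.Linked using (Linked; []; [-]; _∷_)
open import Data.List.Relation.Unary.Unique.Propositional using (Unique)
import Data.List.Relation.Unary.Unique.Propositional.Properties as Uniqueₚ
open import Data.Product using (∃; _×_; _,_; proj₁; proj₂)
open import Data.Product.Properties using () renaming (≡-dec to ×-≡-dec)
open import Data.Sum using (_⊎_; inj₁; inj₂)
open import Data.Sum.Properties using (≡-dec)
open import Data.Vec as Vec using (Vec; lookup; tabulate; _[_]%=_)
import Data.Vec.Properties as Vecₚ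
open import Data.Vec.Properties using (lookup∘tabulate; lookup∘updateAt; lookup∘updateAt′; tabulate∘lookup; tabulate-cong)
open import Function using (_∘_)
open import Function.Bundles using (Equivalence; _⇔_; mk⇔)
open import Relation.Binary.Construct.Closure.ReflexiveTransitive as Star using (Star; ε; _◅_; _◅◅_)
open import Relation.Binary.Definitions using (DecidableEquality)
open import Relation.Binary.PropositionalEquality using (_≡_; _≢_; refl; sym; trans; cong; cong₂; subst; subst₂)
open import Relation.Nullary using (¬_; Dec; yes; no; contradiction)
open import Relation.Nullary.Decidable using (⌊_⌋; _×-dec_; _⊎-dec_; ¬?; map′)
open import Relation.Unary using (Decidable)

-- The order <_f varies with f, so no exchange can be carried out for all hypertrees at once. Only
-- hypertrees whose runs have reached the same node of the decision tree share an initial segment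
-- `h`; hence the exchange result is needed for subfamilies, and the questions asked by the process
-- must respect the lines. On a line, the order a, b makes b inactive except at the one end from
-- which no further unit can go from b to a, while a is active throughout; the order b, a does the
-- same with the other end exceptional. The counts differ at individual points, and only their
-- distribution agrees. The second obstacle is completeness: when the process stops it must have met
-- every hyperedge, yet while it runs the current graph may still contain many trees. So no tree is
-- fixed in advance: at each stage there is some tree containing all traversed edges, and only its
-- existence is used.

module ∑ = CommutativeMonoidSum +-0-commutativeMonoid
open ∑ using () renaming (sum to ∑; sum-cong-≗ to ∑-cong; ∑-distrib-+ to ∑-+)

-- Finite sums

∑-mono : ∀ {k} {f g : Fin k → ℕ} → (∀ i → f i ≤ g i) → ∑ f ≤ ∑ g
∑-mono {zero}  le = z≤n
∑-mono {suc k} le = +-mono-≤ (le zero) (∑-mono (le ∘ suc))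

∑-mono-< : ∀ {k} {f g : Fin k → ℕ} → (∀ i → f i ≤ g i) → ∀ i → f i < g i → ∑ f < ∑ g
∑-mono-< le zero    lt = +-mono-<-≤ lt (∑-mono (le ∘ suc))
∑-mono-< le (suc i) lt = +-mono-≤-< (le zero) (∑-mono-< (le ∘ suc) i lt)

∑-squeeze : ∀ {k} {f g : Fin k → ℕ} → (∀ i → f i ≤ g i) → ∑ g ≤ ∑ f → ∀ i → g i ≤ f i
∑-squeeze le ge i = ≮⇒≥ λ lt → <-irrefl refl (≤-trans (∑-mono-< le i lt) ge)

∑-zero : ∀ {k} {f : Fin k → ℕ} → (∀ i → f i ≡ 0) → ∑ f ≡ 0
∑-zero {zero}  z = refl
∑-zero {suc k} z = cong₂ _+_ (z zero) (∑-zero (z ∘ suc))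

∑-single : ∀ {k} {f : Fin k → ℕ} a → (∀ i → i ≢ a → f i ≡ 0) → ∑ f ≡ f a
∑-single {f = f} zero    z = trans (cong (f zero +_) (∑-zero λ i → z (suc i) λ ())) (ℕₚ.+-identityʳ _)
∑-single (suc a) z = cong₂ _+_ (z zero λ ()) (∑-single a λ i i≢a → z (suc i) (i≢a ∘ Finₚ.suc-injective))

term≤∑ : ∀ {k} (f : Fin k → ℕ) i → f i ≤ ∑ f
term≤∑ f zero    = m≤m+n _ _
term≤∑ f (suc i) = ≤-trans (term≤∑ (f ∘ suc) i) (m≤n+m _ _)

∑-one : ∀ k → ∑ {k} (λ _ → 1) ≡ k
∑-one zero    = refl
∑-one (suc k) = cong suc (∑-one k)

-- Boolean predicates on finite sets

infix 4 _==_
_==_ : ∀ {k} → Fin k → Fin k → Bool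
i == j = ⌊ i Fin.≟ j ⌋

==-refl : ∀ {k} (i : Fin k) → (i == i) ≡ true
==-refl i with i Fin.≟ i
... | yes _ = refl
... | no ne = contradiction refl ne

==-≢ : ∀ {k} {i j : Fin k} → i ≢ j → (i == j) ≡ false
==-≢ {i = i} {j} ne with i Fin.≟ j
... | yes p = contradiction p ne
... | no _  = refl

==-sound : ∀ {k} {i j : Fin k} → (i == j) ≡ true → i ≡ j
==-sound {i = i} {j} eq with i Fin.≟ j
... | yes p = p

true≢false : ∀ {b} → b ≡ true → b ≡ false → ⊥
true≢false refl ()

¬true : ∀ {b} → ¬ b ≡ true → b ≡ false
¬true {false} _ = refl
¬true {true}  h = contradiction refl h

∧-true : ∀ {a b} → a ∧ b ≡ true → a ≡ true × b ≡ true
∧-true {true} {true} _ = refl , refl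

∧-intro : ∀ {a b} → a ≡ true → b ≡ true → a ∧ b ≡ true
∧-intro refl refl = refl

∨-true : ∀ {a b} → a ∨ b ≡ true → a ≡ true ⊎ b ≡ true
∨-true {true}  _ = inj₁ refl
∨-true {false} p = inj₂ p

∨-introˡ : ∀ {a b} → a ≡ true → a ∨ b ≡ true
∨-introˡ refl = refl

∨-introʳ : ∀ {a b} → b ≡ true → a ∨ b ≡ true
∨-introʳ {true}  _ = refl
∨-introʳ {false} p = p

b2n : Bool → ℕ
b2n b = if b then 1 else 0

b2n-mono : ∀ {b c} → (b ≡ true → c ≡ true) → b2n b ≤ b2n c
b2n-mono {false} imp = z≤n
b2n-mono {true}  imp rewrite imp refl = ≤-refl

b2n≤1 : ∀ b → b2n b ≤ 1
b2n≤1 true  = ≤-refl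
b2n≤1 false = z≤n

b2n-≤⇒ : ∀ {b c} → b2n b ≤ b2n c → b ≡ true → c ≡ true
b2n-≤⇒ {c = true} _ _ = refl
b2n-≤⇒ {c = false} () refl

∑-δ : ∀ {k} (a : Fin k) → ∑ (λ i → b2n (i == a)) ≡ 1
∑-δ a = trans (∑-single a λ i i≢a → cong b2n (==-≢ i≢a)) (cong b2n (==-refl a))

anyF : ∀ {k} → (Fin k → Bool) → Bool
anyF p = ⌊ any? (λ i → p i Bool.≟ true) ⌋

anyF-intro : ∀ {k} {p : Fin k → Bool} i → p i ≡ true → anyF p ≡ true
anyF-intro {p = p} i pi with any? (λ i → p i Bool.≟ true)
... | yes _ = refl
... | no ne = contradiction (i , pi) ne

anyF-elim : ∀ {k} {p : Fin k → Bool} → anyF p ≡ true → ∃ λ i → p i ≡ true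
anyF-elim {p = p} eq with any? (λ i → p i Bool.≟ true)
... | yes e = e

-- Subsets and weighted sums

card : ∀ {k} → (Fin k → Bool) → ℕ
card U = ∑ (b2n ∘ U)

wsum : ∀ {k} → (Fin k → Bool) → (Fin k → ℕ) → ℕ
wsum U g = ∑ (λ e → if U e then g e else 0)

_∪_ _∩_ : ∀ {k} → (Fin k → Bool) → (Fin k → Bool) → (Fin k → Bool)
(U ∪ D) e = U e ∨ D e
(U ∩ D) e = U e ∧ D e

card-full : ∀ {k} {U : Fin k → Bool} → (∀ i → U i ≡ true) → card U ≡ k
card-full {k} all = trans (∑-cong λ i → cong b2n (all i)) (∑-one k)

card≤ : ∀ {k} (U : Fin k → Bool) → card U ≤ k
card≤ {k} U = ≤-trans (∑-mono λ i → b2n≤1 (U i)) (≤-reflexive (∑-one k))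

card-nonfull : ∀ {k} {U : Fin k → Bool} i → U i ≡ false → card U < k
card-nonfull {k} {U} i Ui = ≤-trans (∑-mono-< (λ j → b2n≤1 (U j)) i (≤-reflexive (cong (suc ∘ b2n) Ui))) (≤-reflexive (∑-one k))

card≡⇒full : ∀ {k} {U : Fin k → Bool} → k ≤ card U → ∀ i → U i ≡ true
card≡⇒full {k} {U} le i with U i in eq
... | true = refl
... | false = contradiction (≤-trans (card-nonfull i eq) le) (<-irrefl refl)

wsum-cong : ∀ {k} (U : Fin k → Bool) {g h : Fin k → ℕ} → (∀ e → g e ≡ h e) → wsum U g ≡ wsum U h
wsum-cong U eq = ∑-cong λ e → cong (λ z → if U e then z else 0) (eq e)

wsum-+ : ∀ {k} (U : Fin k → Bool) (g h : Fin k → ℕ) → wsum U (λ e → g e + h e) ≡ wsum U g + wsum U h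
wsum-+ {k} U g h = trans (∑-cong pt) (∑-+ {k} (λ e → if U e then g e else 0) (λ e → if U e then h e else 0))
  where
  pt : ∀ e → (if U e then g e + h e else 0) ≡ (if U e then g e else 0) + (if U e then h e else 0)
  pt e with U e
  ... | true  = refl
  ... | false = refl

wsum-∪∩ : ∀ {k} (U D : Fin k → Bool) (g : Fin k → ℕ) → wsum (U ∪ D) g + wsum (U ∩ D) g ≡ wsum U g + wsum D g
wsum-∪∩ {k} U D g = trans (sym (∑-+ {k} (λ e → if U e ∨ D e then g e else 0) (λ e → if U e ∧ D e then g e else 0)))
  (trans (∑-cong pt) (∑-+ {k} (λ e → if U e then g e else 0) (λ e → if D e then g e else 0)))
  where
  pt : ∀ e → (if U e ∨ D e then g e else 0) + (if U e ∧ D e then g e else 0) ≡ (if U e then g e else 0) + (if D e then g e else 0)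
  pt e with U e | D e
  ... | true  | true  = refl
  ... | true  | false = refl
  ... | false | true  = ℕₚ.+-identityʳ _
  ... | false | false = refl

wsum-δ : ∀ {k} (U : Fin k → Bool) (a : Fin k) → wsum U (λ e → b2n (e == a)) ≡ b2n (U a)
wsum-δ U a = trans (∑-single a off) on
  where
  off : ∀ i → i ≢ a → (if U i then b2n (i == a) else 0) ≡ 0
  off i ne with U i
  ... | true  = cong b2n (==-≢ ne)
  ... | false = refl
  on : (if U a then b2n (a == a) else 0) ≡ b2n (U a)
  on with U a
  ... | true  = cong b2n (==-refl a)
  ... | false = refl

wsum-full : ∀ {k} {U : Fin k → Bool} (g : Fin k → ℕ) → (∀ i → U i ≡ true) → wsum U g ≡ ∑ g
wsum-full g all = ∑-cong λ i → cong (λ b → if b then g i else 0) (all i)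

-- Node sets and edge counts

b2n-∨ : ∀ {b c d} → (b ≡ true → c ≡ true ⊎ d ≡ true) → b2n b ≤ b2n c + b2n d
b2n-∨ {false} h = z≤n
b2n-∨ {true} {c} {d} h with h refl
... | inj₁ refl = m≤m+n 1 (b2n d)
... | inj₂ refl = m≤n+m 1 (b2n c)

card-add : ∀ {k} {U : Fin k → Bool} {a} → U a ≡ false → card (λ i → U i ∨ (i == a)) ≡ suc (card U)
card-add {k} {U} {a} Ua = trans (∑-cong pt) (trans (∑-+ {k} (λ i → b2n (i == a)) (b2n ∘ U)) (cong (_+ card U) (∑-δ a)))
  where
  pt : ∀ i → b2n (U i ∨ (i == a)) ≡ b2n (i == a) + b2n (U i)
  pt i with i Fin.≟ a
  ... | yes refl rewrite Ua = refl
  ... | no _ with U i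
  ...   | true  = refl
  ...   | false = refl

card-cong : ∀ {k} {U W : Fin k → Bool} → (∀ i → U i ≡ W i) → card U ≡ card W
card-cong eq = ∑-cong λ i → cong b2n (eq i)

∨-false : ∀ b → b ∨ false ≡ b
∨-false true  = refl
∨-false false = refl

module _ {m n : ℕ} where

  infix 4 _≟ᴺ_
  _≟ᴺ_ : DecidableEquality (Node m n)
  _≟ᴺ_ = ≡-dec Fin._≟_ Fin._≟_

  edges : EdgeSet m n → ℕ
  edges G = ∑ λ e → ∑ λ v → b2n (G e v)

  size : (Node m n → Bool) → ℕ
  size X = card (X ∘ inj₁) + card (X ∘ inj₂)

  _∣_ : EdgeSet m n → (Node m n → Bool) → EdgeSet m n
  (G ∣ X) e v = G e v ∧ (X (inj₁ e) ∧ X (inj₂ v))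

  Closed : EdgeSet m n → (Node m n → Bool) → Set
  Closed G X = ∀ {u w} → Adj G u w → X u ≡ true → X w ≡ true

  single : Node m n → Node m n → Bool
  single (inj₁ e) (inj₁ e') = e' == e
  single (inj₁ e) (inj₂ v)  = false
  single (inj₂ v) (inj₁ e)  = false
  single (inj₂ v) (inj₂ v') = v' == v

  single-self : ∀ x → single x x ≡ true
  single-self (inj₁ e) = ==-refl e
  single-self (inj₂ v) = ==-refl v

  single-sound : ∀ {x y} → single x y ≡ true → y ≡ x
  single-sound {inj₁ e} {inj₁ e'} p = cong inj₁ (==-sound p)
  single-sound {inj₂ v} {inj₂ v'} p = cong inj₂ (==-sound p)

  insert : (Node m n → Bool) → Node m n → Node m n → Bool
  insert X w z = X z ∨ single w z

  size-single : ∀ x → size (single x) ≡ 1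
  size-single (inj₁ e) = cong₂ _+_ (∑-δ e) (∑-zero {n} λ _ → refl)
  size-single (inj₂ v) = cong₂ _+_ (∑-zero {m} λ _ → refl) (∑-δ v)

  size-insert : ∀ {X w} → X w ≡ false → size (insert X w) ≡ suc (size X)
  size-insert {X} {inj₁ e} Xw = cong₂ _+_ (card-add {U = X ∘ inj₁} Xw) (card-cong λ i → ∨-false (X (inj₂ i)))
  size-insert {X} {inj₂ v} Xw = trans (cong₂ _+_ (card-cong λ i → ∨-false (X (inj₁ i))) (card-add {U = X ∘ inj₂} Xw)) (ℕₚ.+-suc _ _)

  size-nonfull : ∀ {X} w → X w ≡ false → size X < m + n
  size-nonfull (inj₁ e) Xw = +-mono-<-≤ (card-nonfull e Xw) (card≤ _)
  size-nonfull (inj₂ v) Xw = +-mono-≤-< (card≤ _) (card-nonfull v Xw)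

  size-full : ∀ {X} → (∀ x → X x ≡ true) → size X ≡ m + n
  size-full all = cong₂ _+_ (card-full (all ∘ inj₁)) (card-full (all ∘ inj₂))

  edges-mono : ∀ {G G'} → G ⊆E G' → edges G ≤ edges G'
  edges-mono sub = ∑-mono λ e → ∑-mono λ v → b2n-mono (sub e v)

  edges-mono-< : ∀ {G G'} → G ⊆E G' → ∀ e v → G e v ≡ false → G' e v ≡ true → edges G < edges G'
  edges-mono-< {G} {G'} sub e v Gev G'ev =
    ∑-mono-< (λ e → ∑-mono λ v → b2n-mono (sub e v)) e
      (∑-mono-< (λ v → b2n-mono (sub e v)) v (≤-reflexive (trans (cong (suc ∘ b2n) Gev) (sym (cong b2n G'ev)))))

  adj-sym : ∀ {G : EdgeSet m n} {x y} → Adj G x y → Adj G y x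
  adj-sym (ev p) = ve p
  adj-sym (ve p) = ev p

  adj-mono : ∀ {G G' : EdgeSet m n} → G ⊆E G' → ∀ {x y} → Adj G x y → Adj G' x y
  adj-mono sub (ev p) = ev (sub _ _ p)
  adj-mono sub (ve p) = ve (sub _ _ p)

  star-sym : ∀ {G : EdgeSet m n} {x y} → Star (Adj G) x y → Star (Adj G) y x
  star-sym = Star.reverse adj-sym

  closed-star : ∀ {G X} → Closed G X → ∀ {x y} → Star (Adj G) x y → X x ≡ true → X y ≡ true
  closed-star cl ε        Xx = Xx
  closed-star cl (a ◅ as) Xx = closed-star cl as (cl a Xx)

  xor-true : ∀ {a b} → a xor b ≡ true → (a ≡ true × b ≡ false) ⊎ (b ≡ true × a ≡ false)
  xor-true {true}  {false} _ = inj₁ (refl , refl)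
  xor-true {false} {true}  _ = inj₂ (refl , refl)

  xor-intro : ∀ {a b} → a ≡ true → b ≡ false → a xor b ≡ true
  xor-intro refl refl = refl

  xor-intro′ : ∀ {a b} → a ≡ true → b ≡ false → b xor a ≡ true
  xor-intro′ refl refl = refl

  crossing : ∀ G X → (∃ λ u → ∃ λ w → Adj G u w × X u ≡ true × X w ≡ false) ⊎ Closed G X
  crossing G X with anyF (λ e → anyF λ v → G e v ∧ (X (inj₁ e) xor X (inj₂ v))) in eq
  ... | true with anyF-elim eq
  ...   | e , p with anyF-elim p
  ...     | v , q with ∧-true {G e v} q
  ...       | Gev , x with xor-true {X (inj₁ e)} x
  ...         | inj₁ (a , b) = inj₁ (inj₁ e , inj₂ v , ev Gev , a , b)
  ...         | inj₂ (a , b) = inj₁ (inj₂ v , inj₁ e , ve Gev , a , b)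
  crossing G X | false = inj₂ closed
    where
    none : ∀ {e v} → G e v ≡ true → X (inj₁ e) xor X (inj₂ v) ≡ true → ⊥
    none Gev x = true≢false (anyF-intro _ (anyF-intro _ (∧-intro Gev x))) eq
    closed : Closed G X
    closed {w = w} (ev g) Xu with X w in Xw
    ... | true  = refl
    ... | false = ⊥-elim (none g (xor-intro Xu Xw))
    closed {w = w} (ve g) Xu with X w in Xw
    ... | true  = refl
    ... | false = ⊥-elim (none g (xor-intro′ Xu Xw))

  -- One closure loop serves for reachability and for the lower and upper bounds on numbers of
  -- edges. It terminates because each insertion raises `size X`, which never exceeds `m + n`.
  grow : ∀ G (P : (Node m n → Bool) → Set) →
    (∀ X u w → Adj G u w → X u ≡ true → X w ≡ false → P X → P (insert X w)) →
    ∀ X → P X → ∃ λ Y → P Y × Closed G Y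
  grow G P step X = go (m + n) X (m≤n+m (m + n) (size X))
    where
    go : ∀ k X → m + n ≤ size X + k → P X → ∃ λ Y → P Y × Closed G Y
    go k X le PX with crossing G X
    ... | inj₂ closed = X , PX , closed
    go zero X le PX | inj₁ (u , w , a , Xu , Xw) =
      contradiction (≤-trans (size-nonfull {X} w Xw) (≤-trans le (≤-reflexive (ℕₚ.+-identityʳ _)))) (<-irrefl refl)
    go (suc k) X le PX | inj₁ (u , w , a , Xu , Xw) =
      go k (insert X w) (≤-trans le (≤-reflexive (trans (ℕₚ.+-suc _ _) (cong (_+ k) (sym (size-insert {X} {w} Xw))))))
        (step X u w a Xu Xw PX)

  insert-old : ∀ X w {z} → X z ≡ true → insert X w z ≡ true
  insert-old X w = ∨-introˡ

  insert-new : ∀ X w → insert X w w ≡ true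
  insert-new X w = ∨-introʳ {X w} (single-self w)

  -- Growing X to the full node set along crossing edges, each new node brings a new edge.
  connected-count : ∀ {G} → Connected G → ∀ X x₀ → X x₀ ≡ true → edges (G ∣ X) + (m + n) ≤ size X + edges G
  connected-count {G} conn X x₀ Xx₀ with grow G P step X (Xx₀ , ≤-reflexive (ℕₚ.+-comm (edges (G ∣ X)) (size X)))
    where
    P : (Node m n → Bool) → Set
    P Y = Y x₀ ≡ true × edges (G ∣ X) + size Y ≤ size X + edges (G ∣ Y)
    sub : ∀ Y w → (G ∣ Y) ⊆E (G ∣ insert Y w)
    sub Y w e v p with ∧-true {G e v} p
    ... | g , q with ∧-true {Y (inj₁ e)} q
    ...   | a , b = ∧-intro g (∧-intro (insert-old Y w a) (insert-old Y w b))
    more : ∀ Y u w → Adj G u w → Y u ≡ true → Y w ≡ false → edges (G ∣ Y) < edges (G ∣ insert Y w)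
    more Y _ _ (ev {e} {v} g) Yu Yw = edges-mono-< (sub Y (inj₂ v)) e v
      (¬true λ p → true≢false (proj₂ (∧-true {Y (inj₁ e)} (proj₂ (∧-true {G e v} p)))) Yw)
      (∧-intro g (∧-intro (insert-old Y (inj₂ v) Yu) (insert-new Y (inj₂ v))))
    more Y _ _ (ve {e} {v} g) Yu Yw = edges-mono-< (sub Y (inj₁ e)) e v
      (¬true λ p → true≢false (proj₁ (∧-true {Y (inj₁ e)} (proj₂ (∧-true {G e v} p)))) Yw)
      (∧-intro g (∧-intro (insert-new Y (inj₁ e)) (insert-old Y (inj₁ e) Yu)))
    step : ∀ Y u w → Adj G u w → Y u ≡ true → Y w ≡ false → P Y → P (insert Y w)
    step Y u w a Yu Yw (Yx₀ , le) = insert-old Y w Yx₀ ,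
      ≤-trans (≤-reflexive (trans (cong (edges (G ∣ X) +_) (size-insert {Y} {w} Yw)) (ℕₚ.+-suc _ _)))
        (≤-trans (s≤s le) (≤-trans (≤-reflexive (sym (ℕₚ.+-suc _ _))) (+-monoʳ-≤ (size X) (more Y u w a Yu Yw))))
  ... | Y , (Yx₀ , le) , closed =
    ≤-trans (≤-reflexive (cong (edges (G ∣ X) +_) (sym (size-full {Y} λ y → closed-star closed (conn x₀ y) Yx₀))))
      (≤-trans le (+-monoʳ-≤ (size X) (edges-mono λ e v → proj₁ ∘ ∧-true)))

  connected-edges : ∀ {G} → Connected G → Node m n → m + n ≤ suc (edges G)
  connected-edges {G} conn x₀ = ≤-trans (m≤n+m (m + n) (edges (G ∣ single x₀)))
    (≤-trans (connected-count conn (single x₀) x₀ (single-self x₀)) (≤-reflexive (cong (_+ edges G) (size-single x₀))))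

  -- The component is produced as a Boolean set so that both sides of a connectivity question are
  -- available: paths to its members, and closedness to exclude all other nodes.
  reach : ∀ G x₀ → ∃ λ X → (X x₀ ≡ true × (∀ y → X y ≡ true → Star (Adj G) x₀ y)) × Closed G X
  reach G x₀ = grow G _ step (single x₀) (single-self x₀ , λ y p → subst (Star (Adj G) x₀) (sym (single-sound p)) ε)
    where
    step : ∀ X u w → Adj G u w → X u ≡ true → X w ≡ false →
      X x₀ ≡ true × (∀ y → X y ≡ true → Star (Adj G) x₀ y) →
      insert X w x₀ ≡ true × (∀ y → insert X w y ≡ true → Star (Adj G) x₀ y)
    step X u w a Xu Xw (Xx₀ , r) = insert-old X w Xx₀ , λ y p → r' y (∨-true p)
      where
      r' : ∀ y → X y ≡ true ⊎ single w y ≡ true → Star (Adj G) x₀ y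
      r' y (inj₁ q) = r y q
      r' y (inj₂ q) = subst (Star (Adj G) x₀) (sym (single-sound q)) (r u Xu ◅◅ (a ◅ ε))

  removeEdge-self : ∀ (G : EdgeSet m n) e v → removeEdge G e v e v ≡ false
  removeEdge-self G e v rewrite ==-refl e | ==-refl v = refl

  removeEdge-⊆ : ∀ (G : EdgeSet m n) e v → removeEdge G e v ⊆E G
  removeEdge-⊆ G e v e' v' p with ⌊ e' Fin.≟ e ⌋ ∧ ⌊ v' Fin.≟ v ⌋
  ... | false = p

  removeEdge-keeps : ∀ (G : EdgeSet m n) e v {e' v'} → G e' v' ≡ true → (e' ≡ e → v' ≢ v) → removeEdge G e v e' v' ≡ true
  removeEdge-keeps G e v {e'} {v'} p ne with ⌊ e' Fin.≟ e ⌋ ∧ ⌊ v' Fin.≟ v ⌋ in eq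
  ... | false = p
  ... | true  = contradiction (==-sound (proj₂ (∧-true {⌊ e' Fin.≟ e ⌋} eq))) (ne (==-sound (proj₁ (∧-true eq))))

  removeEdge-≢ : ∀ (G : EdgeSet m n) e v {e' v'} → removeEdge G e v e' v' ≡ true → e' ≡ e → v' ≢ v
  removeEdge-≢ G e v p refl refl = true≢false p (removeEdge-self G e v)

  removeEdge-mono : ∀ {G G' : EdgeSet m n} e v → G ⊆E G' → removeEdge G e v ⊆E removeEdge G' e v
  removeEdge-mono {G} {G'} e v sub e' v' p = removeEdge-keeps G' e v (sub _ _ (removeEdge-⊆ G e v _ _ p)) (removeEdge-≢ G e v p)

  edges-removeEdge : ∀ {G : EdgeSet m n} {e v} → G e v ≡ true → edges (removeEdge G e v) < edges G
  edges-removeEdge {G} {e} {v} p = edges-mono-< (removeEdge-⊆ G e v) e v (removeEdge-self G e v) p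

  reconnect : ∀ {G : EdgeSet m n} {e v} → Connected G → Star (Adj (removeEdge G e v)) (inj₂ v) (inj₁ e) → Connected (removeEdge G e v)
  reconnect {G} {e} {v} conn s x y = replace (conn x y)
    where
    edge : ∀ {x y} → Adj G x y → Star (Adj (removeEdge G e v)) x y
    edge (ev {e'} {v'} g) with e' Fin.≟ e | v' Fin.≟ v
    ... | yes refl | yes refl = star-sym s
    ... | yes _    | no ne    = ev (removeEdge-keeps G e v g λ _ → ne) ◅ ε
    ... | no ne    | _        = ev (removeEdge-keeps G e v g λ p → contradiction p ne) ◅ ε
    edge (ve {e'} {v'} g) with e' Fin.≟ e | v' Fin.≟ v
    ... | yes refl | yes refl = s
    ... | yes _    | no ne    = ve (removeEdge-keeps G e v g λ _ → ne) ◅ ε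
    ... | no ne    | _        = ve (removeEdge-keeps G e v g λ p → contradiction p ne) ◅ ε
    replace : ∀ {x y} → Star (Adj G) x y → Star (Adj (removeEdge G e v)) x y
    replace ε        = ε
    replace (a ◅ as) = edge a ◅◅ replace as

  -- A detour around the edge would leave a connected graph with fewer than `m + n - 1` edges,
  -- against `connected-edges`.
  bridge : ∀ {T : EdgeSet m n} → Connected T → suc (edges T) ≡ m + n → ∀ {e v} → T e v ≡ true →
    ¬ Star (Adj (removeEdge T e v)) (inj₂ v) (inj₁ e)
  bridge {T} conn count {e} {v} Tev s = <-irrefl refl
    (≤-trans (≤-reflexive count) (≤-trans (connected-edges (reconnect conn s) (inj₁ e)) (edges-removeEdge {T} {e} {v} Tev)))

-- Trees

sum-tabulate : ∀ {k} (f : Fin k → ℕ) → sum (List.tabulate f) ≡ ∑ f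
sum-tabulate {zero}  f = refl
sum-tabulate {suc k} f = cong (f zero +_) (sum-tabulate (f ∘ suc))

module _ {m n : ℕ} where

  degree : EdgeSet m n → Fin m → ℕ
  degree T e = card (T e)

  deg≡degree : ∀ (T : EdgeSet m n) e → deg T e ≡ degree T e
  deg≡degree T e = trans (cong sum (map-tabulate (λ v → v) (λ v → b2n (T e v)))) (sum-tabulate λ v → b2n (T e v))

  data SimplePath (G : EdgeSet m n) (y : Node m n) : List (Node m n) → Set where
    end : SimplePath G y [ y ]
    via : ∀ {x x' xs} → Adj G x x' → SimplePath G y (x' ∷ xs) → All (x ≢_) (x' ∷ xs) → SimplePath G y (x ∷ x' ∷ xs)

  simple-suffix : ∀ {G x y xs} → SimplePath G y xs → x ∈ xs → ∃ λ zs → SimplePath G y (x ∷ zs)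
  simple-suffix p (here refl)         = _ , p
  simple-suffix (via _ p _) (there i) = simple-suffix p i

  -- Loop erasure: if the new first node recurs, the path is cut back to its occurrence.
  simplify : ∀ {G x y} → Star (Adj G) x y → ∃ λ xs → SimplePath G y (x ∷ xs)
  simplify ε = [] , end
  simplify {x = x} (a ◅ as) with simplify as
  ... | xs , p with DecMembership._∈?_ _≟ᴺ_ x (_ ∷ xs)
  ...   | yes x∈ = simple-suffix p x∈
  ...   | no x∉  = _ , via a p (Allₚ.¬Any⇒All¬ _ x∉)

  simple-unique : ∀ {G y xs} → SimplePath G y xs → Unique xs
  simple-unique end         = [] ∷ []
  simple-unique (via _ p d) = d ∷ simple-unique p

  simple-linked : ∀ {G y z xs} → SimplePath G y xs → Adj G y z → Linked (Adj G) (xs ++ [ z ])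
  simple-linked end                        a = a ∷ [-]
  simple-linked (via b end _)             a = b ∷ (a ∷ [-])
  simple-linked (via b p@(via _ _ _) _)   a = b ∷ simple-linked p a

  simple-mono : ∀ {G G' y xs} → G ⊆E G' → SimplePath G y xs → SimplePath G' y xs
  simple-mono sub end         = end
  simple-mono sub (via a p d) = via (adj-mono sub a) (simple-mono sub p) d

  restrict-target : ∀ {G X} {x y : Node m n} → Adj (G ∣ X) x y → X y ≡ true
  restrict-target {G} {X} (ev {e} {v} p) = proj₂ (∧-true {X (inj₁ e)} (proj₂ (∧-true {G e v} p)))
  restrict-target {G} {X} (ve {e} {v} p) = proj₁ (∧-true {X (inj₁ e)} (proj₂ (∧-true {G e v} p)))

  simple-within : ∀ {G X y x xs} → SimplePath (G ∣ X) y (x ∷ xs) → X x ≡ true → All (λ z → X z ≡ true) (x ∷ xs)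
  simple-within end         Xx = Xx ∷ []
  simple-within {G} {X} (via a p _) Xx = Xx ∷ simple-within {G} {X} p (restrict-target {G} {X} a)

  -- Two different neighbours of `w` in `X` would be joined by a simple path inside `X`; since `w`
  -- lies outside `X`, closing this path through `w` gives a cycle.
  unique-neighbour : ∀ {T : EdgeSet m n} → ¬ HasCycle T → ∀ {X u₁ u₂ w} → X u₁ ≡ true → X w ≡ false →
    Star (Adj (T ∣ X)) u₁ u₂ → Adj T w u₁ → Adj T u₂ w → u₁ ≡ u₂
  unique-neighbour {T} acyclic {X} {u₁} {u₂} {w} Xu Xw s a b with simplify s
  ... | [] , end = refl
  ... | x ∷ xs , p = contradiction
    (w , u₁ ∷ x ∷ xs ,
      (All.map (λ {Xz refl → true≢false Xz Xw}) (simple-within {T} {X} p Xu) ∷ simple-unique p) ,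
      s≤s (s≤s z≤n) ,
      a ∷ simple-linked (simple-mono {T ∣ X} {T} (λ e v → proj₁ ∘ ∧-true) p) b)
    acyclic

  -- The counterpart of the growth estimate in `connected-count`. A new edge of the induced subgraph
  -- joins `w` to `X`, so by `only` it is the single edge marked by `hit`.
  edges-insert : ∀ {T X w u} → (∀ u' → Adj T w u' → X u' ≡ true → u' ≡ u) → X w ≡ false →
    edges (T ∣ insert X w) ≤ suc (edges (T ∣ X))
  edges-insert {T} {X} {w} {u} only Xw = ≤-trans (∑-mono λ e → ∑-mono λ v → b2n-∨ (pt e v)) (≤-trans (≤-reflexive split) (≤-trans (+-monoʳ-≤ (edges (T ∣ X)) (one w u)) (≤-reflexive (ℕₚ.+-comm _ 1))))
    where
    hit : Node m n → Node m n → EdgeSet m n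
    hit (inj₁ a) (inj₂ b) e v = (e == a) ∧ (v == b)
    hit (inj₂ b) (inj₁ a) e v = (e == a) ∧ (v == b)
    hit _ _ e v = false
    split : ∑ (λ e → ∑ (λ v → b2n ((T ∣ X) e v) + b2n (hit w u e v))) ≡ edges (T ∣ X) + edges (hit w u)
    split = trans (∑-cong λ e → ∑-+ {n} (λ v → b2n ((T ∣ X) e v)) (λ v → b2n (hit w u e v)))
      (∑-+ {m} (λ e → ∑ λ v → b2n ((T ∣ X) e v)) (λ e → ∑ λ v → b2n (hit w u e v)))
    pair : ∀ a b → edges {m} {n} (λ e v → (e == a) ∧ (v == b)) ≤ 1
    pair a b = ≤-reflexive (trans (∑-single a λ e ne → ∑-zero λ v → cong (λ z → b2n (z ∧ (v == b))) (==-≢ ne))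
      (trans (∑-cong λ v → cong (λ z → b2n (z ∧ (v == b))) (==-refl a)) (∑-δ b)))
    none : edges {m} {n} (λ _ _ → false) ≤ 1
    none = ≤-trans (≤-reflexive (∑-zero {m} {λ _ → ∑ {n} (λ _ → 0)} λ e → ∑-zero {n} {λ _ → 0} λ v → refl)) z≤n
    one : ∀ w u → edges (hit w u) ≤ 1
    one (inj₁ a) (inj₂ b) = pair a b
    one (inj₂ b) (inj₁ a) = pair a b
    one (inj₁ a) (inj₁ _) = none
    one (inj₂ a) (inj₂ _) = none
    hitE : ∀ {w u e v} → inj₁ e ≡ w → inj₂ v ≡ u → hit w u e v ≡ true
    hitE {e = e} {v} refl refl rewrite ==-refl e | ==-refl v = refl
    hitV : ∀ {w u e v} → inj₂ v ≡ w → inj₁ e ≡ u → hit w u e v ≡ true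
    hitV {e = e} {v} refl refl rewrite ==-refl e | ==-refl v = refl
    loop : ∀ e v → T e v ≡ true → single w (inj₁ e) ≡ true → single w (inj₂ v) ≡ true → ⊥
    loop e v t p q with trans (single-sound {x = w} p) (sym (single-sound {x = w} q))
    ... | ()
    pt : ∀ e v → (T ∣ insert X w) e v ≡ true → (T ∣ X) e v ≡ true ⊎ hit w u e v ≡ true
    pt e v p with ∧-true {T e v} p
    ... | t , q with ∧-true {insert X w (inj₁ e)} q
    ...   | a , b with ∨-true {X (inj₁ e)} a | ∨-true {X (inj₂ v)} b
    ...     | inj₁ a' | inj₁ b' = inj₁ (∧-intro t (∧-intro a' b'))
    ...     | inj₂ a' | inj₂ b' = ⊥-elim (loop e v t a' b')
    ...     | inj₂ a' | inj₁ b' with single-sound {x = w} a'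
    ...       | refl = inj₂ (hitE refl (only (inj₂ v) (ev t) b'))
    pt e v p | t , q | a , b | inj₁ a' | inj₂ b' with single-sound {x = w} b'
    ...       | refl = inj₂ (hitV refl (only (inj₁ e) (ve t) a'))

  -- `connected-edges` gives one inequality. For the other, the tree is grown from `r`: each new
  -- node brings at most one edge, and `P` also keeps paths inside `X` because `unique-neighbour`
  -- requires them.
  tree-count : ∀ {T : EdgeSet m n} → IsTree T → Node m n → suc (edges T) ≡ m + n
  tree-count {T} (conn , acyclic) r with grow T P step (single r) (single-self r , start , λ y p → subst (Star (Adj (T ∣ single r)) r) (sym (single-sound p)) ε)
    where
    P : (Node m n → Bool) → Set
    P X = X r ≡ true × suc (edges (T ∣ X)) ≤ size X × (∀ y → X y ≡ true → Star (Adj (T ∣ X)) r y)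
    start : suc (edges (T ∣ single r)) ≤ size (single r)
    start = ≤-reflexive (trans (cong suc (∑-zero λ e → ∑-zero λ v → cong b2n (¬true λ p → loop e v (proj₂ (∧-true {T e v} p))))) (sym (size-single r)))
      where
      loop : ∀ e v → single r (inj₁ e) ∧ single r (inj₂ v) ≡ true → ⊥
      loop e v p with ∧-true {single r (inj₁ e)} p
      ... | a , b with trans (single-sound {x = r} a) (sym (single-sound {x = r} b))
      ...   | ()
    step : ∀ X u w → Adj T u w → X u ≡ true → X w ≡ false → P X → P (insert X w)
    step X u w a Xu Xw (Xr , le , paths) = insert-old X w Xr ,
      ≤-trans (s≤s (edges-insert {T} {X} {w} {u} only Xw)) (≤-trans (s≤s le) (≤-reflexive (sym (size-insert {X = X} {w = w} Xw)))) ,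
      λ y p → path y (∨-true p)
      where
      only : ∀ u' → Adj T w u' → X u' ≡ true → u' ≡ u
      only u' b Xu' = unique-neighbour {T} acyclic {X} Xu' Xw (star-sym (paths u' Xu') ◅◅ paths u Xu) b a
      wider : (T ∣ X) ⊆E (T ∣ insert X w)
      wider e v p with ∧-true {T e v} p
      ... | t , q with ∧-true {X (inj₁ e)} q
      ...   | c , d = ∧-intro t (∧-intro (insert-old X w c) (insert-old X w d))
      new : ∀ {u w} → Adj T u w → X u ≡ true → Adj (T ∣ insert X w) u w
      new {w = w} (ev t) Xu = ev (∧-intro t (∧-intro (insert-old X w Xu) (insert-new X w)))
      new {w = w} (ve t) Xu = ve (∧-intro t (∧-intro (insert-new X w) (insert-old X w Xu)))
      path : ∀ y → X y ≡ true ⊎ single w y ≡ true → Star (Adj (T ∣ insert X w)) r y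
      path y (inj₁ p) = Star.map (adj-mono wider) (paths y p)
      path y (inj₂ p) = subst (Star _ r) (sym (single-sound p)) (Star.map (adj-mono wider) (paths u Xu) ◅◅ (new a Xu ◅ ε))
  ... | Y , (Yr , le , _) , closed = ℕₚ.≤-antisym
    (≤-trans (s≤s (edges-mono {G = T} {G' = T ∣ Y} λ e v t → ∧-intro t (∧-intro (full (inj₁ e)) (full (inj₂ v))))) (≤-trans le (≤-reflexive (size-full {X = Y} full))))
    (connected-edges conn r)
    where
    full : ∀ x → Y x ≡ true
    full x = closed-star closed (conn r x) Yr

  -- The rest of a cycle is a detour around its first edge, against `bridge`.
  count-acyclic : ∀ {T : EdgeSet m n} → Connected T → suc (edges T) ≡ m + n → ¬ HasCycle T
  count-acyclic conn count (x , [] , _ , () , _)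
  count-acyclic conn count (x , x₁ ∷ [] , _ , s≤s () , _)
  count-acyclic {T} conn count (x , x₁ ∷ x₂ ∷ xs , (x≢ ∷ x₁≢ ∷ _) , _ , (a ∷ b ∷ links)) = cut a
    where
    cut : Adj T x x₁ → ⊥
    walk : ∀ {T⁻ : EdgeSet m n} → (∀ {p q} → Adj T p q → ¬ (p ≡ x × q ≡ x₁) → ¬ (p ≡ x₁ × q ≡ x) → Adj T⁻ p q) →
      ∀ y ys → All (x₁ ≢_) (y ∷ ys) → All (x ≢_) (y ∷ ys) → Linked (Adj T) (y ∷ ys ++ [ x ]) → Star (Adj T⁻) y x
    walk keep y [] (c ∷ _) (d ∷ _) (l ∷ _) = keep l (λ (p , _) → d (sym p)) (λ (p , _) → c (sym p)) ◅ ε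
    walk keep y (z ∷ ys) (c ∷ cs) (d ∷ ds) (l ∷ ls) =
      keep l (λ (p , _) → d (sym p)) (λ (p , _) → c (sym p)) ◅ walk keep z ys cs ds ls
    whole : ∀ {T⁻ : EdgeSet m n} → (∀ {p q} → Adj T p q → ¬ (p ≡ x × q ≡ x₁) → ¬ (p ≡ x₁ × q ≡ x) → Adj T⁻ p q) →
      Star (Adj T⁻) x₁ x
    whole keep = keep b (λ (p , _) → All.head x≢ (sym p)) (λ (_ , q) → All.head (All.tail x≢) (sym q))
      ◅ walk keep x₂ xs x₁≢ (All.tail x≢) links
    cut (ev {e} {v} t) = bridge conn count t (whole keep)
      where
      keep : ∀ {p q} → Adj T p q → ¬ (p ≡ inj₁ e × q ≡ inj₂ v) → ¬ (p ≡ inj₂ v × q ≡ inj₁ e) → Adj (removeEdge T e v) p q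
      keep (ev t) c _ = ev (removeEdge-keeps T e v t λ {refl refl → c (refl , refl)})
      keep (ve t) _ c = ve (removeEdge-keeps T e v t λ {refl refl → c (refl , refl)})
    cut (ve {e} {v} t) = bridge conn count t (star-sym (whole keep))
      where
      keep : ∀ {p q} → Adj T p q → ¬ (p ≡ inj₂ v × q ≡ inj₁ e) → ¬ (p ≡ inj₁ e × q ≡ inj₂ v) → Adj (removeEdge T e v) p q
      keep (ev t) _ c = ev (removeEdge-keeps T e v t λ {refl refl → c (refl , refl)})
      keep (ve t) c _ = ve (removeEdge-keeps T e v t λ {refl refl → c (refl , refl)})

  -- Acyclicity is replaced by a count: the degrees force `m + ∑ g` edges, which is `m + n - 1` by
  -- the last component. An edge exchange then has to preserve only connectivity and degrees.
  IsTreeWith : (Fin m → ℕ) → EdgeSet m n → Set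
  IsTreeWith g T = Connected T × (∀ e → degree T e ≡ suc (g e)) × suc (∑ g) ≡ n

  edges-degrees : ∀ {g} {T : EdgeSet m n} → (∀ e → degree T e ≡ suc (g e)) → edges T ≡ m + ∑ g
  edges-degrees {g} degs = trans (∑-cong degs) (trans (∑-+ {m} (λ _ → 1) g) (cong (_+ ∑ g) (∑-one m)))

  treeWith-count : ∀ {g} {T : EdgeSet m n} → IsTreeWith g T → suc (edges T) ≡ m + n
  treeWith-count {g} (_ , degs , total) = trans (cong suc (edges-degrees degs)) (trans (sym (ℕₚ.+-suc m (∑ g))) (cong (m +_) total))

  treeWith⇒tree : ∀ {g} {T : EdgeSet m n} → IsTreeWith g T → IsTree T
  treeWith⇒tree {g} {T} t@(conn , _) = conn , count-acyclic conn (treeWith-count {g} {T} t)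

  tree⇒treeWith : ∀ {g} {T : EdgeSet m n} → Node m n → IsTree T → (∀ e → deg T e ≡ suc (g e)) → IsTreeWith g T
  tree⇒treeWith {g} {T} x₀ tree degs = proj₁ tree , degs' , ℕₚ.+-cancelˡ-≡ m _ _
    (trans (ℕₚ.+-suc m (∑ g)) (trans (cong suc (sym (edges-degrees degs'))) (tree-count tree x₀)))
    where
    degs' : ∀ e → degree T e ≡ suc (g e)
    degs' e = trans (sym (deg≡degree T e)) (degs e)

-- Hypertrees and the Hall condition

b2n-submodular : ∀ {a b c d} → (a ≡ true → c ≡ true ⊎ d ≡ true) → (b ≡ true → c ≡ true × d ≡ true) →
  b2n a + b2n b ≤ b2n c + b2n d
b2n-submodular {a} {true} h k with k refl
... | refl , refl = +-monoˡ-≤ 1 (b2n≤1 a)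
b2n-submodular {a} {false} {c} {d} h k = ≤-trans (≤-reflexive (ℕₚ.+-identityʳ (b2n a))) (b2n-∨ h)

-- The search runs over bit vectors, whereas `P` concerns functions; `resp` stands in for function
-- extensionality.
any-set? : ∀ {k} {P : (Fin k → Bool) → Set} → (∀ U → Dec (P U)) → (∀ {U W} → (∀ i → U i ≡ W i) → P U → P W) → Dec (∃ P)
any-set? P? resp = map′ (λ (s , p) → lookup s , p) (λ (U , p) → tabulate U , resp (λ i → sym (lookup∘tabulate U i)) p)
  (anySubset? λ s → P? (lookup s))

module _ {m n : ℕ} where

  neighbours : EdgeSet m n → (Fin m → Bool) → Fin n → Bool
  neighbours G U v = anyF λ e → U e ∧ G e v

  neighbours-intro : ∀ {G : EdgeSet m n} {U e v} → U e ≡ true → G e v ≡ true → neighbours G U v ≡ true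
  neighbours-intro Ue g = anyF-intro _ (∧-intro Ue g)

  neighbours-elim : ∀ {G : EdgeSet m n} {U v} → neighbours G U v ≡ true → ∃ λ e → U e ≡ true × G e v ≡ true
  neighbours-elim p with anyF-elim p
  ... | e , q = e , ∧-true q

  ∣N_∣ : EdgeSet m n → (Fin m → Bool) → ℕ
  ∣N G ∣ U = card (neighbours G U)

  ∣N∣-mono : ∀ {G G' U U'} → (∀ e v → U e ≡ true → G e v ≡ true → neighbours G' U' v ≡ true) → ∣N G ∣ U ≤ ∣N G' ∣ U'
  ∣N∣-mono {G} {G'} {U} {U'} h = ∑-mono λ v → b2n-mono λ p → let e , Ue , g = neighbours-elim {G} {U} {v} p in h e v Ue g

  -- The neighbours of a union are the union of the neighbours, but the neighbours of an
  -- intersection need not exhaust the common neighbours; hence only an inequality.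
  ∣N∣-submodular : ∀ G U D → ∣N G ∣ (U ∪ D) + ∣N G ∣ (U ∩ D) ≤ ∣N G ∣ U + ∣N G ∣ D
  ∣N∣-submodular G U D = ≤-trans (≤-reflexive (sym (∑-+ {n} (b2n ∘ neighbours G (U ∪ D)) (b2n ∘ neighbours G (U ∩ D)))))
    (≤-trans (∑-mono λ v → b2n-submodular {neighbours G (U ∪ D) v} {neighbours G (U ∩ D) v} (join v) (meet v)) (≤-reflexive (∑-+ {n} (b2n ∘ neighbours G U) (b2n ∘ neighbours G D))))
    where
    join : ∀ v → neighbours G (U ∪ D) v ≡ true → neighbours G U v ≡ true ⊎ neighbours G D v ≡ true
    join v p with neighbours-elim {G} {U ∪ D} p
    ... | e , q , g with ∨-true {U e} q
    ...   | inj₁ Ue = inj₁ (neighbours-intro {G} {U} Ue g)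
    ...   | inj₂ De = inj₂ (neighbours-intro {G} {D} De g)
    meet : ∀ v → neighbours G (U ∩ D) v ≡ true → neighbours G U v ≡ true × neighbours G D v ≡ true
    meet v p with neighbours-elim {G} {U ∩ D} p
    ... | e , q , g with ∧-true {U e} q
    ...   | Ue , De = neighbours-intro {G} {U} Ue g , neighbours-intro {G} {D} De g

  Hall : EdgeSet m n → (Fin m → ℕ) → Set
  Hall G g = suc (∑ g) ≡ n × (∀ U e → U e ≡ true → suc (wsum U g) ≤ ∣N G ∣ U)

  Violation : EdgeSet m n → (Fin m → ℕ) → (Fin m → Bool) → Set
  Violation G g U = (∃ λ e → U e ≡ true) × ∣N G ∣ U ≤ wsum U g

  violation? : ∀ G g → Dec (∃ (Violation G g))
  violation? G g = any-set? (λ U → any? (λ e → U e Bool.≟ true) ×-dec (∣N G ∣ U ≤? wsum U g)) resp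
    where
    resp : ∀ {U W} → (∀ i → U i ≡ W i) → Violation G g U → Violation G g W
    resp {U} {W} eq ((e , Ue) , le) = (e , trans (sym (eq e)) Ue) ,
      ≤-trans (∣N∣-mono {G} {G} {W} {U} λ e v We Gev → neighbours-intro {G} {U} (trans (eq e) We) Gev)
        (≤-trans le (≤-reflexive (∑-cong λ e → cong (λ b → if b then g e else 0) (eq e))))

  hall-or-violation : ∀ G g → suc (∑ g) ≡ n → Hall G g ⊎ ∃ (Violation G g)
  hall-or-violation G g total with violation? G g
  ... | yes v = inj₂ v
  ... | no ¬v = inj₁ (total , λ U e Ue → ≰⇒> λ le → ¬v (U , (e , Ue) , le))

  hall-violation : ∀ {G g U} → Hall G g → ¬ Violation G g U
  hall-violation (_ , h) ((e , Ue) , le) = <-irrefl refl (≤-trans (h _ e Ue) le)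

  abstract

    hall? : ∀ G g → Dec (Hall G g)
    hall? G g with suc (∑ g) ℕₚ.≟ n
    ... | no ne = no λ (total , _) → ne total
    ... | yes total with hall-or-violation G g total
    ...   | inj₁ h       = yes h
    ...   | inj₂ (U , v) = no λ h → hall-violation h v

  hall-cong : ∀ {G g h} → (∀ e → g e ≡ h e) → Hall G g → Hall G h
  hall-cong {G} {g} {h} eq (total , hall) = trans (cong suc (sym (∑-cong eq))) total ,
    λ U e Ue → ≤-trans (≤-reflexive (cong suc (sym (wsum-cong U eq)))) (hall U e Ue)

  hall-mono : ∀ {G G' g} → G ⊆E G' → Hall G g → Hall G' g
  hall-mono {G} {G'} sub (total , hall) = total , λ U e Ue → ≤-trans (hall U e Ue)
    (∣N∣-mono {G} {G'} {U} {U} λ e v Ue g → neighbours-intro {G'} {U} Ue (sub e v g))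

  hall-weak : ∀ {G : EdgeSet m n} {g} → Hall G g → ∀ U → wsum U g ≤ ∣N G ∣ U
  hall-weak {G} {g} (_ , hall) U with anyF U in eq
  ... | true with anyF-elim {p = U} eq
  ...   | e , Ue = ℕₚ.<⇒≤ (hall U e Ue)
  hall-weak {G} {g} (_ , hall) U | false = ≤-trans (≤-reflexive (∑-zero λ e → empty e)) z≤n
    where
    empty : ∀ e → (if U e then g e else 0) ≡ 0
    empty e with U e in Ue
    ... | false = refl
    ... | true  = ⊥-elim (true≢false (anyF-intro e Ue) eq)

  private
    cancel : ∀ c w N E mn → (c + w) + mn ≤ (c + N) + E → suc E ≡ mn → suc w ≤ N
    cancel c w N E .(suc E) le refl = ℕₚ.+-cancelʳ-≤ (c + E) _ _
      (≤-trans (≤-reflexive (eq₁ c w E)) (≤-trans le (≤-reflexive (eq₂ c N E))))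
      where
      eq₁ : ∀ c w E → suc w + (c + E) ≡ (c + w) + suc E
      eq₁ = solve-∀
      eq₂ : ∀ c N E → (c + N) + E ≡ N + (c + E)
      eq₂ = solve-∀

  -- The subgraph of `T` induced on `U` and its neighbours contains all `card U + wsum U g` edges at
  -- `U`, and an induced subgraph of a tree on a nonempty node set has fewer edges than nodes.
  treeWith⇒hall : ∀ {g} {T : EdgeSet m n} → IsTreeWith g T → Hall T g
  treeWith⇒hall {g} {T} t@(conn , degs , total) = total , λ U e Ue →
    cancel (card U) (wsum U g) (∣N T ∣ U) (edges T) (m + n)
      (≤-trans (+-monoˡ-≤ (m + n) (≤-trans (≤-reflexive (sym (wsum-+ U (λ _ → 1) g))) (∑-mono (inner U))))
        (connected-count conn (X U) (inj₁ e) Ue))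
      (treeWith-count {g = g} {T} t)
    where
    X : (Fin m → Bool) → Node m n → Bool
    X U (inj₁ e) = U e
    X U (inj₂ v) = neighbours T U v
    inner : ∀ U e → (if U e then suc (g e) else 0) ≤ ∑ (λ v → b2n ((T ∣ X U) e v))
    inner U e with U e in Ue
    ... | false = z≤n
    ... | true  = ≤-trans (≤-reflexive (sym (degs e))) (∑-mono {n} λ v → b2n-mono {T e v} λ t → ∧-intro t (neighbours-intro {T} {U} {e} {v} Ue t))

  hypertree⇒treeWith : ∀ {G : EdgeSet m n} {f} → Fin m → IsHypertreeIn G f → ∃ λ T → T ⊆E G × IsTreeWith (lookup f) T
  hypertree⇒treeWith e₀ (T , (sub , tree) , degs) = T , sub , tree⇒treeWith (inj₁ e₀) tree degs

  treeWith⇒hypertree : ∀ {G T : EdgeSet m n} {f} → T ⊆E G → IsTreeWith (lookup f) T → IsHypertreeIn G f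
  treeWith⇒hypertree {G} {T} sub t@(_ , degs , _) = T , (sub , treeWith⇒tree t) , λ e → trans (deg≡degree T e) (degs e)

  -- Minimal graphs satisfying the Hall condition

  Critical : EdgeSet m n → (Fin m → ℕ) → Set
  Critical T g = ∀ {e v} → T e v ≡ true → ∃ (Violation (removeEdge T e v) g)

  -- Removable edges are deleted while there are any. The graph left is the required tree:
  -- minimality forces its degrees, and connectedness follows from `Hall`.
  hall⇒critical : ∀ {G : EdgeSet m n} {g} → Hall G g → ∃ λ T → T ⊆E G × Hall T g × Critical T g
  hall⇒critical {G₀} {g} = go (edges G₀) G₀ ≤-refl
    where
    go : ∀ k G → edges G ≤ k → Hall G g → ∃ λ T → T ⊆E G × Hall T g × Critical T g
    go k G le h with any? (λ e → any? λ v → (G e v Bool.≟ true) ×-dec hall? (removeEdge G e v) g)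
    ... | no none = G , (λ e v p → p) , h , critical
      where
      critical : Critical G g
      critical {e} {v} Gev with hall-or-violation (removeEdge G e v) g (proj₁ h)
      ... | inj₁ h' = contradiction (e , v , Gev , h') none
      ... | inj₂ v  = v
    go zero G le h | yes (e , v , Gev , h') with ≤-trans (edges-removeEdge {G = G} {e} {v} Gev) le
    ... | ()
    go (suc k) G le h | yes (e , v , Gev , h')
      with go k (removeEdge G e v) (ℕₚ.≤-pred (≤-trans (edges-removeEdge {G = G} {e} {v} Gev) le)) h'
    ... | T , sub , rest = T , (λ e' v' p → removeEdge-⊆ G e v e' v' (sub e' v' p)) , rest

  Tight : EdgeSet m n → (Fin m → ℕ) → (Fin m → Bool) → Set
  Tight G g U = ∣N G ∣ U ≤ suc (wsum U g)

  -- Uncrossing: sizes of neighbourhoods are submodular, weights are modular, and the union,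
  -- nonempty through `e`, obeys `Hall`; so no slack is left for the intersection.
  tight-∩ : ∀ {G g U D e} → Hall G g → Tight G g U → Tight G g D → U e ≡ true → Tight G g (U ∩ D)
  tight-∩ {G} {g} {U} {D} {e} (_ , hall) tU tD Ue =
    arith (∣N G ∣ (U ∪ D)) (∣N G ∣ (U ∩ D)) (∣N G ∣ U) (∣N G ∣ D) (wsum (U ∪ D) g) (wsum (U ∩ D) g) (wsum U g) (wsum D g)
      (∣N∣-submodular G U D) tU tD (hall (U ∪ D) e (∨-introˡ Ue)) (wsum-∪∩ U D g)
    where
    arith : ∀ j i a b wj wi wa wb → j + i ≤ a + b → a ≤ suc wa → b ≤ suc wb → suc wj ≤ j → wj + wi ≡ wa + wb → i ≤ suc wi
    arith j i a b wj wi wa wb sub ta tb tj eq = ℕₚ.+-cancelˡ-≤ (suc wj) _ _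
      (≤-trans (+-monoˡ-≤ i tj) (≤-trans sub (≤-trans (+-mono-≤ ta tb) (≤-reflexive
        (trans (s wa wb) (trans (cong (λ z → suc (suc z)) (sym eq)) (sym (s wj wi))))))))
      where
      s : ∀ x y → suc x + suc y ≡ suc (suc (x + y))
      s = solve-∀

  -- Deleting one edge can take only `v` out of the neighbourhood of `U`. A violation thus shows
  -- that `v` was lost, with `e` its only neighbour in `U`, and that the bound was attained before.
  violated-edge : ∀ {T g e v U} → Hall T g → Violation (removeEdge T e v) g U →
    U e ≡ true × Tight T g U × (∀ e' → U e' ≡ true → T e' v ≡ true → e' ≡ e)
  violated-edge {T} {g} {e} {v} {U} h (ne , le) = Ue , tight , only
    where
    T⁻ = removeEdge T e v
    unbalanced : ¬ (∀ e' v' → U e' ≡ true → T e' v' ≡ true → neighbours T⁻ U v' ≡ true)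
    unbalanced k = hall-violation h (ne , ≤-trans (∣N∣-mono {T} {T⁻} {U} {U} k) le)
    Ue : U e ≡ true
    Ue with U e in eq
    ... | true  = refl
    ... | false = ⊥-elim (unbalanced λ e' v' Ue' t → neighbours-intro {T⁻} {U} Ue'
                    (removeEdge-keeps T e v t λ {refl _ → true≢false Ue' eq}))
    only : ∀ e' → U e' ≡ true → T e' v ≡ true → e' ≡ e
    only e' Ue' t with e' Fin.≟ e
    ... | yes p = p
    ... | no e'≢e = ⊥-elim (unbalanced k)
      where
      k : ∀ e'' v' → U e'' ≡ true → T e'' v' ≡ true → neighbours T⁻ U v' ≡ true
      k e'' v' Ue'' t'' = split (v' Fin.≟ v)
        where
        split : Dec (v' ≡ v) → neighbours T⁻ U v' ≡ true
        split (yes refl) = neighbours-intro {T⁻} {U} Ue' (removeEdge-keeps T e v t λ p → contradiction p e'≢e)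
        split (no ne)    = neighbours-intro {T⁻} {U} Ue'' (removeEdge-keeps T e v t'' λ _ → ne)
    tight : Tight T g U
    tight = ≤-trans (≤-trans (∑-mono λ v' → b2n-∨ (pt v')) (≤-reflexive (trans (∑-+ {n} (b2n ∘ neighbours T⁻ U) (λ v' → b2n (v' == v)))
        (trans (cong (∣N T⁻ ∣ U +_) (∑-δ v)) (ℕₚ.+-comm _ 1))))) (s≤s le)
      where
      pt : ∀ v' → neighbours T U v' ≡ true → neighbours T⁻ U v' ≡ true ⊎ (v' == v) ≡ true
      pt v' p with neighbours-elim {T} {U} p
      ... | e' , Ue' , t = split (v' Fin.≟ v)
        where
        split : Dec (v' ≡ v) → neighbours T⁻ U v' ≡ true ⊎ (v' == v) ≡ true
        split (yes refl) = inj₂ (==-refl v)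
        split (no ne)    = inj₁ (neighbours-intro {T⁻} {U} Ue' (removeEdge-keeps T e v t λ _ → ne))

  -- In a critical graph the tight sets witnessing criticality of the edges at e intersect in a tight set
  -- whose other members share no neighbour with e.
  isolating : ∀ {T g} e → Hall T g → Critical T g → (vs : List (Fin n)) →
    ∃ λ D → D e ≡ true × Tight T g D × (∀ {v e'} → v ∈ vs → T e v ≡ true → D e' ≡ true → T e' v ≡ true → e' ≡ e)
  isolating {T} {g} e h crit [] = (λ _ → true) , refl ,
    ≤-trans (card≤ _) (≤-reflexive (trans (sym (proj₁ h)) (cong suc (sym (wsum-full g λ _ → refl))))) , λ ()
  isolating {T} {g} e h crit (v ∷ vs) with isolating {T} {g} e h crit vs | T e v in Tev
  ... | D , De , tight , only | false = D , De , tight ,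
    λ { (here refl) t → ⊥-elim (true≢false t Tev) ; (there i) → only i }
  ... | D , De , tight , only | true with crit Tev
  ...   | U , viol with violated-edge {T} {g} h viol
  ...     | Ue , tightU , onlyU = D ∩ U , ∧-intro De Ue , tight-∩ {T} {g} {D} {U} h tight tightU De ,
    λ { (here refl) t p → onlyU _ (proj₂ (∧-true {D _} p)) ; (there i) t p → only i t (proj₁ (∧-true {D _} p)) }

  -- The lower bound is `Hall` for the singleton. For the upper one, the neighbours of `e` and of
  -- `D'` are disjoint and lie among those of the tight set `D`, while `wsum D' g` is at most
  -- `∣N T ∣ D'`. As `D'` may be empty, this last bound is taken from `hall-weak`.
  critical-degree : ∀ {T g} → Hall T g → Critical T g → ∀ e → degree T e ≡ suc (g e)
  critical-degree {T} {g} h crit e = ℕₚ.≤-antisym upper lower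
    where
    g-only : wsum (_== e) g ≡ g e
    g-only = trans (∑-single e λ i ne → cong (λ b → if b then g i else 0) (==-≢ ne)) (cong (λ b → if b then g e else 0) (==-refl e))
    lower : suc (g e) ≤ degree T e
    lower = ≤-trans (≤-reflexive (cong suc (sym g-only))) (≤-trans (proj₂ h (_== e) e (==-refl e))
      (∑-mono λ v → b2n-mono λ p → let e' , q , t = neighbours-elim {T} {_== e} p in subst (λ e → T e v ≡ true) (==-sound q) t))
    upper : degree T e ≤ suc (g e)
    upper with isolating {T} {g} e h crit (allFin n)
    ... | D , De , tight , only = ℕₚ.+-cancelʳ-≤ (∣N T ∣ D') _ _
      (≤-trans (≤-trans (≤-reflexive (sym (∑-+ {n} (b2n ∘ T e) (b2n ∘ neighbours T D')))) (∑-mono disjoint))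
        (≤-trans tight (s≤s (≤-trans (≤-reflexive splits) (+-monoʳ-≤ (g e) (hall-weak {T} h D'))))))
      where
      D' : Fin m → Bool
      D' e' = D e' ∧ not (e' == e)
      D'⇒ : ∀ {e'} → D' e' ≡ true → D e' ≡ true × e' ≢ e
      D'⇒ {e'} p with ∧-true {D e'} p
      ... | q , r = q , λ {refl → case (==-refl e') r}
        where
        case : ∀ {b} → b ≡ true → not b ≡ true → ⊥
        case refl ()
      disjoint : ∀ v → b2n (T e v) + b2n (neighbours T D' v) ≤ b2n (neighbours T D v)
      disjoint v with T e v in Tev | neighbours T D' v in Nv
      ... | true | true with neighbours-elim {T} {D'} Nv
      ...   | e' , q , t with D'⇒ q
      ...     | De' , ne = contradiction (only (∈-allFin v) Tev De' t) ne
      disjoint v | true | false = ≤-reflexive (sym (cong b2n (neighbours-intro {T} {D} De Tev)))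
      disjoint v | false | false = z≤n
      disjoint v | false | true with neighbours-elim {T} {D'} Nv
      ...   | e' , q , t = ≤-reflexive (sym (cong b2n (neighbours-intro {T} {D} (proj₁ (D'⇒ q)) t)))
      splits : wsum D g ≡ g e + wsum D' g
      splits = trans (∑-cong pt) (trans (∑-+ {m} (λ e' → if e' == e then g e' else 0) (λ e' → if D' e' then g e' else 0)) (cong (_+ wsum D' g) g-only))
        where
        pt : ∀ e' → (if D e' then g e' else 0) ≡ (if e' == e then g e' else 0) + (if D' e' then g e' else 0)
        pt e' with e' Fin.≟ e
        ... | yes refl rewrite De = sym (ℕₚ.+-identityʳ _)
        ... | no _ with D e'
        ...   | true  = refl
        ...   | false = refl

  -- If the component of `e₀` missed a hyperedge, the conditions for the hyperedges inside and
  -- outside, whose neighbourhoods are disjoint, would add up to `∑ g + 2 ≤ n`. Once all hyperedges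
  -- lie in it, so do at least `∑ g + 1` vertices, that is, all of them.
  hall⇒connected : ∀ {G : EdgeSet m n} {g} → Fin m → Hall G g → Connected G
  hall⇒connected {G} {g} e₀ (total , hall) with reach G (inj₁ e₀)
  ... | X , (Xe₀ , paths) , closed = λ x y → star-sym (paths x (all x)) ◅◅ paths y (all y)
    where
    U = X ∘ inj₁
    W = X ∘ inj₂
    Uᶜ : Fin m → Bool
    Uᶜ e = not (U e)
    Wᶜ : Fin n → Bool
    Wᶜ v = not (W v)
    not-true : ∀ {b} → not b ≡ true → b ≡ false
    not-true {false} _ = refl
    N≤ : ∣N G ∣ U ≤ card W
    N≤ = ∑-mono {n} λ v → b2n-mono {neighbours G U v} {W v} λ p → let e , Ue , g = neighbours-elim {G} {U} p in closed (ev g) Ue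
    Nᶜ≤ : ∣N G ∣ Uᶜ ≤ card Wᶜ
    Nᶜ≤ = ∑-mono {n} λ v → b2n-mono {neighbours G Uᶜ v} {Wᶜ v} λ p → let e , Ue , g = neighbours-elim {G} {Uᶜ} p in
      cong not (¬true λ Wv → true≢false (closed (ve g) Wv) (not-true Ue))
    W+Wᶜ : card W + card Wᶜ ≡ n
    W+Wᶜ = trans (sym (∑-+ {n} (b2n ∘ W) (b2n ∘ Wᶜ))) (trans (∑-cong λ v → pt (W v)) (∑-one n))
      where
      pt : ∀ b → b2n b + b2n (not b) ≡ 1
      pt true  = refl
      pt false = refl
    w+wᶜ : wsum U g + wsum Uᶜ g ≡ ∑ g
    w+wᶜ = trans (sym (∑-+ {m} (λ e → if U e then g e else 0) (λ e → if Uᶜ e then g e else 0))) (∑-cong pt)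
      where
      pt : ∀ e → (if U e then g e else 0) + (if Uᶜ e then g e else 0) ≡ g e
      pt e with U e
      ... | true  = ℕₚ.+-identityʳ _
      ... | false = refl
    Ufull : ∀ e → U e ≡ true
    Ufull e with U e in Ue
    ... | true = refl
    ... | false = ⊥-elim (arith (wsum U g) (wsum Uᶜ g) (card W) (card Wᶜ) (∑ g) n
            (≤-trans (hall U e₀ Xe₀) N≤) (≤-trans (hall Uᶜ e (cong not Ue)) Nᶜ≤) W+Wᶜ w+wᶜ total)
      where
      arith : ∀ a b c d s n → suc a ≤ c → suc b ≤ d → c + d ≡ n → a + b ≡ s → suc s ≡ n → ⊥
      arith a b c d s n p q refl refl eq = <-irrefl refl
        (≤-trans (≤-reflexive (trans (cong suc (sym eq)) (cong suc (sym (ℕₚ.+-suc a b)))))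
          (+-mono-≤ p q))
    all : ∀ x → X x ≡ true
    all (inj₁ e) = Ufull e
    all (inj₂ v) = card≡⇒full {U = W} (≤-trans (≤-reflexive (trans (sym total) (cong suc (sym (wsum-full g Ufull))))) (≤-trans (hall U e₀ Xe₀) N≤)) v

  hall⇒treeWith : ∀ {G : EdgeSet m n} {g} → Fin m → Hall G g → ∃ λ T → T ⊆E G × IsTreeWith g T
  hall⇒treeWith {G} {g} e₀ h with hall⇒critical {G} {g} h
  ... | T , sub , h' , crit = T , sub , hall⇒connected {T} {g} e₀ h' , critical-degree {T} {g} h' crit , proj₁ h

  hypertree⇒hall : ∀ {G : EdgeSet m n} {f} → Fin m → IsHypertreeIn G f → Hall G (lookup f)
  hypertree⇒hall {G} {f} e₀ hyp with hypertree⇒treeWith {G} {f} e₀ hyp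
  ... | T , sub , t = hall-mono {T} {G} {lookup f} sub (treeWith⇒hall t)

  hall⇒hypertree : ∀ {G : EdgeSet m n} {f} → Fin m → Hall G (lookup f) → IsHypertreeIn G f
  hall⇒hypertree {G} {f} e₀ h with hall⇒treeWith {G} {lookup f} e₀ h
  ... | T , sub , t = treeWith⇒hypertree {f = f} sub t

  abstract

    hypertree? : Fin m → ∀ (G : EdgeSet m n) f → Dec (IsHypertreeIn G f)
    hypertree? e₀ G f = map′ (hall⇒hypertree {G} {f} e₀) (hypertree⇒hall {G} {f} e₀) (hall? G (lookup f))

-- Moving a unit between hyperedges

-- Move g g′ a b says g′ = g − 1ₐ + 1_b, with both sides moved so that no subtraction occurs.
Move : ∀ {k} → (Fin k → ℕ) → (Fin k → ℕ) → Fin k → Fin k → Set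
Move g g′ a b = ∀ e → g′ e + b2n (e == a) ≡ g e + b2n (e == b)

move-sym : ∀ {k} {g g′ : Fin k → ℕ} {a b} → Move g g′ a b → Move g′ g b a
move-sym mv e = sym (mv e)

move-trans : ∀ {k} {f g h : Fin k → ℕ} {a b c} → Move f g a b → Move g h b c → Move f h a c
move-trans {f = f} {g} {h} {a} {b} {c} p q e = ℕₚ.+-cancelʳ-≡ (b2n (e == b)) _ _
  (trans (swap (h e) (b2n (e == a)) (b2n (e == b))) (trans (cong (_+ b2n (e == a)) (q e))
    (trans (swap (g e) (b2n (e == c)) (b2n (e == a))) (trans (cong (_+ b2n (e == c)) (p e)) (swap (f e) (b2n (e == b)) (b2n (e == c)))))))
  where
  swap : ∀ x y z → x + y + z ≡ x + z + y
  swap = solve-∀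

move-unique : ∀ {k} {f g h : Fin k → ℕ} {a b} → Move f g a b → Move f h a b → ∀ e → g e ≡ h e
move-unique {a = a} p q e = ℕₚ.+-cancelʳ-≡ (b2n (e == a)) _ _ (trans (p e) (sym (q e)))

move-wsum : ∀ {k} {g g′ : Fin k → ℕ} {a b} → Move g g′ a b → ∀ U → wsum U g′ + b2n (U a) ≡ wsum U g + b2n (U b)
move-wsum {g = g} {g′} {a} {b} mv U =
  trans (cong (wsum U g′ +_) (sym (wsum-δ U a)))
    (trans (sym (wsum-+ U g′ (λ e → b2n (e == a))))
      (trans (wsum-cong U mv)
        (trans (wsum-+ U g (λ e → b2n (e == b))) (cong (wsum U g +_) (wsum-δ U b)))))

move-source : ∀ {k} {g g′ : Fin k → ℕ} {a b} → a ≢ b → Move g g′ a b → 1 ≤ g a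
move-source {g = g} {g′} {a} {b} ne mv = ≤-trans (m≤n+m 1 (g′ a))
  (≤-reflexive (trans (cong (λ z → g′ a + b2n z) (sym (==-refl a))) (trans (mv a) (trans (cong (λ z → g a + b2n z) (==-≢ ne)) (ℕₚ.+-identityʳ _)))))

move-other : ∀ {k} {g g′ : Fin k → ℕ} {a b e} → e ≢ a → e ≢ b → Move g g′ a b → g′ e ≡ g e
move-other {g = g} {g′} {a} {b} {e} ea eb mv = trans (sym (ℕₚ.+-identityʳ _)) (trans (cong (λ z → g′ e + b2n z) (sym (==-≢ ea)))
  (trans (mv e) (trans (cong (λ z → g e + b2n z) (==-≢ eb)) (ℕₚ.+-identityʳ _))))

move-exists : ∀ {k} (g : Fin k → ℕ) a b → 1 ≤ g a → ∃ λ g′ → Move g g′ a b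
move-exists g a b ga = (λ e → (g e + b2n (e == b)) ℕ.∸ b2n (e == a)) , λ e → ℕₚ.m∸n+n≡m (enough e)
  where
  enough : ∀ e → b2n (e == a) ≤ g e + b2n (e == b)
  enough e with e Fin.≟ a
  ... | yes refl = ≤-trans ga (m≤m+n _ _)
  ... | no _     = z≤n

module _ {m n : ℕ} where

  Transfer : EdgeSet m n → (Fin m → ℕ) → Fin m → Fin m → Set
  Transfer G g a b = ∃ λ g′ → Move g g′ a b × Hall G g′

  Blocked : EdgeSet m n → (Fin m → ℕ) → Fin m → Fin m → Set
  Blocked G g a b = ∃ λ U → U b ≡ true × U a ≡ false × Tight G g U

  gains : ∀ {g g′ : Fin m → ℕ} {a b U} → Move g g′ a b → U b ≡ true → U a ≡ false → wsum U g′ ≡ suc (wsum U g)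
  gains {g} {g′} {a} {b} {U} mv Ub Ua = trans (sym (ℕₚ.+-identityʳ _)) (trans (cong (λ z → wsum U g′ + b2n z) (sym Ua))
    (trans (move-wsum mv U) (trans (cong (λ z → wsum U g + b2n z) Ub) (ℕₚ.+-comm _ 1))))

  gain-sides : ∀ {g g′ : Fin m → ℕ} {a b} U → Move g g′ a b → suc (wsum U g) ≤ wsum U g′ → U b ≡ true × U a ≡ false
  gain-sides {g} {g′} {a} {b} U mv le = go (U a) (U b) (move-wsum mv U)
    where
    go : ∀ p q → wsum U g′ + b2n p ≡ wsum U g + b2n q → q ≡ true × p ≡ false
    go false true  _ = refl , refl
    go true  true  eq = ⊥-elim (<-irrefl (sym (ℕₚ.+-cancelʳ-≡ 1 _ _ eq)) le)
    go false false eq = ⊥-elim (<-irrefl (sym (ℕₚ.+-cancelʳ-≡ 0 _ _ eq)) le)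
    go true  false eq = ⊥-elim (<-irrefl refl (≤-trans le (≤-trans (m≤m+n _ 1) (≤-reflexive (trans eq (ℕₚ.+-identityʳ _))))))

  keeps : ∀ {g g′ : Fin m → ℕ} {a b} U → Move g g′ a b → U a ≡ false → U b ≡ false → wsum U g′ ≡ wsum U g
  keeps {g} {g′} {a} {b} U mv Ua Ub = ℕₚ.+-cancelʳ-≡ 0 _ _
    (trans (cong (λ z → wsum U g′ + b2n z) (sym Ua)) (trans (move-wsum mv U) (cong (λ z → wsum U g + b2n z) Ub)))

  module _ (G : EdgeSet m n) where

    tight-avoids : ∀ {g g′ a b U} → Move g g′ a b → Hall G g′ → Tight G g U → U a ≡ false → U b ≡ false
    tight-avoids {g} {g′} {a} {b} {U} mv (_ , hall′) tight Ua = ¬true λ Ub →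
      <-irrefl refl (≤-trans (≤-reflexive (cong suc (sym (gains {U = U} mv Ub Ua)))) (≤-trans (hall′ U b Ub) tight))

    blocked⇒¬transfer : ∀ {g a b} → Blocked G g a b → ¬ Transfer G g a b
    blocked⇒¬transfer {g} (U , Ub , Ua , tight) (g′ , mv , h′) = true≢false Ub (tight-avoids {g} {g′} {U = U} mv h′ tight Ua)

    -- The moved vector can violate the condition only at a set whose weight has risen; it rises by
    -- exactly one, so the set was tight.
    transfer-or-blocked : ∀ {g a b} → Hall G g → 1 ≤ g a → Transfer G g a b ⊎ Blocked G g a b
    transfer-or-blocked {g} {a} {b} (total , hall) ga with move-exists g a b ga
    ... | g′ , mv with hall-or-violation G g′ (trans (cong suc sum-eq) total)
      where
      sum-eq : ∑ g′ ≡ ∑ g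
      sum-eq = ℕₚ.+-cancelʳ-≡ 1 _ _ (move-wsum mv (λ _ → true))
    ...   | inj₁ h′ = inj₁ (g′ , mv , h′)
    ...   | inj₂ (U , (e , Ue) , le) with gain-sides U mv (≤-trans (hall U e Ue) le)
    ...     | Ub , Ua = inj₂ (U , Ub , Ua , ≤-trans le (≤-reflexive (gains {U = U} mv Ub Ua)))

    ¬transfer⇒blocked : ∀ {g a b} → Hall G g → 1 ≤ g a → ¬ Transfer G g a b → Blocked G g a b
    ¬transfer⇒blocked h ga ¬t with transfer-or-blocked h ga
    ... | inj₁ t = contradiction t ¬t
    ... | inj₂ b = b

    -- The uncrossing of `tight-∩` with union and intersection interchanged. The common element is
    -- essential: `Hall` is applied to the intersection and says nothing about the empty set.
    tight-∪ : ∀ {g U D e} → Hall G g → Tight G g U → Tight G g D → U e ≡ true → D e ≡ true → Tight G g (U ∪ D)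
    tight-∪ {g} {U} {D} {e} (_ , hall) tU tD Ue De =
      arith (∣N G ∣ (U ∪ D)) (∣N G ∣ (U ∩ D)) (∣N G ∣ U) (∣N G ∣ D) (wsum (U ∪ D) g) (wsum (U ∩ D) g) (wsum U g) (wsum D g)
        (∣N∣-submodular G U D) tU tD (hall (U ∩ D) e (∧-intro Ue De)) (wsum-∪∩ U D g)
      where
      arith : ∀ j i a b wj wi wa wb → j + i ≤ a + b → a ≤ suc wa → b ≤ suc wb → suc wi ≤ i → wj + wi ≡ wa + wb → j ≤ suc wj
      arith j i a b wj wi wa wb sub ta tb ti eq = ℕₚ.+-cancelʳ-≤ (suc wi) _ _
        (≤-trans (+-monoʳ-≤ j ti) (≤-trans sub (≤-trans (+-mono-≤ ta tb) (≤-reflexive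
          (trans (s wa wb) (trans (cong (λ z → suc (suc z)) (sym eq)) (sym (s wj wi))))))))
        where
        s : ∀ x y → suc x + suc y ≡ suc (suc (x + y))
        s = solve-∀

    -- A tight set containing `c` but not `a` blocks one of the two given transfers, depending on
    -- whether it contains `b`.
    transfer-trans : ∀ {g a b c} → a ≢ b → Hall G g → Transfer G g a b → Transfer G g b c → Transfer G g a c
    transfer-trans {g} {a} {b} {c} ne h s@(_ , mv , _) t with transfer-or-blocked h (move-source ne mv)
    ... | inj₁ r = r
    ... | inj₂ (U , Uc , Ua , tight) with U b in Ub
    ...   | true  = ⊥-elim (blocked⇒¬transfer (U , Ub , Ua , tight) s)
    ...   | false = ⊥-elim (blocked⇒¬transfer (U , Uc , Ub , tight) t)

    -- A tight set containing `c` but not `a` has lost nothing on the way to `g′`, so it could not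
    -- receive another unit at `c` afterwards.
    transfer-twice : ∀ {g g′ a b c} → a ≢ b → a ≢ c → Hall G g → Move g g′ a b → Transfer G g′ a c → Transfer G g a c
    transfer-twice {g} {g′} {a} {b} {c} ab ac h mv (g″ , mv′ , _ , hall″) with transfer-or-blocked h (move-source ab mv)
    ... | inj₁ r = r
    ... | inj₂ (U , Uc , Ua , tight) = ⊥-elim (<-irrefl refl
      (≤-trans (s≤s (s≤s grows)) (≤-trans (≤-reflexive (cong suc (sym (gains {U = U} mv′ Uc Ua)))) (≤-trans (hall″ U c Uc) tight))))
      where
      grows : wsum U g ≤ wsum U g′
      grows = ≤-trans (m≤m+n _ _) (≤-reflexive (trans (sym (move-wsum mv U)) (trans (cong (λ z → wsum U g′ + b2n z) Ua) (ℕₚ.+-identityʳ _))))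

    module _ {g g′ : Fin m → ℕ} {b a : Fin m} (mv : Move g g′ b a) (h : Hall G g) (h′ : Hall G g′) where

      loses-b : ∀ {U} → Tight G g′ U → U b ≡ true → U a ≡ true
      loses-b {U} tight Ub with U a in Ua
      ... | true  = refl
      ... | false = ⊥-elim (true≢false Ub (tight-avoids {g′} {g} {a} {b} {U} (move-sym mv) h tight Ua))

      -- The transfer from `e` to `p` shows that `U` is not tight for `g`, so its weight rises under
      -- the move from `b` to `a`.
      separates : ∀ {e p U} → Transfer G g e p → Tight G g′ U → U p ≡ true → U e ≡ false → U a ≡ true × U b ≡ false
      separates {e} {p} {U} (g″ , mv″ , _ , hall″) tight Up Ue = gain-sides U mv
        (ℕₚ.≤-pred (≤-trans (≤-reflexive (cong suc (sym (gains {U = U} mv″ Up Ue)))) (≤-trans (hall″ U p Up) tight)))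

      -- Sets blocking `e` from `p` and from `b` at `g′` would both contain `a`, so their union
      -- would be tight; it contains `p` but not `e`, and it contains `b`, against `separates`.
      transfer-later : ∀ {e p} → 1 ≤ g′ e → Transfer G g e p → Transfer G g′ e p ⊎ Transfer G g′ e b
      transfer-later {e} {p} ge t with transfer-or-blocked {b = p} h′ ge | transfer-or-blocked {b = b} h′ ge
      ... | inj₁ r | _ = inj₁ r
      ... | inj₂ _ | inj₁ r = inj₂ r
      ... | inj₂ (U , Up , Ue , tU) | inj₂ (W , Wb , We , tW) =
        ⊥-elim (true≢false (∨-introʳ {U b} Wb) (proj₂ (separates {U = U ∪ W} t tight (∨-introˡ Up) union-e)))
        where
        union-e : (U ∪ W) e ≡ false
        union-e rewrite Ue = We
        tight : Tight G g′ (U ∪ W)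
        tight = tight-∪ {g′} {U} {W} {a} h′ tU tW (proj₁ (separates {U = U} t tU Up Ue)) (loses-b {W} tW Wb)

      -- Sets blocking `e` from `p` and `a` from `p` at `g′` share `p`, so their intersection is
      -- tight; by `separates` it contains `a`, which the second set avoids.
      transfer-earlier : ∀ {e p} → b ≢ a → 1 ≤ g′ e → ¬ Transfer G g′ a p → Transfer G g e p → Transfer G g′ e p
      transfer-earlier {e} {p} ne ge ¬t t with transfer-or-blocked {b = p} h′ ge
      ... | inj₁ r = r
      ... | inj₂ (U , Up , Ue , tU) with ¬transfer⇒blocked h′ (move-source (λ q → ne (sym q)) (move-sym mv)) ¬t
      ...   | W , Wp , Wa , tW = ⊥-elim (true≢false
              (proj₂ (∧-true {U a} (proj₁ (separates {U = U ∩ W} t (tight-∩ {G = G} {g′} {U} {W} h′ tU tW Up) (∧-intro Up Wp) inter-e)))) Wa)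
        where
        inter-e : (U ∩ W) e ≡ false
        inter-e rewrite Ue = refl

  -- A tight set D that blocks the transfer from b to s in G₀ avoids a, stays tight after the removal and keeps v
  -- as a neighbour; by submodularity D and a set U violating the condition for g′ cannot coexist.
  removal-invariant : ∀ {G₀ G : EdgeSet m n} {g g′ b a s v} → Move g g′ b a → G ⊆E G₀ → G s v ≡ true → b ≢ a →
    Hall G₀ g → Hall G₀ g′ → ¬ Transfer G₀ g b s → Hall G g′ →
    Hall (removeEdge G s v) g → Hall (removeEdge G s v) g′
  removal-invariant {G₀} {G} {g} {g′} {b} {a} {s} {v} mv sub Gsv ne h₀ h₀′ ¬t h′ h⁻
    with hall-or-violation (removeEdge G s v) g′ (proj₁ h′)
  ... | inj₁ r = r
  ... | inj₂ (U , viol@((e , Ue) , le)) with violated-edge {T = G} {g′} {s} {v} {U} h′ viol | ¬transfer⇒blocked G₀ h₀ (move-source ne mv) ¬t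
  ...   | Us , tU , only | D , Ds , Db , tD = ⊥-elim
    (arith (∣N G⁻ ∣ (U ∪ D)) (∣N G⁻ ∣ (U ∩ D)) (∣N G⁻ ∣ U) (∣N G⁻ ∣ D) (wsum (U ∪ D) g′) (wsum (U ∩ D) g′) (wsum U g′) (wsum D g′)
      (∣N∣-submodular G⁻ U D) le
      (≤-trans (≤-trans N⁻≤N (≤-trans N≤N₀ tD)) (≤-reflexive (cong suc (sym (keeps D mv Db Da)))))
      (≤-trans (proj₂ h′ (U ∪ D) s (∨-introˡ Us)) N∪≤)
      (≤-trans (≤-reflexive (cong suc (keeps (U ∩ D) mv (inter Db) (inter Da)))) (proj₂ h⁻ (U ∩ D) s (∧-intro Us Ds)))
      (wsum-∪∩ U D g′))
    where
    G⁻ = removeEdge G s v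
    Da : D a ≡ false
    Da = tight-avoids G₀ {g} {g′} {U = D} mv h₀′ tD Db
    inter : ∀ {x} → D x ≡ false → (U ∩ D) x ≡ false
    inter {x} Dx with U x
    ... | true  = Dx
    ... | false = refl
    N⁻≤N : ∣N G⁻ ∣ D ≤ ∣N G ∣ D
    N⁻≤N = ∣N∣-mono {G = G⁻} {G} {D} {D} λ e v′ De p → neighbours-intro {G = G} {D} De (removeEdge-⊆ G s v e v′ p)
    N≤N₀ : ∣N G ∣ D ≤ ∣N G₀ ∣ D
    N≤N₀ = ∣N∣-mono {G = G} {G₀} {D} {D} λ e v′ De p → neighbours-intro {G = G₀} {D} De (sub e v′ p)
    -- `D` is tight already in `G₀` and still obeys the condition in `G⁻`, so none of its neighbours
    -- disappears.
    v∈N⁻D : neighbours G⁻ D v ≡ true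
    v∈N⁻D = b2n-≤⇒ (∑-squeeze {f = b2n ∘ neighbours G⁻ D} {b2n ∘ neighbours G D}
      (λ v′ → b2n-mono λ p → let e , De , q = neighbours-elim {G = G⁻} {D} p in neighbours-intro {G = G} {D} De (removeEdge-⊆ G s v e v′ q))
      (≤-trans N≤N₀ (≤-trans tD (proj₂ h⁻ D s Ds))) v) (neighbours-intro {G = G} {D} Ds Gsv)
    N∪≤ : ∣N G ∣ (U ∪ D) ≤ ∣N G⁻ ∣ (U ∪ D)
    N∪≤ = ∣N∣-mono {G = G} {G⁻} {U ∪ D} {U ∪ D} λ e v′ q p → pick e v′ q p (e Fin.≟ s) (v′ Fin.≟ v)
      where
      pick : ∀ e v′ → (U ∪ D) e ≡ true → G e v′ ≡ true → Dec (e ≡ s) → Dec (v′ ≡ v) → neighbours G⁻ (U ∪ D) v′ ≡ true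
      pick e v′ q p (yes refl) (yes refl) = let d , Dd , r = neighbours-elim {G = G⁻} {D} v∈N⁻D in
        neighbours-intro {G = G⁻} {U ∪ D} (∨-introʳ {U d} Dd) r
      pick e v′ q p (yes _) (no k) = neighbours-intro {G = G⁻} {U ∪ D} q (removeEdge-keeps G s v p λ _ → k)
      pick e v′ q p (no k) _       = neighbours-intro {G = G⁻} {U ∪ D} q (removeEdge-keeps G s v p λ r → contradiction r k)
    -- The neighbourhoods of union and intersection exceed the weights by at least one each, those
    -- of `U` and `D` together by at most one, against submodularity.
    arith : ∀ j i x y wj wi wx wy → j + i ≤ x + y → x ≤ wx → y ≤ suc wy → suc wj ≤ j → suc wi ≤ i → wj + wi ≡ wx + wy → ⊥
    arith j i x y wj wi wx wy sb tx ty tj ti eq = <-irrefl refl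
      (≤-trans (≤-reflexive (two wj wi)) (≤-trans (+-mono-≤ tj ti) (≤-trans sb (≤-trans (+-mono-≤ tx ty)
        (≤-reflexive (trans (ℕₚ.+-suc wx wy) (cong suc (sym eq))))))))
      where
      two : ∀ x y → suc (suc (x + y)) ≡ suc x + suc y
      two = solve-∀

-- Activity with respect to a list of hyperedges

module _ {A : Set} where

  sumOver : (A → ℕ) → List A → ℕ
  sumOver h []       = 0
  sumOver h (x ∷ xs) = h x + sumOver h xs

  sumOver-cong : ∀ {h k : A → ℕ} xs → (∀ {x} → x ∈ xs → h x ≡ k x) → sumOver h xs ≡ sumOver k xs
  sumOver-cong []       eq = refl
  sumOver-cong (x ∷ xs) eq = cong₂ _+_ (eq (here refl)) (sumOver-cong xs (eq ∘ there))

  sumOver-+ : ∀ (h k : A → ℕ) xs → sumOver (λ x → h x + k x) xs ≡ sumOver h xs + sumOver k xs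
  sumOver-+ h k []       = refl
  sumOver-+ h k (x ∷ xs) = trans (cong (h x + k x +_) (sumOver-+ h k xs)) (arith (h x) (k x) (sumOver h xs) (sumOver k xs))
    where
    arith : ∀ a b c d → a + b + (c + d) ≡ a + c + (b + d)
    arith = solve-∀

  sumOver-filter : ∀ {P : A → Set} (P? : Decidable P) h xs →
    sumOver h xs ≡ sumOver h (filter P? xs) + sumOver h (filter (¬? ∘ P?) xs)
  sumOver-filter P? h [] = refl
  sumOver-filter P? h (x ∷ xs) with P? x
  ... | yes _ = trans (cong (h x +_) (sumOver-filter P? h xs)) (sym (ℕₚ.+-assoc (h x) _ _))
  ... | no _  = trans (cong (h x +_) (sumOver-filter P? h xs)) (arith (h x) (sumOver h (filter P? xs)) (sumOver h (filter (¬? ∘ P?) xs)))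
    where
    arith : ∀ a b c → a + (b + c) ≡ b + (a + c)
    arith = solve-∀

  length-⊆ : ∀ {xs ys : List A} → Unique xs → (∀ {x} → x ∈ xs → x ∈ ys) → length xs ≤ length ys
  length-⊆ {[]} _ sub = z≤n
  length-⊆ {x ∷ xs} (x≢ ∷ u) sub with ∈-∃++ (sub (here refl))
  ... | ys₁ , ys₂ , refl = ≤-trans (s≤s (length-⊆ u sub′)) (≤-reflexive (trans (cong suc (length-++ ys₁))
      (trans (sym (ℕₚ.+-suc (length ys₁) (length ys₂))) (sym (length-++ ys₁)))))
    where
    sub′ : ∀ {z} → z ∈ xs → z ∈ ys₁ ++ ys₂
    sub′ {z} i with ∈-++⁻ ys₁ (sub (there i))
    ... | inj₁ j         = ∈-++⁺ˡ j
    ... | inj₂ (here refl) = contradiction refl (All.lookup x≢ i)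
    ... | inj₂ (there j) = ∈-++⁺ʳ ys₁ j

  countIf : (A → Bool) → List A → ℕ
  countIf p = sumOver (b2n ∘ p)

  countIf-filter : ∀ (p : A → Bool) xs → length (filter (λ x → p x Bool.≟ true) xs) ≡ countIf p xs
  countIf-filter p [] = refl
  countIf-filter p (x ∷ xs) with p x
  ... | true  = cong suc (countIf-filter p xs)
  ... | false = countIf-filter p xs

  unique-map-∈ : ∀ {B : Set} (φ : A → B) {xs} → (∀ {x y} → x ∈ xs → y ∈ xs → φ x ≡ φ y → x ≡ y) → Unique xs → Unique (map φ xs)
  unique-map-∈ φ {[]} inj u = []
  unique-map-∈ φ {x ∷ xs} inj (x≢ ∷ u) = Allₚ.map⁺ (All.tabulate λ i eq → All.lookup x≢ i (inj (here refl) (there i) eq))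
    ∷ unique-map-∈ φ (λ i j → inj (there i) (there j)) u

  countIf-injection : ∀ {p q : A → Bool} {xs} (φ : A → A) → Unique xs →
    (∀ {x} → x ∈ xs → p x ≡ true → φ x ∈ xs × q (φ x) ≡ true) →
    (∀ {x y} → p x ≡ true → p y ≡ true → φ x ≡ φ y → x ≡ y) →
    countIf p xs ≤ countIf q xs
  countIf-injection {p} {q} {xs} φ u into inj = ≤-trans (≤-reflexive (trans (sym (countIf-filter p xs)) (sym (length-map φ (filter (λ x → p x Bool.≟ true) xs)))))
    (≤-trans (length-⊆ (unique-map-∈ φ (λ i j → inj (proj₂ (∈-filter⁻ p? {xs = xs} i)) (proj₂ (∈-filter⁻ p? {xs = xs} j))) (Uniqueₚ.filter⁺ p? u)) sub)
      (≤-reflexive (countIf-filter q xs)))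
    where
    p? = λ x → p x Bool.≟ true
    q? = λ x → q x Bool.≟ true
    sub : ∀ {y} → y ∈ map φ (filter p? xs) → y ∈ filter q? xs
    sub i with ∈-map⁻ φ i
    ... | x , j , refl with ∈-filter⁻ p? {xs = xs} j
    ...   | k , px = ∈-filter⁺ q? (proj₁ (into k px)) (proj₂ (into k px))

lookup-ext : ∀ {k} {f g : Vec ℕ k} → (∀ e → lookup f e ≡ lookup g e) → f ≡ g
lookup-ext {f = f} {g} eq = trans (sym (tabulate∘lookup f)) (trans (tabulate-cong eq) (tabulate∘lookup g))

-- Before o p e: some occurrence of p in o precedes every occurrence of e.
Before : ∀ {k} → List (Fin k) → Fin k → Fin k → Set
Before []       p e = ⊥
Before (x ∷ xs) p e = x ≢ e × (p ≡ x ⊎ Before xs p e)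

before? : ∀ {k} o (p e : Fin k) → Dec (Before o p e)
before? []       p e = no λ ()
before? (x ∷ xs) p e = ¬? (x Fin.≟ e) ×-dec ((p Fin.≟ x) ⊎-dec before? xs p e)

module _ {k : ℕ} where

  before-++ˡ : ∀ h {q} {p e : Fin k} → Before h p e → Before (h ++ q) p e
  before-++ˡ (x ∷ h) (ne , inj₁ eq) = ne , inj₁ eq
  before-++ˡ (x ∷ h) (ne , inj₂ b)  = ne , inj₂ (before-++ˡ h b)

  before-++ʳ : ∀ h {q} {p e : Fin k} → e ∉ h → Before q p e → Before (h ++ q) p e
  before-++ʳ []      e∉ b = b
  before-++ʳ (x ∷ h) e∉ b = (λ {refl → e∉ (here refl)}) , inj₂ (before-++ʳ h (e∉ ∘ there) b)

  before-split : ∀ h {q} {p e : Fin k} → Before (h ++ q) p e → Before h p e ⊎ (e ∉ h × Before q p e)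
  before-split []      b = inj₂ ((λ ()) , b)
  before-split (x ∷ h) (ne , inj₁ eq) = inj₁ (ne , inj₁ eq)
  before-split (x ∷ h) (ne , inj₂ b) with before-split h b
  ... | inj₁ b′        = inj₁ (ne , inj₂ b′)
  ... | inj₂ (e∉ , b′) = inj₂ ((λ {(here refl) → ne refl ; (there i) → e∉ i}) , b′)

  before-∈ : ∀ o {p e : Fin k} → Before o p e → p ∈ o
  before-∈ (x ∷ o) (_ , inj₁ refl) = here refl
  before-∈ (x ∷ o) (_ , inj₂ b)    = there (before-∈ o b)

  ∈-before : ∀ {o} {p e : Fin k} → p ∈ o → e ∉ o → Before o p e
  ∈-before (here refl) e∉ = (λ {refl → e∉ (here refl)}) , inj₁ refl
  ∈-before (there i)   e∉ = (λ {refl → e∉ (here refl)}) , inj₂ (∈-before i (e∉ ∘ there))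

  before-≢ : ∀ o {p e : Fin k} → Before o p e → p ≢ e
  before-≢ (x ∷ o) (ne , inj₁ refl) = ne
  before-≢ (x ∷ o) (ne , inj₂ b)    = before-≢ o b

  before-prefix : ∀ h {q r} {p e : Fin k} → (e ∉ h → Before q p e → Before h p e ⊎ Before r p e) → Before (h ++ q) p e → Before (h ++ r) p e
  before-prefix h imp b with before-split h b
  ... | inj₁ b′ = before-++ˡ h b′
  ... | inj₂ (e∉ , b′) with imp e∉ b′
  ...   | inj₁ b″ = before-++ˡ h b″
  ...   | inj₂ b″ = before-++ʳ h e∉ b″

  -- An element of `h` already precedes everything outside `h`, so a later occurrence adds nothing.
  -- This disposes of hyperedges that the process meets repeatedly.
  before-dropˡ : ∀ h {x q} {p e : Fin k} → x ∈ h → Before (h ++ x ∷ q) p e → Before (h ++ q) p e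
  before-dropˡ h x∈ = before-prefix h λ { e∉ (ne , inj₁ refl) → inj₁ (∈-before x∈ e∉) ; e∉ (ne , inj₂ b) → inj₂ b }

  before-dropʳ : ∀ h {x q} {p e : Fin k} → x ∈ h → Before (h ++ q) p e → Before (h ++ x ∷ q) p e
  before-dropʳ h x∈ = before-prefix h λ e∉ b → inj₂ ((λ {refl → e∉ x∈}) , inj₂ b)

module _ {m n : ℕ} (G : EdgeSet m n) where

  abstract

    transfer? : ∀ g a b → Dec (Transfer G g a b)
    transfer? g a b with 1 ≤? g a
    ... | yes ga = let g′ , mv = move-exists g a b ga in
      map′ (λ h → g′ , mv , h) (λ (g″ , mv″ , h) → hall-cong {G = G} (move-unique mv″ mv) h) (hall? G g′)
    ... | no ¬ga with a Fin.≟ b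
    ...   | no ne    = no λ (g′ , mv , _) → ¬ga (move-source ne mv)
    ...   | yes refl = map′ (λ h → g , (λ e → refl) , h)
      (λ (g′ , mv , h) → hall-cong {G = G} (λ e → ℕₚ.+-cancelʳ-≡ (b2n (e == a)) _ _ (mv e)) h) (hall? G g)

  -- The requirement `1 ≤ f e` of internal inactivity is contained in the `Move` equation, because
  -- `p` and `e` differ.
  Inactive : Vec ℕ m → List (Fin m) → Fin m → Set
  Inactive f o e = ∃ λ p → Before o p e × Transfer G (lookup f) e p

  abstract

    inactive? : ∀ f o e → Dec (Inactive f o e)
    inactive? f o e = any? λ p → before? o p e ×-dec transfer? (lookup f) e p

  inactive : Vec ℕ m → List (Fin m) → Fin m → Bool
  inactive f o e = ⌊ inactive? f o e ⌋

  inactivity : Vec ℕ m → List (Fin m) → ℕ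
  inactivity f o = card (inactive f o)

⌊⌋-sound : ∀ {P : Set} {d : Dec P} → ⌊ d ⌋ ≡ true → P
⌊⌋-sound {d = yes p} _ = p

⌊⌋-complete : ∀ {P : Set} {d : Dec P} → P → ⌊ d ⌋ ≡ true
⌊⌋-complete {d = yes _} _ = refl
⌊⌋-complete {d = no ¬p} p = contradiction p ¬p

⌊⌋-false : ∀ {P : Set} {d : Dec P} → ¬ P → ⌊ d ⌋ ≡ false
⌊⌋-false {d = yes p} ¬p = contradiction p ¬p
⌊⌋-false {d = no _}  _  = refl

⌊⌋-cong : ∀ {P Q : Set} {d : Dec P} {d′ : Dec Q} → (P → Q) → (Q → P) → ⌊ d ⌋ ≡ ⌊ d′ ⌋
⌊⌋-cong {d = yes p} f g = sym (⌊⌋-complete (f p))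
⌊⌋-cong {d = no ¬p} f g = sym (⌊⌋-false (¬p ∘ g))

card-split : ∀ {k} (U : Fin k → Bool) {a b} → a ≢ b →
  card U ≡ card (λ e → U e ∧ not ((e == a) ∨ (e == b))) + b2n (U a) + b2n (U b)
card-split {k} U {a} {b} ne = trans (∑-cong pt) (trans (∑-+ {k} (λ e → r e + s a e) (s b))
  (cong₂ _+_ (trans (∑-+ {k} r (s a)) (cong (∑ r +_) (s-sum a))) (s-sum b)))
  where
  r : Fin k → ℕ
  r e = b2n (U e ∧ not ((e == a) ∨ (e == b)))
  s : Fin k → Fin k → ℕ
  s c e = if e == c then b2n (U e) else 0
  s-sum : ∀ c → ∑ (s c) ≡ b2n (U c)
  s-sum c = trans (∑-single c λ i i≢ → cong (λ z → if z then b2n (U i) else 0) (==-≢ i≢))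
    (cong (λ z → if z then b2n (U c) else 0) (==-refl c))
  pt : ∀ e → b2n (U e) ≡ r e + s a e + s b e
  pt e with e Fin.≟ a | e Fin.≟ b
  ... | yes refl | yes refl = contradiction refl ne
  ... | yes _ | no _ with U e
  ...   | true = refl
  ...   | false = refl
  pt e | no _ | yes _ with U e
  ...   | true = refl
  ...   | false = refl
  pt e | no _ | no _ with U e
  ...   | true = refl
  ...   | false = refl

infix 4 _=ᵇ_
_=ᵇ_ : ℕ → ℕ → Bool
i =ᵇ j = ⌊ i ℕₚ.≟ j ⌋

-- The pointwise effect of exchanging two consecutive hyperedges a, b: α and β say whether a and b are
-- inactive on account of their common predecessors, x and y whether b can be moved to a and a to b.
swap-identity : ∀ k r α β x y → (α ≡ true → β ≡ false → x ≡ false) → (β ≡ true → α ≡ false → y ≡ false) →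
  let x′ = not α ∧ not β ∧ x ; y′ = not β ∧ not α ∧ y in
  b2n (r + b2n α + b2n (β ∨ x) =ᵇ k) + b2n (x′ ∧ (r =ᵇ k)) + b2n (y′ ∧ (suc r =ᵇ k)) ≡
  b2n (r + b2n (α ∨ y) + b2n β =ᵇ k) + b2n (y′ ∧ (r =ᵇ k)) + b2n (x′ ∧ (suc r =ᵇ k))
swap-identity k r true  true  x y _ _ = refl
swap-identity k r true  false x y h _ rewrite h refl refl = refl
swap-identity k r false true  x y _ h rewrite h refl refl = refl
swap-identity k r false false x y _ _
  rewrite ℕₚ.+-identityʳ r | ℕₚ.+-identityʳ (r + b2n y) = go x y
  where
  go : ∀ x y → b2n (r + b2n x =ᵇ k) + b2n (x ∧ (r =ᵇ k)) + b2n (y ∧ (suc r =ᵇ k)) ≡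
    b2n (r + b2n y =ᵇ k) + b2n (y ∧ (r =ᵇ k)) + b2n (x ∧ (suc r =ᵇ k))
  go true  true  = refl
  go false false = refl
  go true  false rewrite ℕₚ.+-identityʳ r | ℕₚ.+-comm r 1 = arith (b2n (suc r =ᵇ k)) (b2n (r =ᵇ k))
    where
    arith : ∀ u v → u + v + 0 ≡ v + 0 + u
    arith = solve-∀
  go false true rewrite ℕₚ.+-identityʳ r | ℕₚ.+-comm r 1 = arith (b2n (suc r =ᵇ k)) (b2n (r =ᵇ k))
    where
    arith : ∀ u v → v + 0 + u ≡ u + v + 0
    arith = solve-∀

-- Reordering hyperedges

move-isMove : ∀ {m n : ℕ} (f : Vec ℕ m) {a b} → a ≢ b → 1 ≤ lookup f a → Move (lookup f) (lookup (move {m} {n} f a b)) a b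
move-isMove f {a} {b} ne fa e with e Fin.≟ a | e Fin.≟ b
... | yes refl | yes refl = contradiction refl ne
... | yes refl | no e≢b rewrite lookup∘updateAt′ a b {suc} e≢b (f [ a ]%= pred) | lookup∘updateAt a {pred} f =
  trans (ℕₚ.m∸n+n≡m fa) (sym (ℕₚ.+-identityʳ _))
... | no e≢a | yes refl rewrite lookup∘updateAt b {suc} (f [ a ]%= pred) | lookup∘updateAt′ b a {pred} e≢a f =
  trans (ℕₚ.+-identityʳ _) (ℕₚ.+-comm 1 _)
... | no e≢a | no e≢b rewrite lookup∘updateAt′ e b {suc} e≢b (f [ a ]%= pred) | lookup∘updateAt′ e a {pred} e≢a f = refl

before-pushʳ : ∀ {k} h {a b : Fin k} {q} → a ∈ h → ∀ {p e} → Before (h ++ a ∷ b ∷ q) p e → Before (h ++ b ∷ a ∷ q) p e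
before-pushʳ h {a} {b} {q} a∈ {p} {e} bp = subst (λ o → Before o p e) (++-assoc h [ b ] (a ∷ q))
  (before-dropʳ (h ++ [ b ]) (∈-++⁺ˡ a∈) (subst (λ o → Before o p e) (sym (++-assoc h [ b ] q)) (before-dropˡ h a∈ bp)))

before-pushˡ : ∀ {k} h {a b : Fin k} {q} → a ∈ h → ∀ {p e} → Before (h ++ b ∷ a ∷ q) p e → Before (h ++ a ∷ b ∷ q) p e
before-pushˡ h {a} {b} {q} a∈ {p} {e} bp = before-dropʳ h a∈ (subst (λ o → Before o p e) (++-assoc h [ b ] q)
  (before-dropˡ (h ++ [ b ]) (∈-++⁺ˡ a∈) (subst (λ o → Before o p e) (sym (++-assoc h [ b ] (a ∷ q))) bp)))

module _ {m n : ℕ} (G : EdgeSet m n) where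

  private
    Tr : Vec ℕ m → Fin m → Fin m → Set
    Tr f a b = Transfer G (lookup f) a b

  transfer⇒move : ∀ {f a b} → a ≢ b → Tr f a b →
    Move (lookup f) (lookup (move {m} {n} f a b)) a b × Hall G (lookup (move {m} {n} f a b))
  transfer⇒move {f} {a} {b} ne (g′ , mv , h) = mv′ , hall-cong {G = G} (move-unique mv mv′) h
    where
    mv′ = move-isMove {m} {n} f ne (move-source ne mv)

  -- For a hypertree `f`, excluding transfers from `b` excludes those from `a` as well: `f′` being a
  -- hypertree, `b` can give to `a`, and `transfer-trans` would carry the unit on into `h`.
  LineClosed : List (Vec ℕ m) → List (Fin m) → Set
  LineClosed F h = ∀ {f f′ a b} → f ∈ F → Move (lookup f) (lookup f′) b a → b ≢ a → a ∉ h → b ∉ h →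
    (∀ s → s ∈ h → ¬ Tr f b s) → Hall G (lookup f′) → f′ ∈ F

  lineClosed-⊆ : ∀ {F h h′} → (∀ {s} → s ∈ h → s ∈ h′) → LineClosed F h → LineClosed F h′
  lineClosed-⊆ sub lc i mv ne a∉ b∉ ¬t = lc i mv ne (a∉ ∘ sub) (b∉ ∘ sub) (λ s j → ¬t s (sub j))

  count : ℕ → List (Vec ℕ m) → (Vec ℕ m → List (Fin m)) → ℕ
  count k F o = countIf (λ f → inactivity G f (o f) =ᵇ k) F

  inactivity-cong : ∀ f {o o′} → (∀ {p e} → Before o p e → Before o′ p e) → (∀ {p e} → Before o′ p e → Before o p e) →
    inactivity G f o ≡ inactivity G f o′
  inactivity-cong f {o} {o′} to from = card-cong {U = inactive G f o} {inactive G f o′} λ e → ⌊⌋-cong {d = inactive? G f o e} {inactive? G f o′ e} (λ (p , b , t) → p , to b , t) (λ (p , b , t) → p , from b , t)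

  before-exchange : ∀ h {a b q} {p e : Fin m} → e ≢ a → e ≢ b → Before (h ++ a ∷ b ∷ q) p e → Before (h ++ b ∷ a ∷ q) p e
  before-exchange h ea eb = before-prefix h λ
    { _ (_ , inj₁ refl)            → inj₂ ((λ r → eb (sym r)) , inj₂ ((λ r → ea (sym r)) , inj₁ refl))
    ; _ (_ , inj₂ (_ , inj₁ refl)) → inj₂ ((λ r → eb (sym r)) , inj₁ refl)
    ; _ (_ , inj₂ (_ , inj₂ c))    → inj₂ ((λ r → eb (sym r)) , inj₂ ((λ r → ea (sym r)) , inj₂ c)) }

  module Adjacent (F : List (Vec ℕ m)) (uniq : Unique F) (halls : ∀ {f} → f ∈ F → Hall G (lookup f))
    (h q : List (Fin m)) (closed : LineClosed F h) where

    order : Fin m → Fin m → List (Fin m)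
    order a b = h ++ a ∷ b ∷ q

    -- The points of the relevant lines that have a next point in the direction from `b` to `a`.
    exchangeable : Fin m → Fin m → Vec ℕ m → Bool
    exchangeable a b f = not (inactive G f h a) ∧ not (inactive G f h b) ∧ ⌊ transfer? G (lookup f) b a ⌋

    others : Fin m → Fin m → Vec ℕ m → ℕ
    others a b f = card (λ e → inactive G f (order a b) e ∧ not ((e == a) ∨ (e == b)))

    others-cong : ∀ {a b f f′} → (∀ {e} → e ≢ a → e ≢ b → Inactive G f (order a b) e → Inactive G f′ (order b a) e) →
      (∀ {e} → e ≢ a → e ≢ b → Inactive G f′ (order b a) e → Inactive G f (order a b) e) → others a b f ≡ others b a f′
    others-cong {a} {b} {f} {f′} to from = card-cong pt
      where
      pt : ∀ e → inactive G f (order a b) e ∧ not ((e == a) ∨ (e == b)) ≡ inactive G f′ (order b a) e ∧ not ((e == b) ∨ (e == a))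
      pt e with e Fin.≟ a | e Fin.≟ b
      ... | yes _ | yes _ = trans (∧-zeroʳ (inactive G f (order a b) e)) (sym (∧-zeroʳ (inactive G f′ (order b a) e)))
      ... | yes _ | no _ = trans (∧-zeroʳ (inactive G f (order a b) e)) (sym (∧-zeroʳ (inactive G f′ (order b a) e)))
      ... | no _ | yes _ = trans (∧-zeroʳ (inactive G f (order a b) e)) (sym (∧-zeroʳ (inactive G f′ (order b a) e)))
      ... | no ea | no eb = cong (_∧ true) (⌊⌋-cong (to ea eb) (from ea eb))

    ¬inactive⇒ : ∀ {f x} → x ∉ h → ¬ Inactive G f h x → ∀ s → s ∈ h → ¬ Tr f x s
    ¬inactive⇒ x∉ ¬i s j t = ¬i (s , ∈-before j x∉ , t)

    -- If the receiving `p` lies in `h`, it keeps serving by `transfer-earlier`, as `a` has no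
    -- transfer into `h` at `f′`. If `p` comes later, `transfer-later` offers `p` or `b`, and `b`
    -- stands directly after `h` in the new order.
    others-step : ∀ {a b f f′} → a ≢ b → a ∉ h → b ∉ h → Hall G (lookup f) → Hall G (lookup f′) → Move (lookup f) (lookup f′) b a →
      ¬ Inactive G f′ h a → ∀ {e} → e ≢ a → e ≢ b → Inactive G f (order a b) e → Inactive G f′ (order b a) e
    others-step {a} {b} {f} {f′} ne a∉ b∉ hf hf′ mv ¬i {e} ea eb (p , bf , t) with before-split h bf
    ... | inj₁ bh = p , before-++ˡ h bh ,
      transfer-earlier G mv hf hf′ (λ r → ne (sym r)) e≥1 (¬inactive⇒ {f′} {a} a∉ ¬i p (before-∈ h bh)) t
      where
      e≥1 : 1 ≤ lookup f′ e
      e≥1 = subst (1 ≤_) (sym (move-other eb ea mv)) (move-source (λ r → before-≢ (order a b) bf (sym r)) (proj₁ (proj₂ t)))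
    ... | inj₂ (e∉ , _) with transfer-later G mv hf hf′ (subst (1 ≤_) (sym (move-other eb ea mv)) (move-source (λ r → before-≢ (order a b) bf (sym r)) (proj₁ (proj₂ t)))) t
    ...   | inj₁ t′ = p , before-exchange h ea eb bf , t′
    ...   | inj₂ t′ = b , before-++ʳ h e∉ ((λ r → eb (sym r)) , inj₁ refl) , t′

    exchangeable-elim : ∀ {a b f} → exchangeable a b f ≡ true → ¬ Inactive G f h a × ¬ Inactive G f h b × Tr f b a
    exchangeable-elim {a} {b} {f} p with inactive? G f h a | inactive? G f h b
    ... | no na | no nb = na , nb , ⌊⌋-sound p

    exchangeable-intro : ∀ {a b f} → ¬ Inactive G f h a → ¬ Inactive G f h b → Tr f b a → exchangeable a b f ≡ true
    exchangeable-intro {a} {b} {f} na nb t rewrite ⌊⌋-false {d = inactive? G f h a} na | ⌊⌋-false {d = inactive? G f h b} nb = ⌊⌋-complete t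

    -- Shifting by one step along the lines sends points with a next point to points with a previous
    -- one and keeps `others`. `D` is left open because `swap-distinct` compares both `r` and
    -- `r + 1` with `k`.
    half : ∀ {a b} → a ≢ b → a ∉ h → b ∉ h → (D : ℕ → Bool) →
      countIf (λ f → exchangeable a b f ∧ D (others a b f)) F ≤ countIf (λ f → exchangeable b a f ∧ D (others b a f)) F
    half {a} {b} ne a∉ b∉ D = countIf-injection (λ f → move {m} {n} f b a) uniq into injective
      where
      ba : b ≢ a
      ba r = ne (sym r)
      into : ∀ {f} → f ∈ F → exchangeable a b f ∧ D (others a b f) ≡ true →
        move {m} {n} f b a ∈ F × exchangeable b a (move {m} {n} f b a) ∧ D (others b a (move {m} {n} f b a)) ≡ true
      into {f} f∈ p with ∧-true {exchangeable a b f} p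
      ... | x , d with exchangeable-elim {a} {b} {f} x
      ...   | na , nb , t with transfer⇒move {f} ba t
      ...     | mv , hf′ = closed f∈ mv ba a∉ b∉ (¬inactive⇒ {f} {b} b∉ nb) hf′ ,
        ∧-intro (exchangeable-intro {b} {a} {f′} nb′ na′ (lookup f , move-sym mv , hf)) (trans (cong D (sym same)) d)
        where
        f′ = move {m} {n} f b a
        hf = halls f∈
        -- Giving from `a` to `s` at `f′` reaches the same vector as giving from `b` to `s` at `f`.
        -- For `b`, two units would leave it, which `transfer-twice` reduces to one.
        na′ : ¬ Inactive G f′ h a
        na′ (s , bs , g″ , mv″ , h″) = nb (s , ∈-before (before-∈ h bs) b∉ , g″ , move-trans mv mv″ , h″)
        nb′ : ¬ Inactive G f′ h b
        nb′ (s , bs , t″) = nb (s , bs , transfer-twice G ba (λ r → before-≢ h bs (sym r)) hf mv t″)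
        same : others a b f ≡ others b a f′
        same = others-cong {a} {b} {f} {f′} (others-step {a} {b} {f} {f′} ne a∉ b∉ hf hf′ mv na′)
          (λ ea eb → others-step {b} {a} {f′} {f} ba b∉ a∉ hf′ hf (move-sym mv) nb eb ea)
      injective : ∀ {f g} → exchangeable a b f ∧ D (others a b f) ≡ true → exchangeable a b g ∧ D (others a b g) ≡ true →
        move {m} {n} f b a ≡ move {m} {n} g b a → f ≡ g
      injective {f} {g} p p′ eq with exchangeable-elim {a} {b} {f} (proj₁ (∧-true p)) | exchangeable-elim {a} {b} {g} (proj₁ (∧-true p′))
      ... | _ , _ , t | _ , _ , t′ = lookup-ext (move-unique (move-sym (proj₁ (transfer⇒move {f} ba t)))
        (move-sym (subst (λ z → Move (lookup g) (lookup z) b a) (sym eq) (proj₁ (transfer⇒move {g} ba t′)))))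

    inactive-first : ∀ {f a b} → a ∉ h → inactive G f (order a b) a ≡ inactive G f h a
    inactive-first {f} {a} {b} a∉ = ⌊⌋-cong to λ (p , bp , t) → p , before-++ˡ h bp , t
      where
      to : Inactive G f (order a b) a → Inactive G f h a
      to (p , bp , t) with before-split h bp
      ... | inj₁ bh = p , bh , t
      ... | inj₂ (_ , (aa , _)) = contradiction refl aa

    inactive-second : ∀ {f a b} → a ≢ b → b ∉ h → inactive G f (order a b) b ≡ inactive G f h b ∨ ⌊ transfer? G (lookup f) b a ⌋
    inactive-second {f} {a} {b} ne b∉ with inactive? G f h b
    ... | yes (p , bp , t) = ⌊⌋-complete (p , before-++ˡ h bp , t)
    ... | no ni = ⌊⌋-cong to λ t → a , before-++ʳ h b∉ (ne , inj₁ refl) , t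
      where
      to : Inactive G f (order a b) b → Tr f b a
      to (p , bp , t) with before-split h bp
      ... | inj₁ bh = contradiction (p , bh , t) ni
      ... | inj₂ (_ , (_ , inj₁ refl)) = t
      ... | inj₂ (_ , (_ , inj₂ (bb , _))) = contradiction refl bb

    inactivity-split : ∀ {a b} f → a ≢ b → a ∉ h → b ∉ h → inactivity G f (order a b) ≡
      others a b f + b2n (inactive G f h a) + b2n (inactive G f h b ∨ ⌊ transfer? G (lookup f) b a ⌋)
    inactivity-split {a} {b} f ne a∉ b∉ = trans (card-split (inactive G f (order a b)) ne)
      (cong₂ (λ x y → others a b f + b2n x + b2n y) (inactive-first {f} {a} {b} a∉) (inactive-second {f} {a} {b} ne b∉))

    -- A unit given by `b` to `a` could go on from `a` into `h`, making `b` inactive on account of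
    -- `h`. This supplies the hypotheses of `swap-identity`.
    exclusive : ∀ {a b f} → a ≢ b → a ∉ h → b ∉ h → f ∈ F → inactive G f h a ≡ true → inactive G f h b ≡ false →
      ⌊ transfer? G (lookup f) b a ⌋ ≡ false
    exclusive {a} {b} {f} ne a∉ b∉ f∈ ia ib with ⌊⌋-sound {d = inactive? G f h a} ia
    ... | p , bp , t = ⌊⌋-false λ t′ → true≢false
      (⌊⌋-complete {d = inactive? G f h b} (p , ∈-before (before-∈ h bp) b∉ , transfer-trans G (λ r → ne (sym r)) (halls f∈) t′ t)) ib

    -- The counts agree pointwise only after corrections are added on both sides; by `half` in both
    -- directions the corrections have equal totals and cancel.
    swap-distinct : ∀ k {a b} → a ≢ b → a ∉ h → b ∉ h → count k F (λ _ → order a b) ≡ count k F (λ _ → order b a)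
    swap-distinct k {a} {b} ne a∉ b∉ = ℕₚ.+-cancelʳ-≡ (sumOver (u f₁) F) _ _ (ℕₚ.+-cancelʳ-≡ (sumOver (u f₂) F) _ _
      (trans (sym (sum₃ c₁ (u f₁) (u f₂))) (trans (sumOver-cong F pointwise) (trans (sum₃ c₂ (u f₃) (u f₄))
        (cong₂ (λ y z → sumOver c₂ F + y + z) (equal (_=ᵇ k)) (sym (equal (λ r → suc r =ᵇ k))))))))
      where
      ba : b ≢ a
      ba r = ne (sym r)
      u : (Vec ℕ m → Bool) → Vec ℕ m → ℕ
      u p = b2n ∘ p
      c₁ c₂ : Vec ℕ m → ℕ
      c₁ f = b2n (inactivity G f (order a b) =ᵇ k)
      c₂ f = b2n (inactivity G f (order b a) =ᵇ k)
      f₁ f₂ f₃ f₄ : Vec ℕ m → Bool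
      f₁ f = exchangeable a b f ∧ (others a b f =ᵇ k)
      f₂ f = exchangeable b a f ∧ (suc (others b a f) =ᵇ k)
      f₃ f = exchangeable b a f ∧ (others b a f =ᵇ k)
      f₄ f = exchangeable a b f ∧ (suc (others a b f) =ᵇ k)
      sum₃ : ∀ x y z → sumOver (λ f → x f + y f + z f) F ≡ sumOver x F + sumOver y F + sumOver z F
      sum₃ x y z = trans (sumOver-+ (λ f → x f + y f) z F) (cong (_+ sumOver z F) (sumOver-+ x y F))
      equal : ∀ D → countIf (λ f → exchangeable b a f ∧ D (others b a f)) F ≡ countIf (λ f → exchangeable a b f ∧ D (others a b f)) F
      equal D = ℕₚ.≤-antisym (half ba b∉ a∉ D) (half ne a∉ b∉ D)
      arith : ∀ x y z → x + y + z ≡ x + z + y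
      arith = solve-∀
      pointwise : ∀ {f} → f ∈ F → c₁ f + u f₁ f + u f₂ f ≡ c₂ f + u f₃ f + u f₄ f
      pointwise {f} f∈
        rewrite inactivity-split {a} {b} f ne a∉ b∉ | inactivity-split {b} {a} f ba b∉ a∉
              | others-cong {b} {a} {f} {f} (λ eb ea (p , bp , t) → p , before-exchange h eb ea bp , t) (λ eb ea (p , bp , t) → p , before-exchange h ea eb bp , t)
              | arith (others a b f) (b2n (inactive G f h b)) (b2n (inactive G f h a ∨ ⌊ transfer? G (lookup f) a b ⌋))
        = swap-identity k (others a b f) (inactive G f h a) (inactive G f h b) ⌊ transfer? G (lookup f) b a ⌋ ⌊ transfer? G (lookup f) a b ⌋
            (exclusive ne a∉ b∉ f∈) (exclusive ba b∉ a∉ f∈)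

  -- Bringing a hyperedge to the front

  module _ (F : List (Vec ℕ m)) (uniq : Unique F) (halls : ∀ {f} → f ∈ F → Hall G (lookup f)) where

    count-cong : ∀ k {o o′} → (∀ {p e} → Before o p e → Before o′ p e) → (∀ {p e} → Before o′ p e → Before o p e) →
      count k F (λ _ → o) ≡ count k F (λ _ → o′)
    count-cong k to from = sumOver-cong F λ {f} _ → cong (λ z → b2n (z =ᵇ k)) (inactivity-cong f to from)

    count-swap : ∀ k h q a b → LineClosed F h → count k F (λ _ → h ++ a ∷ b ∷ q) ≡ count k F (λ _ → h ++ b ∷ a ∷ q)
    count-swap k h q a b closed with a Fin.≟ b | DecMembership._∈?_ Fin._≟_ a h | DecMembership._∈?_ Fin._≟_ b h
    ... | yes refl | _ | _ = refl
    ... | no ne | no a∉ | no b∉ = Adjacent.swap-distinct F uniq halls h q closed k ne a∉ b∉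
    ... | no ne | yes a∈ | _ = count-cong k (before-pushʳ h a∈) (before-pushˡ h a∈)
    ... | no ne | no _ | yes b∈ = count-cong k (before-pushˡ h b∈) (before-pushʳ h b∈)

    -- Most of the exchanged pairs stand after a longer segment than `h`, so closedness is needed
    -- for extensions of `h`; `lineClosed-⊆` supplies it.
    count-advance : ∀ k p h q x → LineClosed F h → count k F (λ _ → h ++ p ++ x ∷ q) ≡ count k F (λ _ → h ++ x ∷ p ++ q)
    count-advance k []      h q x closed = refl
    count-advance k (y ∷ p) h q x closed = trans
      (subst₂ (λ o o′ → count k F (λ _ → o) ≡ count k F (λ _ → o′)) (++-assoc h [ y ] (p ++ x ∷ q)) (++-assoc h [ y ] (x ∷ p ++ q))
        (count-advance k p (h ++ [ y ]) q x (lineClosed-⊆ ∈-++⁺ˡ closed)))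
      (count-swap k h (p ++ q) y x closed)

    -- The old occurrence of `x` is invisible to `Before`, which leaves `count-advance`. As `o` is
    -- kept whole after `x`, the hyperedges not yet met need not be recorded.
    count-prepend : ∀ k h {o} x → LineClosed F h → x ∈ o → count k F (λ _ → h ++ x ∷ o) ≡ count k F (λ _ → h ++ o)
    count-prepend k h x closed x∈ with ∈-∃++ x∈
    ... | p , q , refl = trans (count-cong k
        (λ {p′} {e} bp → subst (λ o → Before o p′ e) (assoc p q) (before-dropˡ (h ++ x ∷ p) (∈-++⁺ʳ h (here refl)) (subst (λ o → Before o p′ e) (sym (assoc p (x ∷ q))) bp)))
        (λ {p′} {e} bp → subst (λ o → Before o p′ e) (assoc p (x ∷ q)) (before-dropʳ (h ++ x ∷ p) (∈-++⁺ʳ h (here refl)) (subst (λ o → Before o p′ e) (sym (assoc p q)) bp))))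
      (sym (count-advance k p h q x closed))
      where
      assoc : ∀ p r → (h ++ x ∷ p) ++ r ≡ h ++ x ∷ p ++ r
      assoc p r = ++-assoc h (x ∷ p) r

-- Cyclic successors

module _ {A : Set} (_≟A_ : DecidableEquality A) where

  -- The cyclic order cut open at `y`, which is itself left out: the list that `cycSucc` searches.
  data Rotation (xs : List A) (y : A) : List A → Set where
    rotated : ∀ p q → xs ≡ p ++ y ∷ q → Rotation xs y (q ++ p)

  rotation : ∀ {xs y} → y ∈ xs → ∃ (Rotation xs y)
  rotation y∈ with ∈-∃++ y∈
  ... | p , q , eq = q ++ p , rotated p q eq

  breakAt-spec : ∀ p {y q} → Unique (p ++ y ∷ q) → breakAt _≟A_ y (p ++ y ∷ q) ≡ (p , q)
  breakAt-spec [] {y} u with y ≟A y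
  ... | yes _ = refl
  ... | no ne = contradiction refl ne
  breakAt-spec (x ∷ p) {y} (x≢ ∷ u) with x ≟A y
  ... | yes refl = contradiction refl (All.lookup x≢ (∈-++⁺ʳ p (here refl)))
  ... | no _ rewrite breakAt-spec p u = refl

  cycSucc-rotation : ∀ {xs y l} keep → Unique xs → Rotation xs y l → cycSucc _≟A_ keep xs y ≡ firstKept _≟A_ keep y l
  cycSucc-rotation keep u (rotated p q refl) rewrite breakAt-spec p u = refl

  ++-split : ∀ (q : List A) {p} l₁ {z l₂} → q ++ p ≡ l₁ ++ z ∷ l₂ →
    (∃ λ l → q ≡ l₁ ++ z ∷ l × l₂ ≡ l ++ p) ⊎ (∃ λ l → l₁ ≡ q ++ l × p ≡ l ++ z ∷ l₂)
  ++-split []      l₁       eq   = inj₂ (l₁ , refl , eq)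
  ++-split (x ∷ q) []       refl = inj₁ (q , refl , refl)
  ++-split (x ∷ q) (y ∷ l₁) eq with ∷-injective eq
  ... | refl , eq′ with ++-split q l₁ eq′
  ...   | inj₁ (l , refl , e) = inj₁ (l , refl , e)
  ...   | inj₂ (l , refl , e) = inj₂ (l , refl , e)

  rotation-shift : ∀ {xs y l} l₁ {z l₂} → l ≡ l₁ ++ z ∷ l₂ → Rotation xs y l → Rotation xs z (l₂ ++ y ∷ l₁)
  rotation-shift {y = y} l₁ {z} eq (rotated p q refl) with ++-split q l₁ eq
  ... | inj₁ (l , refl , refl) = subst (Rotation _ z) (sym (++-assoc l p (y ∷ l₁)))
        (rotated (p ++ y ∷ l₁) l (sym (++-assoc p (y ∷ l₁) (z ∷ l))))
  ... | inj₂ (l , refl , refl) = subst (Rotation _ z) (++-assoc _ (y ∷ q) l)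
        (rotated l (_ ++ y ∷ q) (++-assoc l (z ∷ _) (y ∷ q)))

  firstKept-skip : ∀ keep d l {r} → (∀ {x} → x ∈ l → keep x ≡ false) → firstKept _≟A_ keep d (l ++ r) ≡ firstKept _≟A_ keep d r
  firstKept-skip keep d []      none = refl
  firstKept-skip keep d (x ∷ l) none rewrite none (here refl) = firstKept-skip keep d l (none ∘ there)

  firstKept-default : ∀ keep d l {y r} → keep y ≡ true → firstKept _≟A_ keep d (l ++ y ∷ r) ≡ firstKept _≟A_ keep y l
  firstKept-default keep d []      ky rewrite ky = refl
  firstKept-default keep d (x ∷ l) ky with keep x
  ... | true  = refl
  ... | false = firstKept-default keep d l ky

  firstKept-stable : ∀ {keep keep′} d l → (∀ {x} → keep′ x ≡ true → keep x ≡ true) →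
    keep′ (firstKept _≟A_ keep d l) ≡ true → firstKept _≟A_ keep′ d l ≡ firstKept _≟A_ keep d l
  firstKept-stable d [] sub k = refl
  firstKept-stable {keep} {keep′} d (x ∷ l) sub k with keep x in eq | keep′ x in eq′
  ... | true  | true  = refl
  ... | true  | false = ⊥-elim (true≢false k eq′)
  ... | false | true  = ⊥-elim (true≢false (sub eq′) eq)
  ... | false | false = firstKept-stable d l sub k

  firstKept-cases : ∀ keep d l → (firstKept _≟A_ keep d l ≡ d × (∀ {x} → x ∈ l → keep x ≡ false)) ⊎
    (∃ λ l₁ → ∃ λ l₂ → l ≡ l₁ ++ firstKept _≟A_ keep d l ∷ l₂ × (∀ {x} → x ∈ l₁ → keep x ≡ false) × keep (firstKept _≟A_ keep d l) ≡ true)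
  firstKept-cases keep d [] = inj₁ (refl , λ ())
  firstKept-cases keep d (x ∷ l) with keep x in eq
  ... | true = inj₂ ([] , l , refl , (λ ()) , eq)
  ... | false with firstKept-cases keep d l
  ...   | inj₁ (e , none) = inj₁ (e , λ {(here refl) → eq ; (there i) → none i})
  ...   | inj₂ (l₁ , l₂ , e , none , k) = inj₂ (x ∷ l₁ , l₂ , cong (x ∷_) e , (λ {(here refl) → eq ; (there i) → none i}) , k)

  rotation-∈ : ∀ {xs y l z} → Rotation xs y l → z ∈ xs → z ≡ y ⊎ z ∈ l
  rotation-∈ (rotated p q refl) z∈ with ∈-++⁻ p z∈
  ... | inj₁ i           = inj₂ (∈-++⁺ʳ q i)
  ... | inj₂ (here refl) = inj₁ refl
  ... | inj₂ (there i)   = inj₂ (∈-++⁺ˡ i)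

  module _ {xs : List A} (uniq : Unique xs) where

    cycSucc-kept : ∀ {keep y z} → y ∈ xs → z ∈ xs → keep z ≡ true → keep (cycSucc _≟A_ keep xs y) ≡ true
    cycSucc-kept {keep} {y} {z} y∈ z∈ kz with rotation y∈
    ... | l , rot rewrite cycSucc-rotation keep uniq rot with firstKept-cases keep y l
    ...   | inj₂ (_ , _ , _ , _ , k) = k
    ...   | inj₁ (e , none) with rotation-∈ rot z∈
    ...     | inj₁ refl = trans (cong keep e) kz
    ...     | inj₂ i    = ⊥-elim (true≢false kz (none i))

    cycSucc-stable : ∀ {keep keep′ y} → (∀ {x} → keep′ x ≡ true → keep x ≡ true) →
      keep′ (cycSucc _≟A_ keep xs y) ≡ true → cycSucc _≟A_ keep′ xs y ≡ cycSucc _≟A_ keep xs y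
    cycSucc-stable {keep} {keep′} {y} sub k = firstKept-stable {keep} {keep′} y (proj₂ (breakAt _≟A_ y xs) ++ proj₁ (breakAt _≟A_ y xs)) sub k

    -- Nothing kept lies between `y` and its deleted successor, so both searches see the same
    -- remaining list; the one from the successor ends by meeting `y`, the default of the other.
    -- Hence a removal keeps the link between the last traversal and the current edge.
    cycSucc-skip : ∀ {keep keep′ y} → y ∈ xs → keep′ y ≡ true → (∀ {x} → keep′ x ≡ true → keep x ≡ true) →
      keep′ (cycSucc _≟A_ keep xs y) ≡ false → cycSucc _≟A_ keep′ xs (cycSucc _≟A_ keep xs y) ≡ cycSucc _≟A_ keep′ xs y
    cycSucc-skip {keep} {keep′} {y} y∈ ky sub kz with rotation y∈
    ... | l , rot rewrite cycSucc-rotation keep uniq rot | cycSucc-rotation keep′ uniq rot with firstKept-cases keep y l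
    ...   | inj₁ (e , _) = ⊥-elim (true≢false (trans (cong keep′ e) ky) kz)
    ...   | inj₂ (l₁ , l₂ , e , none , _) = trans (cycSucc-rotation keep′ uniq (rotation-shift l₁ e rot))
            (trans (firstKept-default keep′ _ l₂ ky) (sym (trans (cong (firstKept _≟A_ keep′ y) e)
              (trans (firstKept-skip keep′ y l₁ (λ i → none′ (none i))) last))))
      where
      none′ : ∀ {x} → keep x ≡ false → keep′ x ≡ false
      none′ kx = ¬true λ k′ → true≢false (sub k′) kx
      last : firstKept _≟A_ keep′ y (firstKept _≟A_ keep y l ∷ l₂) ≡ firstKept _≟A_ keep′ y l₂
      last rewrite kz = refl

    cycSucc-orbit : ∀ {keep} {C : A → Set} → (∀ {y} → y ∈ xs → C y → C (cycSucc _≟A_ keep xs y)) →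
      ∀ {y} → y ∈ xs → keep y ≡ true → C y → ∀ {z} → z ∈ xs → keep z ≡ true → C z
    cycSucc-orbit {keep} {C} step {y} y∈ ky Cy {z} z∈ kz with rotation y∈
    ... | l , rot with rotation-∈ rot z∈
    ...   | inj₁ refl = Cy
    ...   | inj₂ i = go [] l [] y∈ Cy (λ ()) (subst (Rotation xs y) (sym (++-identityʳ l)) rot) i
      where
      rotation-self : ∀ {y l} → Rotation xs y l → y ∈ xs
      rotation-self (rotated p q refl) = ∈-++⁺ʳ p (here refl)
      -- `s` holds the elements rejected since `y`, `l` those still to scan, `r` those already
      -- passed; a kept element becomes the new `y` and the cyclic order is cut open there.
      go : ∀ s l r {y} → y ∈ xs → C y → (∀ {x} → x ∈ s → keep x ≡ false) → Rotation xs y (s ++ l ++ r) → z ∈ l → C z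
      go s (x ∷ l) r {y} y∈ Cy none rot z∈ with keep x in kx
      go s (x ∷ l) r {y} y∈ Cy none rot (here refl) | false = ⊥-elim (true≢false kz kx)
      go s (x ∷ l) r {y} y∈ Cy none rot (there i) | false =
        go (s ++ [ x ]) l r y∈ Cy none′ (subst (Rotation xs y) (sym (++-assoc s [ x ] (l ++ r))) rot) i
        where
        none′ : ∀ {w} → w ∈ s ++ [ x ] → keep w ≡ false
        none′ j with ∈-++⁻ s j
        ... | inj₁ j′          = none j′
        ... | inj₂ (here refl) = kx
      go s (x ∷ l) r {y} y∈ Cy none rot z∈ | true = next z∈
        where
        succ≡x : cycSucc _≟A_ keep xs y ≡ x
        succ≡x = trans (cycSucc-rotation keep uniq rot) (trans (firstKept-skip keep y s none) (cong (λ b → if b then x else firstKept _≟A_ keep y (l ++ r)) kx))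
        Cx : C x
        Cx = subst C succ≡x (step y∈ Cy)
        shifted : Rotation xs x ((l ++ r) ++ y ∷ s)
        shifted = rotation-shift s refl rot
        next : z ∈ x ∷ l → C z
        next (here refl) = Cx
        next (there i) = go [] l (r ++ y ∷ s) (rotation-self shifted) Cx (λ ())
          (subst (Rotation xs x) (++-assoc l r (y ∷ s)) shifted) i

-- Tours of a tree

module _ {m n : ℕ} where

  HasTree : EdgeSet m n → (Fin m → ℕ) → Set
  HasTree G g = ∃ λ T → T ⊆E G × IsTreeWith g T

  hasTree-mono : ∀ {G G′ : EdgeSet m n} {g} → G ⊆E G′ → HasTree G g → HasTree G′ g
  hasTree-mono sub (T , sub′ , t) = T , (λ e v p → sub e v (sub′ e v p)) , t

  hasTree-connected : ∀ {G : EdgeSet m n} {g} → HasTree G g → Connected G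
  hasTree-connected (T , sub , conn , _) x y = Star.map (adj-mono sub) (conn x y)

  addEdge : EdgeSet m n → Fin m → Fin n → EdgeSet m n
  addEdge G e v e′ v′ = G e′ v′ ∨ ((e′ == e) ∧ (v′ == v))

  removeAt : EdgeSet m n → Fin m → EdgeSet m n
  removeAt G d e v = G e v ∧ not (e == d)

  -- Cutting the path at its last visit to `d` leaves a remainder that avoids `d`, hence survives
  -- the deletion of `dw`.
  last-departure : ∀ {T : EdgeSet m n} {d v} → Star (Adj T) (inj₁ d) (inj₂ v) →
    ∃ λ w → T d w ≡ true × Star (Adj (removeAt T d)) (inj₂ w) (inj₂ v)
  last-departure {T} {d} {v} s with go s
    where
    T° = removeAt T d
    none : ∀ {w} → ¬ (T d w ∧ not (d == d) ≡ true)
    none {w} p with ∧-true {T d w} p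
    ... | _ , q rewrite ==-refl d = true≢false q refl
    stuck : ¬ Star (Adj T°) (inj₁ d) (inj₂ v)
    stuck (ev p ◅ _) = none p
    keep : ∀ {e w} → T e w ≡ true → e ≢ d → T° e w ≡ true
    keep t ne = ∧-intro t (cong not (==-≢ ne))
    go : ∀ {x} → Star (Adj T) x (inj₂ v) → Star (Adj T°) x (inj₂ v) ⊎ (∃ λ w → T d w ≡ true × Star (Adj T°) (inj₂ w) (inj₂ v))
    go ε = inj₁ ε
    go (a ◅ as) with go as
    go (a ◅ as) | inj₂ r = inj₂ r
    go (ev {e} t ◅ as) | inj₁ s with e Fin.≟ d
    ... | yes refl = inj₂ (_ , t , s)
    ... | no ne    = inj₁ (ev (keep t ne) ◅ s)
    go (ve {e} t ◅ as) | inj₁ s with e Fin.≟ d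
    ... | yes refl = ⊥-elim (stuck s)
    ... | no ne    = inj₁ (ve (keep t ne) ◅ s)
  ... | inj₂ r = r
  ... | inj₁ (ev {v = w} p ◅ _) with ∧-true {T d w} p
  ...   | _ , q rewrite ==-refl d = ⊥-elim (true≢false q refl)

  -- The deleted and the added edge share the hyperedge `d`, so all hyperedge degrees persist.
  -- `side` is the part of `T` beyond `dw`; later it confines walks that do not cross `dw`.
  record Exchange (g : Fin m → ℕ) (T : EdgeSet m n) (d : Fin m) (v : Fin n) : Set where
    field
      w       : Fin n
      edge    : T d w ≡ true
      side    : Node m n → Bool
      closed  : Closed (removeEdge T d w) side
      side-w  : side (inj₂ w) ≡ true
      side-v  : side (inj₂ v) ≡ true
      side-d  : side (inj₁ d) ≡ false
      tree    : IsTreeWith g (addEdge (removeEdge T d w) d v)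

  exchange : ∀ {g T d v} → IsTreeWith g T → T d v ≡ false → Exchange g T d v
  exchange {g} {T} {d} {v} t@(conn , degs , total) Tdv with last-departure (conn (inj₁ d) (inj₂ v))
  ... | w , Tdw , path with reach (removeEdge T d w) (inj₂ w) | reach (removeEdge T d w) (inj₁ d)
  ...   | X , (Xw , pathsX) , closedX | Y , (Yd , pathsY) , closedY = record
    { w = w ; edge = Tdw ; side = X ; closed = closedX ; side-w = Xw ; side-v = Xv
    ; side-d = ¬true λ Xd → bridge conn (treeWith-count {g = g} {T} t) Tdw (pathsX _ Xd)
    ; tree = (λ x y → star-sym (to-d x) ◅◅ to-d y) , degs′ , total }
    where
    T⁻ = removeEdge T d w
    T′ = addEdge T⁻ d v
    w≢v : w ≢ v
    w≢v refl = true≢false Tdw Tdv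
    Xv : X (inj₂ v) ≡ true
    Xv = closed-star closedX (Star.map (adj-mono sub) path) Xw
      where
      sub : removeAt T d ⊆E T⁻
      sub e x p with ∧-true {T e x} p
      ... | q , r = removeEdge-keeps T d w q λ {refl _ → true≢false r (cong not (==-refl e))}
    sub⁻ : T⁻ ⊆E T′
    sub⁻ e x p = ∨-introˡ p
    -- The parts of `w` and of `d` together are closed under all edges of `T`, including `dw`, hence
    -- exhaust the nodes.
    cover : ∀ {x y} → Adj T x y → (X x ∨ Y x) ≡ true → (X y ∨ Y y) ≡ true
    cover {x} {y} a xy with step a
      where
      step : ∀ {x y} → Adj T x y → Adj T⁻ x y ⊎ (y ≡ inj₁ d ⊎ y ≡ inj₂ w)
      step (ev {e} {u} p) with e Fin.≟ d | u Fin.≟ w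
      ... | yes _    | yes refl = inj₂ (inj₂ refl)
      ... | yes _    | no ne    = inj₁ (ev (removeEdge-keeps T d w p λ _ → ne))
      ... | no ne    | _        = inj₁ (ev (removeEdge-keeps T d w p λ q → contradiction q ne))
      step (ve {e} {u} p) with e Fin.≟ d | u Fin.≟ w
      ... | yes refl | yes _    = inj₂ (inj₁ refl)
      ... | yes _    | no ne    = inj₁ (ve (removeEdge-keeps T d w p λ _ → ne))
      ... | no ne    | _        = inj₁ (ve (removeEdge-keeps T d w p λ q → contradiction q ne))
    ... | inj₂ (inj₁ refl) = ∨-introʳ {X y} Yd
    ... | inj₂ (inj₂ refl) = ∨-introˡ Xw
    ... | inj₁ a′ with ∨-true {X x} xy
    ...   | inj₁ Xx = ∨-introˡ (closedX a′ Xx)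
    ...   | inj₂ Yx = ∨-introʳ {X y} (closedY a′ Yx)
    to-d : ∀ x → Star (Adj T′) (inj₁ d) x
    to-d x with ∨-true {X x} (closed-star {G = T} {X = λ z → X z ∨ Y z} cover (conn (inj₁ d) x) (∨-introʳ {X (inj₁ d)} Yd))
    ... | inj₂ Yx = Star.map (adj-mono sub⁻) (pathsY x Yx)
    ... | inj₁ Xx = ev new ◅ Star.map (adj-mono sub⁻) (star-sym (pathsX _ Xv) ◅◅ pathsX x Xx)
      where
      new : T′ d v ≡ true
      new = ∨-introʳ {T⁻ d v} (∧-intro (==-refl d) (==-refl v))
    degs′ : ∀ e → degree T′ e ≡ suc (g e)
    degs′ e = trans (go (e Fin.≟ d)) (degs e)
      where
      go : Dec (e ≡ d) → degree T′ e ≡ degree T e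
      go (no ne) = card-cong pt
        where
        pt : ∀ x → T′ e x ≡ T e x
        pt x rewrite ==-≢ ne = ∨-false (T e x)
      go (yes refl) = ℕₚ.+-cancelʳ-≡ 1 _ _ (trans (cong (degree T′ d +_) (sym (∑-δ w)))
        (trans (sym (∑-+ {n} (b2n ∘ T′ d) (λ x → b2n (x == w)))) (trans (∑-cong pt)
          (trans (∑-+ {n} (b2n ∘ T d) (λ x → b2n (x == v))) (cong (degree T d +_) (∑-δ v))))))
        where
        pt : ∀ x → b2n (T′ d x) + b2n (x == w) ≡ b2n (T d x) + b2n (x == v)
        pt x rewrite ==-refl d with x Fin.≟ w | x Fin.≟ v
        ... | yes refl | yes refl = contradiction refl w≢v
        ... | yes refl | no _  rewrite Tdw = refl
        ... | no _ | yes refl rewrite Tdv = refl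
        ... | no _ | no _ rewrite ∨-false (T d x) = refl

  Traversal : Set
  Traversal = Fin m × Fin n × Side

  _≟ˢ_ : DecidableEquality Side
  fromEmerald ≟ˢ fromEmerald = yes refl
  fromEmerald ≟ˢ fromViolet  = no λ ()
  fromViolet  ≟ˢ fromEmerald = no λ ()
  fromViolet  ≟ˢ fromViolet  = yes refl

  _≟ᵗ_ : DecidableEquality Traversal
  _≟ᵗ_ = ×-≡-dec Fin._≟_ (×-≡-dec Fin._≟_ _≟ˢ_)

  _∈ᵗ?_ : ∀ t L → Dec (t ∈ L)
  _∈ᵗ?_ = DecMembership._∈?_ _≟ᵗ_

  source target : Traversal → Node m n
  source (e , v , fromEmerald) = inj₁ e
  source (e , v , fromViolet)  = inj₂ v
  target (e , v , fromEmerald) = inj₂ v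
  target (e , v , fromViolet)  = inj₁ e

  reverse : Traversal → Traversal
  reverse (e , v , fromEmerald) = e , v , fromViolet
  reverse (e , v , fromViolet)  = e , v , fromEmerald

  target-reverse : ∀ t → target (reverse t) ≡ source t
  target-reverse (e , v , fromEmerald) = refl
  target-reverse (e , v , fromViolet)  = refl

  infix 4 _∋ᵗ_
  _∋ᵗ_ : EdgeSet m n → Traversal → Set
  G ∋ᵗ (e , v , _) = G e v ≡ true

  -- Walks are listed with the most recent traversal first.
  data Walk (x : Node m n) : List Traversal → Node m n → Set where
    []  : Walk x [] x
    _∷_ : ∀ t {L} → Walk x L (source t) → Walk x (t ∷ L) (target t)

  walk-split : ∀ L₁ {L₂ t x y} → Walk x (L₁ ++ t ∷ L₂) y → Walk x L₂ (source t) × Walk (target t) L₁ y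
  walk-split []       (t ∷ w) = w , []
  walk-split (s ∷ L₁) (.s ∷ w) = let a , b = walk-split L₁ w in a , (s ∷ b)

  adj-traversal : ∀ {G : EdgeSet m n} t → G ∋ᵗ t → Adj G (source t) (target t)
  adj-traversal (e , v , fromEmerald) p = ev p
  adj-traversal (e , v , fromViolet)  p = ve p

  -- Only the edge of `c` can lead out of `X`, and its opposite direction starts outside. Forbidding
  -- just one direction matters, since the other may have been used.
  stay : ∀ {T : EdgeSet m n} {X : Node m n → Bool} c →
    Closed (removeEdge T (proj₁ c) (proj₁ (proj₂ c))) X → X (target c) ≡ false →
    ∀ {x L y} → Walk x L y → (∀ {t} → t ∈ L → T ∋ᵗ t) → c ∉ L → X x ≡ true → X y ≡ true
  stay c closed out [] inT c∉ Xx = Xx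
  stay {T} {X} c@(d , w , s) closed out (t@(e , v , _) ∷ walk) inT c∉ Xx with stay {T} {X} c closed out walk (inT ∘ there) (c∉ ∘ there) Xx
  ... | Xs with e Fin.≟ d | v Fin.≟ w
  ...   | no ne | _ = closed (adj-traversal {removeEdge T d w} t (removeEdge-keeps T d w (inT (here refl)) λ p → contradiction p ne)) Xs
  ...   | yes _ | no ne = closed (adj-traversal {removeEdge T d w} t (removeEdge-keeps T d w (inT (here refl)) λ _ → ne)) Xs
  ...   | yes refl | yes refl = ⊥-elim (impossible t s refl refl)
    where
    impossible : ∀ t′ s → t ≡ t′ → c ≡ (d , w , s) → ⊥
    impossible (_ , _ , fromEmerald) fromEmerald refl refl = c∉ (here refl)
    impossible (_ , _ , fromViolet)  fromViolet  refl refl = c∉ (here refl)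
    impossible (_ , _ , fromEmerald) fromViolet  refl refl = true≢false Xs out
    impossible (_ , _ , fromViolet)  fromEmerald refl refl = true≢false Xs out

  closed-complement : ∀ {G : EdgeSet m n} {X} → Closed G X → Closed G (not ∘ X)
  closed-complement {X = X} closed {u} {w} a ¬Xu with X w in Xw
  ... | false = refl
  ... | true rewrite closed (adj-sym a) Xw = ¬Xu

  -- Every edge of a tree is a bridge. After it is crossed by `t`, the rest of the walk followed by
  -- the part before `t` leads back to the source, which requires the opposite crossing.
  closed-walk-reverse : ∀ {g} {T : EdgeSet m n} → IsTreeWith g T → ∀ {x L} → Walk x L x → (∀ {t} → t ∈ L → T ∋ᵗ t) →
    ∀ {t} → t ∈ L → reverse t ∈ L
  closed-walk-reverse {g} {T} tree {x} {L} walk inT {t} t∈ with reverse t ∈ᵗ? L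
  ... | yes r = r
  ... | no r∉ with reach (removeEdge T (proj₁ t) (proj₁ (proj₂ t))) (target t)
  ...   | X , (Xt , paths) , closed with ∈-∃++ t∈
  ...     | L₁ , L₂ , refl = let before-t , after-t = walk-split L₁ walk in
      ⊥-elim (true≢false (go before-t (go after-t Xt ∈-++⁺ˡ) (λ i → ∈-++⁺ʳ L₁ (there i))) Xs)
      where
      not-bridged : ∀ t → T ∋ᵗ t → ¬ Star (Adj (removeEdge T (proj₁ t) (proj₁ (proj₂ t)))) (target t) (source t)
      not-bridged (e , v , fromEmerald) p s = bridge (proj₁ tree) (treeWith-count {g = g} {T} tree) p s
      not-bridged (e , v , fromViolet)  p s = bridge (proj₁ tree) (treeWith-count {g = g} {T} tree) p (star-sym s)
      Xs : X (source t) ≡ false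
      Xs = ¬true λ p → not-bridged t (inT t∈) (paths _ p)
      same : ∀ t → Closed (removeEdge T (proj₁ t) (proj₁ (proj₂ t))) X → Closed (removeEdge T (proj₁ (reverse t)) (proj₁ (proj₂ (reverse t)))) X
      same (e , v , fromEmerald) c = c
      same (e , v , fromViolet)  c = c
      go : ∀ {a b M} → Walk a M b → X a ≡ true → (∀ {s} → s ∈ M → s ∈ L) → X b ≡ true
      go w Xa sub = stay {T} {X} (reverse t) (same t closed) (trans (cong X (target-reverse t)) Xs) w (inT ∘ sub) (λ i → r∉ (sub i)) Xa

  -- A missing edge vd entered from v is exchanged for the first edge of the tree path from d to v, which the walk
  -- has not used yet.
  tree-through-walk : ∀ {g} {G : EdgeSet m n} {x L y} → HasTree G g → Walk x L y → (∀ {t} → t ∈ L → G ∋ᵗ t) →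
    (∀ {e v} → (e , v , fromEmerald) ∈ L → ¬ HasTree (removeEdge G e v) g) →
    ∃ λ T → T ⊆E G × IsTreeWith g T × (∀ {t} → t ∈ L → T ∋ᵗ t)
  tree-through-walk (T , sub , t) [] inG needed = T , sub , t , λ ()
  tree-through-walk {g} {G} ht ((d , v , side) ∷ walk) inG needed
    with tree-through-walk {g} {G} ht walk (inG ∘ there) (needed ∘ there)
  ... | T , sub , t , inT with T d v in Tdv
  ...   | true = T , sub , t , λ {(here refl) → Tdv ; (there i) → inT i}
  tree-through-walk {g} {G} ht ((d , v , fromEmerald) ∷ walk) inG needed | T , sub , t , inT | false =
    ⊥-elim (needed (here refl) (T , (λ e x p → removeEdge-keeps G d v (sub e x p) λ {refl refl → true≢false p Tdv}) , t))
  tree-through-walk {g} {G} ht (_∷_ (d , v , fromViolet) {L} walk) inG needed | T , sub , t , inT | false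
    with exchange {g} {T} {d} {v} t Tdv
  ... | record { w = w ; edge = edge ; side = X ; closed = closed ; side-w = side-w ; side-v = side-v ; side-d = side-d ; tree = tree } =
    T′ , sub′ , tree , λ { {t′} (here refl) → ∨-introʳ {removeEdge T d w d v} (∧-intro (==-refl d) (==-refl v)) ; {t′} (there i) → old t′ i }
    where
    T′ = addEdge (removeEdge T d w) d v
    new : ∀ e x → (e == d) ∧ (x == v) ≡ true → e ≡ d × x ≡ v
    new e x p = ==-sound (proj₁ (∧-true p)) , ==-sound (proj₂ (∧-true {e == d} p))
    sub′ : T′ ⊆E G
    sub′ e x p with ∨-true {removeEdge T d w e x} p
    ... | inj₁ q = sub e x (removeEdge-⊆ T d w e x q)
    ... | inj₂ q with new e x q
    ...   | refl , refl = inG (here refl)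
    -- The exchanged tree avoids `dw`, so `needed` forbids an earlier traversal of `dw` from `d`.
    unused-from-emerald : (d , w , fromEmerald) ∉ L
    unused-from-emerald i = needed (there i) (T′ , sub″ , tree)
      where
      sub″ : T′ ⊆E removeEdge G d w
      sub″ e x p with ∨-true {removeEdge T d w e x} p
      ... | inj₁ q = removeEdge-mono d w sub e x q
      ... | inj₂ q with new e x q
      ...   | refl , refl = removeEdge-keeps G d w (inG (here refl)) λ {_ refl → true≢false edge Tdv}
    -- After crossing from `w` to `d` the walk would be off the side of `w`, yet it ends at `v` on
    -- that side; the only way back is the traversal just excluded.
    unused-from-violet : (d , w , fromViolet) ∉ L
    unused-from-violet i with ∈-∃++ i
    ... | L₁ , L₂ , refl = true≢false (stay {T} {not ∘ X} (d , w , fromEmerald)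
          (closed-complement {removeEdge T d w} closed) (cong not side-w) (proj₂ (walk-split L₁ walk))
          (λ j → inT (∈-++⁺ˡ j)) (λ j → unused-from-emerald (∈-++⁺ˡ j)) (cong not side-d)) (cong not side-v)
    old : ∀ t′ → t′ ∈ L → T′ ∋ᵗ t′
    old (e , x , s) i = ∨-introˡ (removeEdge-keeps T d w (inT i) λ {refl refl → used s i})
      where
      used : ∀ s → (d , w , s) ∉ L
      used fromEmerald = unused-from-emerald
      used fromViolet  = unused-from-violet

  -- Tours following a ribbon structure

  module Tour {H : Hypergraph m n} (ρ : Ribbon H) where

    succE : EdgeSet m n → Fin m → Fin n → Fin n
    succE G e v = cycSucc Fin._≟_ (λ w → G e w) (rotE ρ e) v

    succV : EdgeSet m n → Fin n → Fin m → Fin m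
    succV G v e = cycSucc Fin._≟_ (λ d → G d v) (rotV ρ v) e

    next : EdgeSet m n → Traversal → Traversal
    next G (e , v , fromEmerald) = succV G v e , v , fromViolet
    next G (e , v , fromViolet)  = e , succE G e v , fromEmerald

    source-next : ∀ G t → source (next G t) ≡ target t
    source-next G (e , v , fromEmerald) = refl
    source-next G (e , v , fromViolet)  = refl

    Follows : EdgeSet m n → Traversal → Traversal → Set
    Follows G s t = s ≡ next G t

    linked-walk : ∀ {G} p {z z₀} → Linked (Follows G) (z ∷ p ++ [ z₀ ]) → Walk (target z₀) p (source z)
    linked-walk {G} [] {z₀ = z₀} (refl ∷ _) = subst (Walk (target z₀) []) (sym (source-next G z₀)) []
    linked-walk {G} (t ∷ p) {z₀ = z₀} (refl ∷ l) = subst (Walk (target z₀) (t ∷ p)) (sym (source-next G t)) (t ∷ linked-walk p l)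

    linked-next : ∀ {G} p {z z₀} → Linked (Follows G) (z ∷ p ++ [ z₀ ]) → ∀ {t} → t ∈ p ++ [ z₀ ] → next G t ∈ z ∷ p
    linked-next []      (refl ∷ _) (here refl) = here refl
    linked-next (s ∷ p) (refl ∷ l) (here refl) = here refl
    linked-next (s ∷ p) (_ ∷ l)    (there i)   = there (linked-next p l i)

    rotE-∈ : ∀ {G} → G ⊆E inc H → ∀ {e v} → G e v ≡ true → v ∈ rotE ρ e
    rotE-∈ sub p = Equivalence.from (rotE-mem ρ _ _) (sub _ _ p)

    rotV-∈ : ∀ {G} → G ⊆E inc H → ∀ {e v} → G e v ≡ true → e ∈ rotV ρ v
    rotV-∈ sub p = Equivalence.from (rotV-mem ρ _ _) (sub _ _ p)

    -- `reverse (next G t)` arrives at the same node as `t`, one edge further in its rotation;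
    -- closure under this step therefore runs through the whole rotation.
    saturated : ∀ {G C} → G ⊆E inc H → (∀ {t} → t ∈ C → G ∋ᵗ t) → (∀ {t} → t ∈ C → reverse (next G t) ∈ C) →
      ∀ {t u} → t ∈ C → G ∋ᵗ u → target u ≡ target t → u ∈ C
    saturated {G} {C} sub inG turn {e , v , fromViolet} {e , w , fromViolet} t∈ Gu refl =
      cycSucc-orbit Fin._≟_ (rotE-uniq ρ e) {λ w → G e w} {λ w → (e , w , fromViolet) ∈ C} (λ _ i → turn i)
        (rotE-∈ sub (inG t∈)) (inG t∈) t∈ (rotE-∈ sub Gu) Gu
    saturated {G} {C} sub inG turn {e , v , fromEmerald} {d , v , fromEmerald} t∈ Gu refl =
      cycSucc-orbit Fin._≟_ (rotV-uniq ρ v) {λ d → G d v} {λ d → (d , v , fromEmerald) ∈ C} (λ _ i → turn i)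
        (rotV-∈ sub (inG t∈)) (inG t∈) t∈ (rotV-∈ sub Gu) Gu

    module _ {g : Fin m → ℕ} {G : EdgeSet m n} (sub : G ⊆E inc H) where

      Needed : List Traversal → Set
      Needed L = ∀ {e v} → (e , v , fromEmerald) ∈ L → ¬ HasTree (removeEdge G e v) g

      adj⇒traversal : ∀ {G : EdgeSet m n} {x y} → Adj G x y → ∃ λ u → source u ≡ y × target u ≡ x × G ∋ᵗ u
      adj⇒traversal (ev {e} {v} p) = (e , v , fromViolet) , refl , refl , p
      adj⇒traversal (ve {e} {v} p) = (e , v , fromEmerald) , refl , refl , p

      -- The edges of the tour lie in a common tree, so each is crossed both ways; then the rule for
      -- the next traversal exhausts the rotation at every visited node, and connectedness of `G`
      -- spreads the visit to all nodes.
      tour-complete : HasTree G g → ∀ c p → Linked (Follows G) (c ∷ p ++ [ c ]) → (∀ {t} → t ∈ c ∷ p → G ∋ᵗ t) →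
        Needed (c ∷ p) → ∀ e → ∃ λ v → ∃ λ s → (e , v , s) ∈ c ∷ p
      tour-complete ht c p linked inG needed e with tree-through-walk {g} {G} ht walk inG needed
        where
        walk : Walk (target c) (c ∷ p) (target c)
        walk = c ∷ linked-walk p linked
      ... | T , T⊆ , tree , inT with visit (hasTree-connected {G} {g} ht (target c) (inj₁ e)) (c , here refl , refl)
        where
        walk : Walk (target c) (c ∷ p) (target c)
        walk = c ∷ linked-walk p linked
        rev : ∀ {t} → t ∈ c ∷ p → reverse t ∈ c ∷ p
        rev = closed-walk-reverse {g} {T} tree walk inT
        shift : ∀ {t} → t ∈ c ∷ p → t ∈ p ++ [ c ]
        shift (here refl) = ∈-++⁺ʳ p (here refl)
        shift (there i)   = ∈-++⁺ˡ i
        visit : ∀ {x y} → Star (Adj G) x y → (∃ λ t → t ∈ c ∷ p × target t ≡ x) → ∃ λ t → t ∈ c ∷ p × target t ≡ y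
        visit ε r = r
        visit (a ◅ as) (t , t∈ , refl) with adj⇒traversal a
        ... | u , refl , tu , Gu = visit as (reverse u ,
                rev (saturated sub inG (λ i → rev (linked-next p linked (shift i))) t∈ Gu tu) , target-reverse u)
      ... | (e′ , v , fromViolet) , i , refl = v , fromViolet , i

      -- The walk starting with v → d and about to cross from d to v has explored everything beyond dv, so dv is a bridge.
      return-edge-needed : HasTree G g → ∀ d v p → Linked (Follows G) ((d , v , fromEmerald) ∷ p ++ [ d , v , fromViolet ]) →
        (∀ {t} → t ∈ p ++ [ d , v , fromViolet ] → G ∋ᵗ t) → Needed p → ¬ HasTree (removeEdge G d v) g
      return-edge-needed ht d v p linked inG needed ht⁻ with (d , v , fromEmerald) ∈ᵗ? p
      ... | yes i = needed i ht⁻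
      ... | no c∉ with tree-through-walk {g} {G} ht (walk-append (linked-walk p linked)) inG needed′
        where
        walk-append : ∀ {L y} → Walk (inj₁ d) L y → Walk (inj₂ v) (L ++ [ d , v , fromViolet ]) y
        walk-append []      = (d , v , fromViolet) ∷ []
        walk-append (t ∷ w) = t ∷ walk-append w
        needed′ : Needed (p ++ [ d , v , fromViolet ])
        needed′ i with ∈-++⁻ p i
        ... | inj₁ j = needed j
        ... | inj₂ (here ())
      ...   | T , T⊆ , tree , inT with reach (removeEdge T d v) (inj₁ d)
      ...     | X , (Xd , paths) , closed = outside (visit (hasTree-connected {removeEdge G d v} {g} ht⁻ (inj₁ d) (inj₂ v)) (inj₁ refl))
        where
        walk : Walk (inj₁ d) p (inj₁ d)
        walk = linked-walk p linked
        rev : ∀ {t} → t ∈ p → reverse t ∈ p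
        rev = closed-walk-reverse {g} {T} tree walk (inT ∘ ∈-++⁺ˡ)
        Xv : X (inj₂ v) ≡ false
        Xv = ¬true λ q → bridge (proj₁ tree) (treeWith-count {g = g} {T} tree) (inT (∈-++⁺ʳ p (here refl))) (star-sym (paths _ q))
        C = p ++ [ d , v , fromViolet ]
        Visited : Node m n → Set
        Visited x = x ≡ inj₁ d ⊎ (∃ λ t → t ∈ p × target t ≡ x)
        -- The traversal about to be made need not have its reverse in `p`, but `C` contains that
        -- reverse as its earliest traversal.
        turn : ∀ {t} → t ∈ C → reverse (next G t) ∈ C
        turn i = back (linked-next p linked i)
          where
          back : ∀ {t} → t ∈ (d , v , fromEmerald) ∷ p → reverse t ∈ C
          back (here refl) = ∈-++⁺ʳ p (here refl)
          back (there j)   = ∈-++⁺ˡ (rev j)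
        arrival : ∀ {x} → Visited x → ∃ λ t → t ∈ C × target t ≡ x
        arrival (inj₁ refl)           = _ , ∈-++⁺ʳ p (here refl) , refl
        arrival (inj₂ (t , i , eq))   = t , ∈-++⁺ˡ i , eq
        visit : ∀ {x y} → Star (Adj (removeEdge G d v)) x y → Visited x → Visited y
        visit ε r = r
        visit (a ◅ as) r with arrival r | adj⇒traversal a
        ... | t , t∈ , refl | u , refl , tu , Gu
          with ∈-++⁻ p (saturated {C = C} sub inG turn t∈ (removeEdge-⊆ G d v _ _ Gu) tu)
        ...   | inj₁ i           = visit as (inj₂ (reverse u , rev i , target-reverse u))
        ...   | inj₂ (here refl) = ⊥-elim (removeEdge-≢ G d v Gu refl refl)
        outside : ¬ Visited (inj₂ v)
        outside (inj₂ (t , i , eq)) with ∈-∃++ i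
        ... | L₁ , L₂ , refl = true≢false (subst (λ z → X z ≡ true) eq
              (stay {T} {X} (d , v , fromEmerald) closed Xv (t ∷ proj₁ (walk-split L₁ walk))
                (λ j → inT (∈-++⁺ˡ (∈-++⁺ʳ L₁ j))) (λ j → c∉ (∈-++⁺ʳ L₁ j)) Xd)) Xv

-- The Bernardi process

linked-prefix : ∀ {A : Set} {R : A → A → Set} p {z z₀ q} → Linked R (z ∷ p ++ z₀ ∷ q) → Linked R (z ∷ p ++ [ z₀ ])
linked-prefix []      (r ∷ _) = r ∷ [-]
linked-prefix (_ ∷ p) (r ∷ l) = r ∷ linked-prefix p l

remaining : Bool → Bool → ℕ
remaining present traversed = if present then (if traversed then 1 else 2) else 0

remaining-mono : ∀ {p p′ t t′} → (p′ ≡ true → p ≡ true) → (t ≡ true → t′ ≡ true) → remaining p′ t′ ≤ remaining p t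
remaining-mono {p′ = false} _ _ = z≤n
remaining-mono {p′ = true} {t′ = t′} p _ with p refl
remaining-mono {p′ = true} {t = false} {true}  _ _ | refl = s≤s z≤n
remaining-mono {p′ = true} {t = false} {false} _ _ | refl = ≤-refl
remaining-mono {p′ = true} {t = true} _ t | refl with t refl
... | refl = ≤-refl

remaining-removed : ∀ {p p′ t} → p′ ≡ false → p ≡ true → remaining p′ t < remaining p t
remaining-removed {t = true}  refl refl = s≤s z≤n
remaining-removed {t = false} refl refl = s≤s z≤n

remaining-traversed : ∀ {p t t′} → p ≡ true → t′ ≡ true → t ≡ false → remaining p t′ < remaining p t
remaining-traversed refl refl refl = ≤-refl

module _ {m n : ℕ} (H : Hypergraph m n) (ρ : Ribbon H) where

  open Tour ρ

  -- `linked` treats the current edge as a pending traversal from `e`, whether it will be traversed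
  -- or removed. `needed` refers to the current graph; removals preserve it, since a smaller graph
  -- has fewer trees.
  record Invariant (f : Vec ℕ m) (G : EdgeSet m n) (e : Fin m) (v : Fin n) (tr : List (Traversal {m} {n})) (h : List (Fin m)) : Set where
    field
      sub       : G ⊆E inc H
      hypertree : IsHypertreeIn G f
      current   : G e v ≡ true
      linked    : Linked (Follows G) ((e , v , fromEmerald) ∷ tr)
      present   : ∀ {t} → t ∈ tr → G ∋ᵗ t
      needed    : ∀ {e v} → (e , v , fromEmerald) ∈ tr → ¬ HasTree (removeEdge G e v) (lookup f)
      seen-here : e ∈ h
      seen      : ∀ {t} → t ∈ tr → proj₁ t ∈ h

  hasTree : ∀ G f → Fin m → IsHypertreeIn {m} {n} G f → HasTree G (lookup f)
  hasTree G f e₀ hyp = hypertree⇒treeWith {G = G} {f} e₀ hyp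

  isHypertree : ∀ G f → HasTree {m} {n} G (lookup f) → IsHypertreeIn G f
  isHypertree G f (T , sub , t) = treeWith⇒hypertree {G = G} {T} {f} sub t

  module _ {f : Vec ℕ m} {G : EdgeSet m n} {e : Fin m} {v : Fin n} {tr : List (Traversal {m} {n})} {h : List (Fin m)}
    (inv : Invariant f G e v tr h) where

    open Invariant inv

    private
      e-kept : e ∈ rotV ρ v
      e-kept = rotV-∈ sub current

    -- A traversal from the emerald end was made because the edge could not be spared; one from the
    -- violet end is covered by `return-edge-needed`. So removals leave the walk made so far intact.
    traversed-kept : IsHypertreeIn (removeEdge G e v) f → ∀ s → (e , v , s) ∉ tr
    traversed-kept hyp⁻ fromEmerald i = needed i (hasTree (removeEdge G e v) f e hyp⁻)
    traversed-kept hyp⁻ fromViolet i with ∈-∃++ i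
    ... | p , q , refl = return-edge-needed {g = lookup f} {G} sub (hasTree G f e hypertree) e v p (linked-prefix p linked)
      (λ j → present (shorten j)) (λ j → needed (∈-++⁺ˡ j)) (hasTree (removeEdge G e v) f e hyp⁻)
      where
      shorten : ∀ {t} → t ∈ p ++ [ e , v , fromViolet ] → t ∈ p ++ (e , v , fromViolet) ∷ q
      shorten j with ∈-++⁻ p j
      ... | inj₁ j′          = ∈-++⁺ˡ j′
      ... | inj₂ (here refl) = ∈-++⁺ʳ p (here refl)

    invariant-remove : IsHypertreeIn (removeEdge G e v) f →
      Invariant f (removeEdge G e v) e (succE (removeEdge G e v) e v) tr h
    invariant-remove hyp⁻ = record
      { sub = λ e′ v′ p → sub e′ v′ (removeEdge-⊆ G e v e′ v′ p)
      ; hypertree = hyp⁻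
      ; current = current′
      ; linked = relink linked present⁻
      ; present = present⁻
      ; needed = λ {e′} {v′} i ht → needed i (hasTree-mono {g = lookup f} (removeEdge-mono e′ v′ (removeEdge-⊆ G e v)) ht)
      ; seen-here = seen-here
      ; seen = seen }
      where
      G⁻ = removeEdge G e v
      v-kept : v ∈ rotE ρ e
      v-kept = rotE-∈ sub current
      present⁻ : ∀ {t} → t ∈ tr → G⁻ ∋ᵗ t
      present⁻ {e′ , v′ , s} i = removeEdge-keeps G e v (present i) λ {refl refl → traversed-kept hyp⁻ s i}
      -- The first step of a path from `e` to `v` in `G⁻` shows that `e` still has an edge.
      current′ : G⁻ e (succE G⁻ e v) ≡ true
      current′ with hasTree-connected {G = G⁻} {lookup f} (hasTree (removeEdge G e v) f e hyp⁻) (inj₁ e) (inj₂ v)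
      ... | ev p ◅ _ = cycSucc-kept Fin._≟_ (rotE-uniq ρ e) {λ w → G⁻ e w} v-kept (rotE-∈ sub (removeEdge-⊆ G e v _ _ p)) p
      stable : ∀ t → G⁻ ∋ᵗ next G t → next G t ≡ next G⁻ t
      stable (e′ , v′ , fromEmerald) p = cong (λ d → d , v′ , fromViolet) (sym (cycSucc-stable Fin._≟_ (rotV-uniq ρ v′)
        {λ d → G d v′} {λ d → G⁻ d v′} (removeEdge-⊆ G e v _ _) p))
      stable (e′ , v′ , fromViolet) p = cong (λ w → e′ , w , fromEmerald) (sym (cycSucc-stable Fin._≟_ (rotE-uniq ρ e′)
        {λ w → G e′ w} {λ w → G⁻ e′ w} (removeEdge-⊆ G e v _ _) p))
      restable : ∀ {L} → Linked (Follows G) L → (∀ {t} → t ∈ L → G⁻ ∋ᵗ t) → Linked (Follows G⁻) L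
      restable [] _ = []
      restable [-] _ = [-]
      restable {_ ∷ t ∷ _} (refl ∷ l) in⁻ = stable t (in⁻ (here refl)) ∷ restable l (in⁻ ∘ there)
      -- Older links persist because the traversals they lead to persist; at the head, the search
      -- resumes after the removed edge by `cycSucc-skip`.
      relink : ∀ {tr} → Linked (Follows G) ((e , v , fromEmerald) ∷ tr) → (∀ {t} → t ∈ tr → G⁻ ∋ᵗ t) →
        Linked (Follows G⁻) ((e , succE G⁻ e v , fromEmerald) ∷ tr)
      relink [-] _ = [-]
      relink {(e′ , v₀ , fromEmerald) ∷ _} (() ∷ l) in⁻
      relink {(e′ , v₀ , fromViolet) ∷ _} (eq ∷ l) in⁻ = head eq ∷ restable l in⁻
        where
        head : (e , v , fromEmerald) ≡ (e′ , succE G e′ v₀ , fromEmerald) → (e , succE G⁻ e v , fromEmerald) ≡ (e′ , succE G⁻ e′ v₀ , fromEmerald)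
        head refl = cong (λ w → e , w , fromEmerald) (cycSucc-skip Fin._≟_ (rotE-uniq ρ e) {λ w → G e w} {λ w → G⁻ e w}
          (rotE-∈ sub (removeEdge-⊆ G e v e v₀ (in⁻ (here refl)))) (in⁻ (here refl)) (λ {w} → removeEdge-⊆ G e v e w) (removeEdge-self G e v))

    invariant-traverse : ¬ IsHypertreeIn (removeEdge G e v) f → let d = succV G v e in
      Invariant f G d (succE G d v) ((d , v , fromViolet) ∷ (e , v , fromEmerald) ∷ tr) (h ++ [ d ])
    invariant-traverse ¬hyp⁻ = record
      { sub = sub ; hypertree = hypertree
      ; current = cycSucc-kept Fin._≟_ (rotE-uniq ρ d) {λ w → G d w} (rotE-∈ sub Gdv) (rotE-∈ sub Gdv) Gdv
      ; linked = refl ∷ refl ∷ linked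
      ; present = λ {(here refl) → Gdv ; (there (here refl)) → current ; (there (there i)) → present i}
      ; needed = λ {(there (here refl)) ht → ¬hyp⁻ (isHypertree (removeEdge G e v) f ht) ; (there (there i)) → needed i}
      ; seen-here = ∈-++⁺ʳ h (here refl)
      ; seen = λ {(here refl) → ∈-++⁺ʳ h (here refl) ; (there (here refl)) → ∈-++⁺ˡ seen-here ; (there (there i)) → ∈-++⁺ˡ (seen i)} }
      where
      d = succV G v e
      Gdv : G d v ≡ true
      Gdv = cycSucc-kept Fin._≟_ (rotV-uniq ρ v) {λ d → G d v} e-kept e-kept current

    -- The pending traversal repeats an earlier one, so what lies between is a closed tour, to which
    -- `tour-complete` applies.
    stopped-at-emerald : (e , v , fromEmerald) ∈ tr → ∀ x → x ∈ h
    stopped-at-emerald i x with ∈-∃++ i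
    ... | p , q , refl = found (tour-complete {g = lookup f} {G} sub (hasTree G f e hypertree) (e , v , fromEmerald) p (linked-prefix p linked)
        (λ {(here refl) → current ; (there j) → present (∈-++⁺ˡ j)}) (λ {(here refl) → needed i ; (there j) → needed (∈-++⁺ˡ j)}) x)
      where
      found : (∃ λ w → ∃ λ s → (x , w , s) ∈ (e , v , fromEmerald) ∷ p) → x ∈ h
      found (_ , _ , here refl) = seen-here
      found (_ , _ , there j)   = seen (∈-++⁺ˡ j)

    -- The repetition occurs one traversal after the current edge, so the pending traversal of `ev`
    -- belongs to the tour; it is admissible there because the removal was refused.
    stopped-at-violet : ¬ IsHypertreeIn (removeEdge G e v) f → (succV G v e , v , fromViolet) ∈ tr → ∀ x → x ∈ h
    stopped-at-violet ¬hyp⁻ i x with ∈-∃++ i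
    ... | p , q , refl = found (tour-complete {g = lookup f} {G} sub (hasTree G f e hypertree) (succV G v e , v , fromViolet) ((e , v , fromEmerald) ∷ p)
        (refl ∷ linked-prefix p linked)
        (λ {(here refl) → present i ; (there (here refl)) → current ; (there (there j)) → present (∈-++⁺ˡ j)})
        (λ {(there (here refl)) ht → ¬hyp⁻ (isHypertree (removeEdge G e v) f ht) ; (there (there j)) → needed (∈-++⁺ˡ j)}) x)
      where
      found : (∃ λ w → ∃ λ s → (x , w , s) ∈ (succV G v e , v , fromViolet) ∷ (e , v , fromEmerald) ∷ p) → x ∈ h
      found (_ , _ , here refl)         = seen i
      found (_ , _ , there (here refl)) = seen-here
      found (_ , _ , there (there j))   = seen (∈-++⁺ˡ j)

  traversed : List (Traversal {m} {n}) → Fin m → Fin n → Bool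
  traversed tr e v = ⌊ (e , v , fromEmerald) ∈ᵗ? tr ⌋

  traversed-complete : ∀ tr e v → (e , v , fromEmerald) ∈ tr → traversed tr e v ≡ true
  traversed-complete tr e v i with (e , v , fromEmerald) ∈ᵗ? tr
  ... | yes _ = refl
  ... | no k  = contradiction i k

  traversed-sound : ∀ tr e v → traversed tr e v ≡ true → (e , v , fromEmerald) ∈ tr
  traversed-sound tr e v p with (e , v , fromEmerald) ∈ᵗ? tr
  ... | yes i = i

  -- Each edge can still be removed once and traversed from its emerald end once.
  fuel : EdgeSet m n → List (Traversal {m} {n}) → ℕ
  fuel G tr = ∑ λ e → ∑ λ v → remaining (G e v) (traversed tr e v)

  fuel-< : ∀ G G′ tr tr′ e v → G′ ⊆E G → (∀ {t} → t ∈ tr → t ∈ tr′) →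
    remaining (G′ e v) (traversed tr′ e v) < remaining (G e v) (traversed tr e v) → fuel G′ tr′ < fuel G tr
  fuel-< G G′ tr tr′ e v sub tsub lt = ∑-mono-< {m} (λ e → ∑-mono {n} (mono e)) e (∑-mono-< {n} (mono e) v lt)
    where
    mono : ∀ e v → remaining (G′ e v) (traversed tr′ e v) ≤ remaining (G e v) (traversed tr e v)
    mono e v = remaining-mono {G e v} {G′ e v} (sub e v) λ i → traversed-complete tr′ e v (tsub (traversed-sound tr e v i))

  fuel-remove : ∀ G tr e v → G e v ≡ true → fuel (removeEdge G e v) tr < fuel G tr
  fuel-remove G tr e v Gev = fuel-< G (removeEdge G e v) tr tr e v (removeEdge-⊆ G e v) (λ i → i)
    (remaining-removed (removeEdge-self G e v) Gev)

  fuel-traverse : ∀ G tr e v t → G e v ≡ true → (e , v , fromEmerald) ∉ tr → fuel G (t ∷ (e , v , fromEmerald) ∷ tr) < fuel G tr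
  fuel-traverse G tr e v t Gev k = fuel-< G G tr (t ∷ (e , v , fromEmerald) ∷ tr) e v (λ _ _ p → p) (there ∘ there)
    (remaining-traversed Gev (traversed-complete (t ∷ (e , v , fromEmerald) ∷ tr) e v (there (here refl))) (¬true (k ∘ traversed-sound tr e v)))

  -- The decision tree of the process

  record State : Set where
    constructor state
    field
      graph : EdgeSet m n
      at-e  : Fin m
      at-v  : Fin n
      trav  : List (Traversal {m} {n})
      hist  : List (Fin m)

  -- `F` consists of hypertrees whose runs share the state. Appending all of `allFin m` to `h`
  -- stands for the fixed order on the hyperedges not met, since `Before` ignores repetitions.
  Runs : State → List (Vec ℕ m) → Set
  Runs (state G e v tr h) F = ∃ λ (tail : Vec ℕ m → List (Fin m × Fin n)) →
    (∀ {f} → f ∈ F → Process.Run H ρ f G (e , v) tr ((e , v) ∷ tail f)) ×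
    (∀ k → count (inc H) k F (λ f → h ++ map proj₁ (tail f)) ≡ count (inc H) k F (λ _ → h ++ allFin m))

  Good : State → List (Vec ℕ m) → Set
  Good (state G e v tr h) F = Unique F × (∀ {f} → f ∈ F → Hall (inc H) (lookup f)) × LineClosed (inc H) F h × (∀ {f} → f ∈ F → Invariant f G e v tr h)

  module Split {G e v tr h F} (good : Good (state G e v tr h) F) (Gev : G e v ≡ true) where

    private
      G⁻ = removeEdge G e v
      uniq = proj₁ good
      halls : ∀ {f} → f ∈ F → Hall (inc H) (lookup f)
      halls = proj₁ (proj₂ good)
      closed : LineClosed (inc H) F h
      closed = proj₁ (proj₂ (proj₂ good))
      invs : ∀ {f} → f ∈ F → Invariant f G e v tr h
      invs = proj₂ (proj₂ (proj₂ good))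

    removable? : ∀ f → Dec (IsHypertreeIn G⁻ f)
    removable? = hypertree? e G⁻

    removed kept : List (Vec ℕ m)
    removed = filter removable? F
    kept = filter (¬? ∘ removable?) F

    removed-∈ : ∀ {f} → f ∈ removed → f ∈ F × IsHypertreeIn G⁻ f
    removed-∈ = ∈-filter⁻ removable? {xs = F}

    kept-∈ : ∀ {f} → f ∈ kept → f ∈ F × ¬ IsHypertreeIn G⁻ f
    kept-∈ = ∈-filter⁻ (¬? ∘ removable?) {xs = F}

    private
      invariance : ∀ {f f′ a b} → f ∈ F → f′ ∈ F → Move (lookup f) (lookup f′) b a → b ≢ a → ¬ Transfer (inc H) (lookup f) b e →
        IsHypertreeIn G⁻ f → IsHypertreeIn G⁻ f′
      invariance {f} {f′} i i′ mv ne ¬t hyp⁻ = hall⇒hypertree {G = G⁻} {f′} e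
        (removal-invariant {G₀ = inc H} {G} {lookup f} {lookup f′} mv (Invariant.sub (invs i)) Gev ne (halls i) (halls i′) ¬t
          (hypertree⇒hall {G = G} {f′} e (Invariant.hypertree (invs i′))) (hypertree⇒hall {G = G⁻} {f} e hyp⁻))

    removed-closed : LineClosed (inc H) removed h
    removed-closed {f} {f′} i mv ne a∉ b∉ ¬t hall′ = ∈-filter⁺ removable? f′∈
      (invariance f∈ f′∈ mv ne (¬t e (Invariant.seen-here (invs f∈))) (proj₂ (removed-∈ i)))
      where
      f∈ = proj₁ (removed-∈ i)
      f′∈ = closed f∈ mv ne a∉ b∉ ¬t hall′

    kept-closed : LineClosed (inc H) kept h
    kept-closed {f} {f′} {a} {b} i mv ne a∉ b∉ ¬t hall′ = ∈-filter⁺ (¬? ∘ removable?) f′∈ λ hyp⁻ →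
      proj₂ (kept-∈ i) (invariance f′∈ f∈ (move-sym mv) (λ r → ne (sym r))
        -- A transfer from `a` to `e` at `f′` is a transfer from `b` to `e` at `f`.
        (λ (g″ , mv″ , h″) → ¬t e (Invariant.seen-here (invs f∈)) (g″ , move-trans mv mv″ , h″)) hyp⁻)
      where
      f∈ = proj₁ (kept-∈ i)
      f′∈ = closed f∈ mv ne a∉ b∉ ¬t hall′

    removed-good : Good (state G⁻ e (succE G⁻ e v) tr h) removed
    removed-good = Uniqueₚ.filter⁺ removable? uniq , (λ i → halls (proj₁ (removed-∈ i))) , removed-closed ,
      λ i → invariant-remove (invs (proj₁ (removed-∈ i))) (proj₂ (removed-∈ i))

    traversed-good : let d = succV G v e in
      Good (state G d (succE G d v) ((d , v , fromViolet) ∷ (e , v , fromEmerald) ∷ tr) (h ++ [ d ])) kept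
    traversed-good = Uniqueₚ.filter⁺ (¬? ∘ removable?) uniq , (λ i → halls (proj₁ (kept-∈ i))) ,
      lineClosed-⊆ (inc H) {F = kept} {h} {h ++ [ succV G v e ]} ∈-++⁺ˡ kept-closed ,
      λ i → invariant-traverse (invs (proj₁ (kept-∈ i))) (proj₂ (kept-∈ i))

    KeptRuns : Set
    KeptRuns = ∃ λ (tail : Vec ℕ m → List (Fin m × Fin n)) →
        (∀ {f} → f ∈ kept → Process.Run H ρ f G (e , v) tr ((e , v) ∷ tail f)) ×
        (∀ k → count (inc H) k kept (λ f → h ++ map proj₁ (tail f)) ≡ count (inc H) k kept (λ _ → h ++ allFin m))

    combine : Runs (state G⁻ e (succE G⁻ e v) tr h) removed →
      KeptRuns →
      Runs (state G e v tr h) F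
    combine (tail₁ , runs₁ , counts₁) (tail₂ , runs₂ , counts₂) = tail , runs , counts
      where
      pick : ∀ f → Dec (IsHypertreeIn G⁻ f) → List (Fin m × Fin n)
      pick f (yes _) = (e , succE G⁻ e v) ∷ tail₁ f
      pick f (no _)  = tail₂ f
      tail : Vec ℕ m → List (Fin m × Fin n)
      tail f = pick f (removable? f)
      pick-yes : ∀ {f} d → IsHypertreeIn G⁻ f → pick f d ≡ (e , succE G⁻ e v) ∷ tail₁ f
      pick-yes (yes _) hyp = refl
      pick-yes (no k)  hyp = contradiction hyp k
      pick-no : ∀ {f} d → ¬ IsHypertreeIn G⁻ f → pick f d ≡ tail₂ f
      pick-no (yes hyp) k = contradiction hyp k
      pick-no (no _)    k = refl
      runs : ∀ {f} → f ∈ F → Process.Run H ρ f G (e , v) tr ((e , v) ∷ tail f)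
      runs {f} i = go (removable? f)
        where
        go : ∀ d → Process.Run H ρ f G (e , v) tr ((e , v) ∷ pick f d)
        go (yes hyp) = Process.remove hyp (runs₁ (∈-filter⁺ removable? i hyp))
        go (no k)    = runs₂ (∈-filter⁺ (¬? ∘ removable?) i k)
      counts : ∀ k → count (inc H) k F (λ f → h ++ map proj₁ (tail f)) ≡ count (inc H) k F (λ _ → h ++ allFin m)
      counts k = trans (sumOver-filter removable? (λ f → b2n (inactivity (inc H) f (h ++ map proj₁ (tail f)) =ᵇ k)) F)
        (trans (cong₂ _+_
          (trans (sumOver-cong removed first) (counts₁ k))
          (trans (sumOver-cong kept λ {f} i → cong (λ t → b2n (inactivity (inc H) f (h ++ map proj₁ t) =ᵇ k)) (pick-no (removable? f) (proj₂ (kept-∈ i)))) (counts₂ k)))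
        (sym (sumOver-filter removable? (λ f → b2n (inactivity (inc H) f (h ++ allFin m) =ᵇ k)) F)))
        where
        first : ∀ {f} → f ∈ removed → b2n (inactivity (inc H) f (h ++ map proj₁ (tail f)) =ᵇ k) ≡ b2n (inactivity (inc H) f (h ++ map proj₁ (tail₁ f)) =ᵇ k)
        first {f} i = trans (cong (λ t → b2n (inactivity (inc H) f (h ++ map proj₁ t) =ᵇ k)) (pick-yes (removable? f) (proj₂ (removed-∈ i))))
          (cong (λ c → b2n (c =ᵇ k)) (inactivity-cong (inc H) f (before-dropˡ h e∈h) (before-dropʳ h e∈h)))
          where
          e∈h = Invariant.seen-here (invs (proj₁ (removed-∈ i)))

    stop-runs : (∀ {f} → f ∈ kept → Process.Run H ρ f G (e , v) tr [ e , v ]) → (∀ {f} → f ∈ kept → ∀ x → x ∈ h) →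
      KeptRuns
    stop-runs runs all-seen = (λ _ → []) , runs , λ k → sumOver-cong kept λ {f} i → cong (λ c → b2n (c =ᵇ k))
      (inactivity-cong (inc H) f (before-prefix h λ _ ()) (before-prefix h λ x∉ _ → contradiction (all-seen i _) x∉))

    -- Besides the start, the order changes only here. The recursive call compares with `d` in front
    -- of `allFin m`; `count-prepend` then returns `d` to its fixed position.
    traverse-runs : (e , v , fromEmerald) ∉ tr → (succV G v e , v , fromViolet) ∉ tr →
      let d = succV G v e in Runs (state G d (succE G d v) ((d , v , fromViolet) ∷ (e , v , fromEmerald) ∷ tr) (h ++ [ d ])) kept →
      KeptRuns
    traverse-runs e∉ d∉ (tail , runs , counts) = (λ f → (d , succE G d v) ∷ tail f) ,
      (λ i → Process.traverse (proj₂ (kept-∈ i)) e∉ d∉ (runs i)) ,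
      λ k → trans (sumOver-cong kept λ {f} _ → cong (λ o → b2n (inactivity (inc H) f o =ᵇ k)) (sym (++-assoc h [ d ] (map proj₁ (tail f)))))
        (trans (counts k) (trans (cong (λ o → count (inc H) k kept (λ _ → o)) (++-assoc h [ d ] (allFin m)))
          (count-prepend (inc H) kept (Uniqueₚ.filter⁺ (¬? ∘ removable?) uniq) (λ i → halls (proj₁ (kept-∈ i))) k h d kept-closed (∈-allFin d))))
      where
      d = succV G v e

  process-runs : ∀ k G e v tr h F → fuel G tr < k → Good (state G e v tr h) F → Runs (state G e v tr h) F
  process-runs zero G e v tr h F () good
  -- No hypertree reaches this state, so there is no invariant to show that the current edge is
  -- present.
  process-runs (suc k) G e v tr h [] lt good = (λ _ → []) , (λ ()) , λ _ → refl
  process-runs (suc k) G e v tr h F@(_ ∷ _) lt good = combine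
    (process-runs k (removeEdge G e v) e (succE (removeEdge G e v) e v) tr h removed
      (≤-trans (fuel-remove G tr e v Gev) (ℕₚ.≤-pred lt)) removed-good)
    keep
    where
    invs : ∀ {f} → f ∈ F → Invariant f G e v tr h
    invs = proj₂ (proj₂ (proj₂ good))
    Gev : G e v ≡ true
    Gev = Invariant.current (invs (here refl))
    open Split {G} {e} {v} {tr} {h} {F} good Gev
    keep : KeptRuns
    keep with (e , v , fromEmerald) ∈ᵗ? tr | (succV G v e , v , fromViolet) ∈ᵗ? tr
    ... | yes i | _ = stop-runs (λ j → Process.stopE (proj₂ (kept-∈ j)) i)
          (λ j → stopped-at-emerald (invs (proj₁ (kept-∈ j))) i)
    ... | no k₁ | yes i = stop-runs (λ j → Process.stopV (proj₂ (kept-∈ j)) k₁ i)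
          (λ j → stopped-at-violet (invs (proj₁ (kept-∈ j))) (proj₂ (kept-∈ j)) i)
    ... | no k₁ | no k₂ = traverse-runs k₁ k₂
          (process-runs k G (succV G v e) (succE G (succV G v e) v) ((succV G v e , v , fromViolet) ∷ (e , v , fromEmerald) ∷ tr)
            (h ++ [ succV G v e ]) kept (≤-trans (fuel-traverse G tr e v (succV G v e , v , fromViolet) Gev k₁) (ℕₚ.≤-pred lt))
            traversed-good)

-- Counting hypertrees

hasCard-unique : ∀ {A : Set} {P : A → Set} {j k} → HasCard P j → HasCard P k → j ≡ k
hasCard-unique (xs , ux , mx , refl) (ys , uy , my , refl) = ℕₚ.≤-antisym
  (length-⊆ ux λ i → Equivalence.from (my _) (Equivalence.to (mx _) i))
  (length-⊆ uy λ i → Equivalence.from (mx _) (Equivalence.to (my _) i))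

hasCard-countIf : ∀ {A : Set} {P : A → Set} {p : A → Bool} {xs} → Unique xs →
  (∀ x → (x ∈ xs × p x ≡ true) ⇔ P x) → HasCard P (countIf p xs)
hasCard-countIf {p = p} {xs} u mem = filter p? xs , Uniqueₚ.filter⁺ p? u ,
  (λ x → mk⇔ (Equivalence.to (mem x) ∘ ∈-filter⁻ p? {xs = xs}) λ Px → let i , px = Equivalence.from (mem x) Px in ∈-filter⁺ p? i px) ,
  countIf-filter p xs
  where
  p? = λ x → p x Bool.≟ true

countIf-tabulate : ∀ {A : Set} {k} (p : A → Bool) (g : Fin k → A) → countIf p (List.tabulate g) ≡ card (p ∘ g)
countIf-tabulate {k = zero}  p g = refl
countIf-tabulate {k = suc k} p g = cong (b2n (p (g zero)) +_) (countIf-tabulate p (g ∘ suc))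

vectorsBelow : ℕ → ∀ k → List (Vec ℕ k)
vectorsBelow b zero    = [ Vec.[] ]
vectorsBelow b (suc k) = cartesianProductWith Vec._∷_ (upTo b) (vectorsBelow b k)

vectorsBelow-unique : ∀ b k → Unique (vectorsBelow b k)
vectorsBelow-unique b zero    = [] ∷ []
vectorsBelow-unique b (suc k) = Uniqueₚ.cartesianProductWith⁺ Vec._∷_ Vecₚ.∷-injective (Uniqueₚ.upTo⁺ b) (vectorsBelow-unique b k)

∈-vectorsBelow : ∀ {b k} (f : Vec ℕ k) → (∀ e → lookup f e < b) → f ∈ vectorsBelow b k
∈-vectorsBelow Vec.[]       below = here refl
∈-vectorsBelow (x Vec.∷ f) below = ∈-cartesianProductWith⁺ Vec._∷_ (∈-upTo⁺ (below zero)) (∈-vectorsBelow f (below ∘ suc))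

-- An arbitrary injective `g` takes the place of the identity because the induction passes from `g`
-- to `g ∘ suc`.
before-tabulate : ∀ {k l} (g : Fin k → Fin l) → (∀ {i j} → g i ≡ g j → i ≡ j) → ∀ i j → Before (List.tabulate g) (g i) (g j) ⇔ (i Fin.< j)
before-tabulate g inj zero zero = mk⇔ (λ (ne , _) → contradiction refl ne) λ ()
before-tabulate g inj zero (suc j) = mk⇔ (λ _ → s≤s z≤n) λ _ → (λ eq → case (inj eq)) , inj₁ refl
  where
  case : ¬ Fin.zero ≡ suc j
  case ()
before-tabulate g inj (suc i) zero = mk⇔ (λ (ne , _) → contradiction refl ne) λ ()
before-tabulate g inj (suc i) (suc j) = mk⇔
  (λ { (_ , inj₁ eq) → case (inj eq) ; (_ , inj₂ b) → s≤s (Equivalence.to (before-tabulate (g ∘ suc) (suc-injective ∘ inj) i j) b) })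
  λ { (s≤s lt) → (λ eq → case′ (inj eq)) , inj₂ (Equivalence.from (before-tabulate (g ∘ suc) (suc-injective ∘ inj) i j) lt) }
  where
  case : ∀ {X : Set} → Fin.suc i ≡ zero → X
  case ()
  case′ : ¬ Fin.zero ≡ suc j
  case′ ()

before-currentOrder : ∀ {m n : ℕ} (L : List (Fin m × Fin n)) p e → Before (map proj₁ L) p e ⇔ CurrentOrder L p e
before-currentOrder [] p e = mk⇔ (λ ()) λ ()
before-currentOrder ((x , v) ∷ L) p e = mk⇔ to from
  where
  ih = before-currentOrder L p e
  to : Before (x ∷ map proj₁ L) p e → CurrentOrder ((x , v) ∷ L) p e
  to (ne , inj₁ refl) = zero , refl , λ { zero eq → contradiction eq ne ; (suc j) _ → s≤s z≤n }
  to (ne , inj₂ b) with Equivalence.to ih b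
  ... | i , eq , first = suc i , eq , λ { zero eq′ → contradiction eq′ ne ; (suc j) eq′ → s≤s (first j eq′) }
  from : CurrentOrder ((x , v) ∷ L) p e → Before (x ∷ map proj₁ L) p e
  from (zero , eq , first) = (λ eq′ → case (first zero eq′)) , inj₁ (sym eq)
    where
    case : ¬ Fin.zero {length L} Fin.< Fin.zero {length L}
    case ()
  from (suc i , eq , first) = (λ eq′ → case (first zero eq′)) ,
    inj₂ (Equivalence.from ih (i , eq , λ j eq′ → ℕₚ.≤-pred (first (suc j) eq′)))
    where
    case : ¬ Fin.suc i Fin.< Fin.zero {length L}
    case ()

module _ {m n : ℕ} (H : Hypergraph m n) where

  internallyInactive⇔inactive : ∀ {_≺_ : Fin m → Fin m → Set} {f o} → Fin m → (∀ p e → Before o p e ⇔ (p ≺ e)) →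
    ∀ e → InternallyInactive (inc H) _≺_ f e ⇔ Inactive (inc H) f o e
  internallyInactive⇔inactive {_≺_} {f} {o} e₀ order e = mk⇔ to from
    where
    to : InternallyInactive (inc H) _≺_ f e → Inactive (inc H) f o e
    to (p , lt , fe , hyp) = p , bp , _ , move-isMove {m} {n} f (λ r → before-≢ o bp (sym r)) fe , hypertree⇒hall {G = inc H} {move {m} {n} f e p} e₀ hyp
      where
      bp = Equivalence.from (order p e) lt
    from : Inactive (inc H) f o e → InternallyInactive (inc H) _≺_ f e
    from (p , bp , t) with (λ r → before-≢ o bp (sym r))
    ... | ne with transfer⇒move {m} {n} (inc H) {f} ne t
    ...   | mv , hall = p , Equivalence.to (order p e) bp , move-source ne mv , hall⇒hypertree {G = inc H} {move {m} {n} f e p} e₀ hall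

  inactiveCount⇔ : ∀ {_≺_ : Fin m → Fin m → Set} {f o k} → Fin m → (∀ p e → Before o p e ⇔ (p ≺ e)) →
    (inactivity (inc H) f o =ᵇ k) ≡ true ⇔ InactiveCount (inc H) _≺_ f k
  inactiveCount⇔ {_≺_} {f} {o} {k} e₀ order = mk⇔
    (λ eq → subst (InactiveCount (inc H) _≺_ f) (⌊⌋-sound eq) counted)
    (λ c → ⌊⌋-complete (hasCard-unique counted c))
    where
    equiv = internallyInactive⇔inactive {_≺_} {f} {o} e₀ order
    counted : InactiveCount (inc H) _≺_ f (inactivity (inc H) f o)
    counted = subst (HasCard (InternallyInactive (inc H) _≺_ f)) (countIf-tabulate (inactive (inc H) f o) (λ e → e))
      (hasCard-countIf (Uniqueₚ.allFin⁺ m) λ e → mk⇔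
        (λ (_ , i) → Equivalence.from (equiv e) (⌊⌋-sound i))
        (λ i → ∈-allFin e , ⌊⌋-complete (Equivalence.to (equiv e) i)))

  -- The bound `n` loses nothing: the values of a hypertree sum to `n - 1`.
  hypertrees : Fin m → List (Vec ℕ m)
  hypertrees e₀ = filter (hypertree? e₀ (inc H)) (vectorsBelow n m)

  hypertrees-unique : ∀ e₀ → Unique (hypertrees e₀)
  hypertrees-unique e₀ = Uniqueₚ.filter⁺ (hypertree? e₀ (inc H)) (vectorsBelow-unique n m)

  hypertrees-∈ : ∀ e₀ {f} → f ∈ hypertrees e₀ → IsHypertreeIn (inc H) f
  hypertrees-∈ e₀ i = proj₂ (∈-filter⁻ (hypertree? e₀ (inc H)) {xs = vectorsBelow n m} i)

  ∈-hypertrees : ∀ e₀ {f} → IsHypertreeIn (inc H) f → f ∈ hypertrees e₀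
  ∈-hypertrees e₀ {f} hyp = ∈-filter⁺ (hypertree? e₀ (inc H)) (∈-vectorsBelow f λ e →
    ≤-trans (s≤s (term≤∑ (lookup f) e)) (≤-reflexive (proj₁ (hypertree⇒hall {G = inc H} {f} e₀ hyp)))) hyp

  hasCard-hypertrees : ∀ e₀ {Q : Vec ℕ m → Set} (q : Vec ℕ m → Bool) → (∀ {f} → IsHypertreeIn (inc H) f → (q f ≡ true) ⇔ Q f) →
    HasCard (λ f → IsHypertreeIn (inc H) f × Q f) (countIf q (hypertrees e₀))
  hasCard-hypertrees e₀ q equiv = hasCard-countIf (hypertrees-unique e₀) λ f → mk⇔
    (λ (i , qf) → let hyp = hypertrees-∈ e₀ i in hyp , Equivalence.to (equiv hyp) qf)
    (λ (hyp , Qf) → ∈-hypertrees e₀ hyp , Equivalence.from (equiv hyp) Qf)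

  -- `IeBar` asserts that some run has a given count; uniqueness of the run turns this into a
  -- statement on the run constructed here.
  run-deterministic : ∀ {ρ : Ribbon H} {f G c tr L L′} → Process.Run H ρ f G c tr L → Process.Run H ρ f G c tr L′ → L ≡ L′
  run-deterministic (Process.remove h r) (Process.remove h′ r′) = cong (_ ∷_) (run-deterministic r r′)
  run-deterministic (Process.remove h r) (Process.stopE k _) = contradiction h k
  run-deterministic (Process.remove h r) (Process.stopV k _ _) = contradiction h k
  run-deterministic (Process.remove h r) (Process.traverse k _ _ _) = contradiction h k
  run-deterministic (Process.stopE k _) (Process.remove h r) = contradiction h k
  run-deterministic (Process.stopE k i) (Process.stopE _ _) = refl
  run-deterministic (Process.stopE k i) (Process.stopV _ j _) = contradiction i j
  run-deterministic (Process.stopE k i) (Process.traverse _ j _ _) = contradiction i j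
  run-deterministic (Process.stopV k _ _) (Process.remove h r) = contradiction h k
  run-deterministic (Process.stopV k j i) (Process.stopE _ i′) = contradiction i′ j
  run-deterministic (Process.stopV k j i) (Process.stopV _ _ _) = refl
  run-deterministic (Process.stopV k j i) (Process.traverse _ _ j′ _) = contradiction i j′
  run-deterministic (Process.traverse k _ _ _) (Process.remove h r) = contradiction h k
  run-deterministic (Process.traverse k j _ _) (Process.stopE _ i) = contradiction i j
  run-deterministic (Process.traverse k _ j _) (Process.stopV _ _ i) = contradiction i j
  run-deterministic (Process.traverse k _ _ r) (Process.traverse _ _ _ r′) = cong (_ ∷_) (run-deterministic r r′)

  runFrom-deterministic : ∀ {ρ : Ribbon H} {f} (b : Base H) {L L′} → Process.RunFrom H ρ f b L → Process.RunFrom H ρ f b L′ → L ≡ L′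
  runFrom-deterministic (baseE _ _ _) r r′ = run-deterministic r r′
  runFrom-deterministic (baseV _ _ _) r r′ = run-deterministic r r′

  -- The start of the process and the comparison of coefficients

  module _ (ρ : Ribbon H) where

    open Tour ρ

    startE : Base H → Fin m
    startE (baseE b₀ _ _) = b₀
    startE (baseV _ b₁ _) = b₁

    startV : Base H → Fin n
    startV (baseE _ b₁ _) = b₁
    startV (baseV b₀ b₁ _) = succE (inc H) b₁ b₀

    startTraversals : Base H → List (Traversal {m} {n})
    startTraversals (baseE _ _ _) = []
    startTraversals (baseV b₀ b₁ _) = [ b₁ , b₀ , fromViolet ]

    startRun : ∀ {f} b {L} → Process.Run H ρ f (inc H) (startE b , startV b) (startTraversals b) L → Process.RunFrom H ρ f b L
    startRun (baseE _ _ _) r = r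
    startRun (baseV _ _ _) r = r

    startInvariant : ∀ b {f} → IsHypertreeIn (inc H) f → Invariant H ρ f (inc H) (startE b) (startV b) (startTraversals b) [ startE b ]
    startInvariant (baseE b₀ b₁ p) hyp = record
      { sub = λ _ _ q → q ; hypertree = hyp ; current = p ; linked = [-]
      ; present = λ () ; needed = λ () ; seen-here = here refl ; seen = λ () }
    startInvariant (baseV b₀ b₁ p) hyp = record
      { sub = λ _ _ q → q ; hypertree = hyp
      ; current = cycSucc-kept Fin._≟_ (rotE-uniq ρ b₁) {λ w → (inc H) b₁ w} (rotE-∈ {G = inc H} (λ _ _ q → q) p) (rotE-∈ {G = inc H} (λ _ _ q → q) p) p
      ; linked = refl ∷ [-]
      ; present = λ { (here refl) → p } ; needed = λ { (here ()) ; (there ()) }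
      ; seen-here = here refl ; seen = λ { (here refl) → here refl } }

    module _ (b : Base H) where

      private
        e₀ = startE b
        F = hypertrees e₀
        halls : ∀ {f} → f ∈ F → Hall (inc H) (lookup f)
        halls {f} i = hypertree⇒hall {G = inc H} {f} e₀ (hypertrees-∈ e₀ i)
        closed : ∀ {h} → LineClosed {m} {n} (inc H) F h
        closed {f′ = f′} _ _ _ _ _ _ hall′ = ∈-hypertrees e₀ (hall⇒hypertree {G = inc H} {f′} e₀ hall′)

      private
        coefficients-from-runs : Runs H ρ (state (inc H) e₀ (startV b) (startTraversals b) [ e₀ ]) F →
          ∀ k → ∃ λ c → InteriorCoeff H k c × TildeCoeff H ρ b k c
        coefficients-from-runs (tail , runs , counts) k = _ ,
          hasCard-hypertrees e₀ (λ f → inactivity (inc H) f (allFin m) =ᵇ k)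
            (λ {f} _ → inactiveCount⇔ {f = f} e₀ (before-tabulate (λ e → e) (λ eq → eq))) ,
          subst (TildeCoeff H ρ b k) same-count
            (hasCard-hypertrees e₀ (λ f → inactivity (inc H) f (e₀ ∷ map proj₁ (tail f)) =ᵇ k) equiv)
          where
          same-count : countIf (λ f → inactivity (inc H) f (e₀ ∷ map proj₁ (tail f)) =ᵇ k) F
            ≡ countIf (λ f → inactivity (inc H) f (allFin m) =ᵇ k) F
          -- With empty `h`, `count-prepend` moves the starting hyperedge from the front to its
          -- fixed position.
          same-count = trans (counts k) (count-prepend (inc H) F (hypertrees-unique e₀) halls k [] e₀ closed (∈-allFin e₀))
          equiv : ∀ {f} → IsHypertreeIn (inc H) f → (inactivity (inc H) f (e₀ ∷ map proj₁ (tail f)) =ᵇ k) ≡ true ⇔ IeBar H ρ b f k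
          equiv {f} hyp = mk⇔ (λ eq → L , run , Equivalence.to counted eq) from
            where
            L : List (Fin m × Fin n)
            L = (e₀ , startV b) ∷ tail f
            run : Process.RunFrom H ρ f b L
            run = startRun b (runs (∈-hypertrees e₀ hyp))
            counted : (inactivity (inc H) f (map proj₁ L) =ᵇ k) ≡ true ⇔ InactiveCount (inc H) (CurrentOrder L) f k
            counted = inactiveCount⇔ {f = f} e₀ (before-currentOrder L)
            from : IeBar H ρ b f k → (inactivity (inc H) f (map proj₁ L) =ᵇ k) ≡ true
            from (L′ , run′ , c) = Equivalence.from counted
              (subst (λ L → InactiveCount (inc H) (CurrentOrder L) f k) (runFrom-deterministic {ρ} {f} b run′ run) c)

      coefficients-agree : ∀ k → ∃ λ c → InteriorCoeff H k c × TildeCoeff H ρ b k c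
      coefficients-agree = coefficients-from-runs
        (process-runs H ρ (suc (fuel H ρ (inc H) (startTraversals b))) (inc H) e₀ (startV b) (startTraversals b) [ e₀ ] F ≤-refl
          (hypertrees-unique e₀ , halls , closed , λ i → startInvariant b (hypertrees-∈ e₀ i)))

theorem5p4 : {m n : ℕ} (H : Hypergraph m n) → Connected (inc H) →
    (ρ : Ribbon H) (b : Base H) →
    (k : ℕ) → ∃ λ c → InteriorCoeff H k c × TildeCoeff H ρ b k c
theorem5p4 H _ ρ b k = coefficients-agree H ρ b k
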